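{- Let $h$ be a height function, $f$ the function defined by the octahedron recurrence, $\mathcal{G}$ the crosses-and-wrenches graph of $h$ with its edge labels, and for $(n,i,j)\in\mathcal{U}$ let $G_{(n,i,j)}$ be the finite subgraph with open faces described below. Then: (1) For every $(n,i,j)\in\mathcal{U}$, $$f(n,i,j)=\sum_{M}\ \prod_{e\in M\cap E_w}\lambda(e)\prod_{F}x(F)^{\epsilon_M(F)},$$ where $M$ ranges over all perfect matchings of $G_{(n,i,j)}$, $F$ ranges over all faces (closed and open) of $G_{(n,i,j)}$, $\lambda(e)$ is the label of the weighted edge $e$, and $x(F)=x(i',j')$ if $F$ is the face $(i',j')$. (2) If $(n,i,j),(n',i',j')\in\mathcal{U}$ and $n'\le n-|i'-i|-|j'-j|$, then every vertex, every edge and every face of $G_{(n',i',j')}$ is respectively a vertex, an edge and a face of $G_{(n,i,j)}$ (an open face of $G_{(n',i',j')}$ may be a closed face of $G_{(n,i,j)}$).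
   Context: Octahedron recurrence. Let $\mathcal{L}=\{(n,i,j)\in\mathbb{Z}^3 : n\equiv i+j \pmod 2\}$. A height function is $h\colon\mathbb{Z}^2\to\mathbb{Z}$ with (1) $|h(i_1,j_1)-h(i_2,j_2)|=1$ whenever $|i_1-i_2|+|j_1-j_2|=1$ ("lattice-adjacent"); (2) $h(i,j)\equiv i+j\pmod 2$; (3) $h(i,j)+|i|+|j|\to\infty$ as $|i|+|j|\to\infty$. Set $\mathcal{I}=\{(n,i,j)\in\mathcal{L}: n=h(i,j)\}$, $\mathcal{U}=\{(n,i,j)\in\mathcal{L}: n>h(i,j)\}$. With formal face variables $x(i,j)$ ($(i,j)\in\mathbb{Z}^2$) and edge variables $a(i,j),b(i,j),c(i,j),d(i,j)$ ($i+j$ odd), define $f(n,i,j)=x(i,j)$ on $\mathcal{I}$ and on $\mathcal{U}$ $$f(n,i,j)=\frac{a(i+n-1,j)c(i-n+1,j)f(n-1,i,j+1)f(n-1,i,j-1)+b(i,j+n-1)d(i,j-n+1)f(n-1,i+1,j)f(n-1,i-1,j)}{f(n-2,i,j)}.$$ Crosses-and-wrenches graph $\mathcal{G}$. $\mathcal{G}$ is an infinite planar graph whose faces are indexed by $\mathbb{Z}^2$ (face $(i,j)$ is drawn around the point $(i,j)$ and corresponds to $(h(i,j),i,j)\in\mathcal{I}$). For each $(i,j)$ consider the block $\{(i,j),(i+1,j),(i,j+1),(i+1,j+1)\}$ with its two diagonal pairs $\{(i,j),(i+1,j+1)\}$ and $\{(i+1,j),(i,j+1)\}$. Either both diagonal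 pairs have equal heights (a "cross"), in which case the block contributes one vertex incident to all four faces of the block; or exactly one diagonal pair $\{P,P'\}$ has equal heights (a "wrench"), in which case, writing $\{Q,Q'\}$ for the other pair, the block contributes two vertices $u_Q$ (incident to $P,P',Q$) and $u_{Q'}$ (incident to $P,P',Q'$) joined by a "diagonal" edge separating $P$ from $P'$. For each pair of lattice-adjacent faces $F,F'$, each of the two blocks containing both has a unique vertex incident to both $F$ and $F'$, and $\mathcal{G}$ has one edge joining these two vertices, separating $F$ from $F'$. These are all the edges. The diagonal edges form $E_u$ (unweighted edges); the others form $E_w$ (weighted edges). The boundary edges of face $(i,j)$ are the four edges separating it from $(i\pm1,j),(i,j\pm1)$ together with the diagonal edges of those wrench blocks in which $(i,j)$ belongs to the equal-height pair. Edge labels. For a weighted edge $e$ separating faces $(i_1,j_1)$ and $(i_2,j_2)$ with $(i_1-i_2)+(j_1-j_2)=1$, put $n_k=h(i_k,j_k)$. If $i_1=i_2+1$: $\lambda(e)=a(i_1+n_2,j_1)$ when $n_1>n_2$ and $\lambda(e)=c(i_1-n_2,j_1)$ when $n_1<n_2$. If $j_1=j_2+1$: $\lambda(e)=b(i_1,j_1+n_2)$ when $n_1>n_2$ and $\lambda(e)=d(i_1,j_1-n_2)$ when $n_1<n_2$. Subgraphs. For $(n_0,i_0,j_0)\in\mathcal{U}$ let $p(i,j)=n_0-|i-i_0|-|j-j_0|$. The graph with open faces $G=G_{(n_0,i_0,j_0)}$ has as closed faces the faces $(i,j)$ of $\mathcal{G}$ with $h(i,j)<p(i,j)$; its edges are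 the edges of $\mathcal{G}$ lying on the boundary of at least one closed face; its vertices are their endpoints; its open faces are the faces of $\mathcal{G}$ that are not closed but have at least one boundary edge that is an edge of $G$. A perfect matching of $G$ is a set $M$ of edges of $G$ such that every vertex of $G$ lies on exactly one edge of $M$. For a face $F$ of $G$ let $\alpha_F$ be the number of boundary edges of $F$ lying in $M$ and $\beta_F$ the number of boundary edges of $F$ that are edges of $G$ but not in $M$; set $\epsilon_M(F)=\lceil(\beta_F-\alpha_F)/2\rceil-1$ if $F$ is closed and $\epsilon_M(F)=\lceil(\beta_F-\alpha_F)/2\rceil$ if $F$ is open. -}

module Defs where

open import Level using (Level; _⊔_) renaming (suc to lsuc)
open import Data.Bool using (Bool; true; false; if_then_else_)
open import Data.Empty using (⊥)
open import Data.Unit using (⊤)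
open import Data.Nat as ℕ using (ℕ; ⌊_/2⌋; ⌈_/2⌉)
open import Data.Integer as ℤ using (ℤ; +_; -[1+_]; _+_; _-_; -_; ∣_∣; _<_; _≤_; _<?_)
open import Data.Integer.Divisibility using (_∣_)
open import Data.Product using (Σ; ∃; _×_; _,_)
open import Data.Sum using (_⊎_)
open import Data.Maybe using (Maybe; just; nothing)
open import Data.List using (List; []; _∷_; _++_; map; filter; length; foldr)
open import Data.List.Relation.Unary.All using (All; all?)
open import Relation.Binary.Core using (Rel)
open import Relation.Binary.Definitions using (DecidableEquality)
open import Relation.Binary.PropositionalEquality using (_≡_; _≢_; refl)
open import Relation.Nullary using (¬_; Dec; yes; no; does; _×-dec_; ¬?)
open import Algebra.Core using (Op₁; Op₂)
open import Algebra.Structures using (IsCommutativeSemigroup; IsAbelianGroup)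
open import Algebra.Definitions using (_DistributesOver_)
import Data.List.Membership.DecPropositional as DecMem

-- Semifields: (S, +, *, 1, ⁻¹) with (S,+) a commutative semigroup,
-- (S,*,1,⁻¹) an abelian group and * distributing over +.
-- (Examples: positive rationals/reals, the universal semifield of
-- subtraction-free rational expressions in formal variables.)

record Semifield (c ℓ : Level) : Set (lsuc (c ⊔ ℓ)) where
  infixl 7 _*_
  infixl 6 _+ₛ_
  infix 4 _≈_
  infix 8 _⁻¹
  field
    Carrier : Set c
    _≈_     : Rel Carrier ℓ
    _+ₛ_    : Op₂ Carrier
    _*_     : Op₂ Carrier
    1#      : Carrier
    _⁻¹     : Op₁ Carrier
    +-isCommutativeSemigroup : IsCommutativeSemigroup _≈_ _+ₛ_
    *-isAbelianGroup         : IsAbelianGroup _≈_ _*_ 1# _⁻¹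
    distrib                  : _DistributesOver_ _≈_ _*_ _+ₛ_

module SF {c ℓ} (S : Semifield c ℓ) where
  open Semifield S

  _^ℕ_ : Carrier → ℕ → Carrier
  x ^ℕ ℕ.zero  = 1#
  x ^ℕ ℕ.suc n = x * (x ^ℕ n)

  _^ℤ_ : Carrier → ℤ → Carrier
  x ^ℤ (+ n)    = x ^ℕ n
  x ^ℤ -[1+ n ] = (x ⁻¹) ^ℕ ℕ.suc n

  prod : List Carrier → Carrier
  prod = foldr _*_ 1#

  -- "the (nonempty) sum of the list ts equals s";  an empty sum is never
  -- considered equal to anything (there is no zero in a semifield).
  SumsTo : List Carrier → Carrier → Set ℓ
  SumsTo []       s = Level.Lift ℓ ⊥
  SumsTo (t ∷ ts) s = foldr _+ₛ_ t ts ≈ s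

Even : ℤ → Set
Even n = + 2 ∣ n

record IsHeightFunction (h : ℤ → ℤ → ℤ) : Set where
  field
    adjᵢ   : ∀ i j → ∣ h (i + + 1) j - h i j ∣ ≡ 1
    adjⱼ   : ∀ i j → ∣ h i (j + + 1) - h i j ∣ ≡ 1
    parity : ∀ i j → Even (h i j - (i + j))
    growth : ∀ (K : ℤ) → ∃ λ (R : ℕ) → ∀ i j →
               R ℕ.≤ ∣ i ∣ ℕ.+ ∣ j ∣ → K ≤ h i j + (+ ∣ i ∣) + (+ ∣ j ∣)

InL : ℤ → ℤ → ℤ → Set
InL n i j = Even (n - (i + j))

InU : (h : ℤ → ℤ → ℤ) → ℤ → ℤ → ℤ → Set
InU h n i j = InL n i j × h i j < n

record OctahedronRecurrence {lc lℓ} (S : Semifield lc lℓ) (h : ℤ → ℤ → ℤ)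
       (x a b c d : ℤ → ℤ → Semifield.Carrier S)
       (f : ℤ → ℤ → ℤ → Semifield.Carrier S) : Set (lc ⊔ lℓ) where
  open Semifield S
  field
    initial : ∀ i j → f (h i j) i j ≈ x i j
    recur   : ∀ n i j → InU h n i j →
      f n i j ≈ ( a (i + n - + 1) j * c (i - n + + 1) j
                    * f (n - + 1) i (j + + 1) * f (n - + 1) i (j - + 1)
                 +ₛ b i (j + n - + 1) * d i (j - n + + 1)
                    * f (n - + 1) (i + + 1) j * f (n - + 1) (i - + 1) j )
                * (f (n - + 2) i j) ⁻¹

-- The crosses-and-wrenches graph.
-- Block (i,j) has corners c00=(i,j), c10=(i+1,j), c01=(i,j+1), c11=(i+1,j+1);
-- diagonal pairs {c00,c11} and {c10,c01}.

data Corner : Set where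
  c00 c10 c01 c11 : Corner

-- cross       : both diagonal pairs have equal heights
-- wrenchMain  : exactly {c00,c11} has equal heights (Q-pair {c10,c01})
-- wrenchAnti  : exactly {c10,c01} has equal heights (Q-pair {c00,c11})
data Kind : Set where
  cross wrenchMain wrenchAnti : Kind

kind : (ℤ → ℤ → ℤ) → ℤ → ℤ → Kind
kind h i j with h i j ℤ.≟ h (i + + 1) (j + + 1) | h (i + + 1) j ℤ.≟ h i (j + + 1)
... | yes _ | yes _ = cross
... | yes _ | no  _ = wrenchMain
... | no  _ | _     = wrenchAnti   -- then {c10,c01} is equal, by adjacency

-- vertices: vertex i j centre (the vertex of a cross block (i,j)),
-- vertex i j (at Q) (the vertex u_Q of a wrench block (i,j))
data Tag : Set where
  centre : Tag
  at     : Corner → Tag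

data Vertex : Set where
  vertex : ℤ → ℤ → Tag → Vertex

-- the vertex of a block of kind k incident to the two adjacent corners X, Y
-- (exactly one of X,Y lies in the Q-pair of a wrench)
inQ : Kind → Corner → Bool
inQ wrenchMain c10 = true
inQ wrenchMain c01 = true
inQ wrenchAnti c00 = true
inQ wrenchAnti c11 = true
inQ _          _   = false

meet : Kind → Corner → Corner → Tag
meet cross X Y = centre
meet k     X Y = if inQ k X then at X else at Y

-- Edges: hE i j separates faces (i,j),(i+1,j); vE i j separates (i,j),(i,j+1);
-- dE i j is the diagonal edge of block (i,j) (an edge only for wrenches).
data Edge : Set where
  hE vE dE : ℤ → ℤ → Edge

IsEdge𝒢 : (ℤ → ℤ → ℤ) → Edge → Set
IsEdge𝒢 h (hE i j) = ⊤
IsEdge𝒢 h (vE i j) = ⊤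
IsEdge𝒢 h (dE i j) = kind h i j ≢ cross

ends : (ℤ → ℤ → ℤ) → Edge → List Vertex
ends h (hE i j) = vertex i (j - + 1) (meet (kind h i (j - + 1)) c01 c11)
                ∷ vertex i j (meet (kind h i j) c00 c10) ∷ []
ends h (vE i j) = vertex (i - + 1) j (meet (kind h (i - + 1) j) c10 c11)
                ∷ vertex i j (meet (kind h i j) c00 c01) ∷ []
ends h (dE i j) with kind h i j
... | wrenchMain = vertex i j (at c10) ∷ vertex i j (at c01) ∷ []
... | wrenchAnti = vertex i j (at c00) ∷ vertex i j (at c11) ∷ []
... | cross      = []   -- not an edge of 𝒢

inEqualPair : Kind → Corner → Bool
inEqualPair wrenchMain c00 = true
inEqualPair wrenchMain c11 = true
inEqualPair wrenchAnti c10 = true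
inEqualPair wrenchAnti c01 = true
inEqualPair _          _   = false

diagIf : (ℤ → ℤ → ℤ) → ℤ → ℤ → Corner → List Edge
diagIf h i j X = if inEqualPair (kind h i j) X then dE i j ∷ [] else []

boundary : (ℤ → ℤ → ℤ) → ℤ → ℤ → List Edge
boundary h i j =
  hE (i - + 1) j ∷ hE i j ∷ vE i (j - + 1) ∷ vE i j ∷
  (diagIf h i j c00 ++ diagIf h (i - + 1) j c10 ++
   diagIf h i (j - + 1) c01 ++ diagIf h (i - + 1) (j - + 1) c11)

IsWeighted : Edge → Bool
IsWeighted (dE _ _) = false
IsWeighted _        = true

label : ∀ {ℓA} {A : Set ℓA} → (ℤ → ℤ → ℤ) → (a b c d : ℤ → ℤ → A) → Edge → Maybe A
label h a b c d (hE i j) with h i j <? h (i + + 1) j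
... | yes _ = just (a (i + + 1 + h i j) j)
... | no  _ = just (c (i + + 1 - h i j) j)
label h a b c d (vE i j) with h i j <? h i (j + + 1)
... | yes _ = just (b i (j + + 1 + h i j))
... | no  _ = just (d i (j + + 1 - h i j))
label h a b c d (dE i j) = nothing

_≟C_ : DecidableEquality Corner
c00 ≟C c00 = yes refl
c10 ≟C c10 = yes refl
c01 ≟C c01 = yes refl
c11 ≟C c11 = yes refl
c00 ≟C c10 = no λ ()
c00 ≟C c01 = no λ ()
c00 ≟C c11 = no λ ()
c10 ≟C c00 = no λ ()
c10 ≟C c01 = no λ ()
c10 ≟C c11 = no λ ()
c01 ≟C c00 = no λ ()
c01 ≟C c10 = no λ ()
c01 ≟C c11 = no λ ()
c11 ≟C c00 = no λ ()
c11 ≟C c10 = no λ ()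
c11 ≟C c01 = no λ ()

_≟T_ : DecidableEquality Tag
centre ≟T centre = yes refl
centre ≟T at _   = no λ ()
at _   ≟T centre = no λ ()
at X   ≟T at Y with X ≟C Y
... | yes refl = yes refl
... | no  X≢Y  = no λ { refl → X≢Y refl }

_≟V_ : DecidableEquality Vertex
vertex i j t ≟V vertex i′ j′ t′ with i ℤ.≟ i′ | j ℤ.≟ j′ | t ≟T t′
... | yes refl | yes refl | yes refl = yes refl
... | no  p    | _        | _        = no λ { refl → p refl }
... | yes _    | no  p    | _        = no λ { refl → p refl }
... | yes _    | yes _    | no  p    = no λ { refl → p refl }

private
  pair≟ : ∀ (i j i′ j′ : ℤ) → Dec ((i ≡ i′) × (j ≡ j′))
  pair≟ i j i′ j′ = (i ℤ.≟ i′) ×-dec (j ℤ.≟ j′)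

_≟E_ : DecidableEquality Edge
hE i j ≟E hE i′ j′ with pair≟ i j i′ j′
... | yes (refl , refl) = yes refl
... | no  p             = no λ { refl → p (refl , refl) }
vE i j ≟E vE i′ j′ with pair≟ i j i′ j′
... | yes (refl , refl) = yes refl
... | no  p             = no λ { refl → p (refl , refl) }
dE i j ≟E dE i′ j′ with pair≟ i j i′ j′
... | yes (refl , refl) = yes refl
... | no  p             = no λ { refl → p (refl , refl) }
hE _ _ ≟E vE _ _ = no λ ()
hE _ _ ≟E dE _ _ = no λ ()
vE _ _ ≟E hE _ _ = no λ ()
vE _ _ ≟E dE _ _ = no λ ()
dE _ _ ≟E hE _ _ = no λ ()
dE _ _ ≟E vE _ _ = no λ ()

module MemV = DecMem _≟V_
module MemE = DecMem _≟E_

Face : Set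
Face = ℤ × ℤ

pyr : ℤ → ℤ → ℤ → ℤ → ℤ → ℤ
pyr n0 i0 j0 i j = n0 - + ∣ i - i0 ∣ - + ∣ j - j0 ∣

module Subgraph (h : ℤ → ℤ → ℤ) (n0 i0 j0 : ℤ) where

  ClosedFace : Face → Set
  ClosedFace (i , j) = h i j < pyr n0 i0 j0 i j

  closed? : (F : Face) → Dec (ClosedFace F)
  closed? (i , j) = h i j <? pyr n0 i0 j0 i j

  bd : Face → List Edge
  bd (i , j) = boundary h i j

  EdgeOfG : Edge → Set
  EdgeOfG e = IsEdge𝒢 h e × ∃ λ F → ClosedFace F × e MemE.∈ bd F

  VertexOfG : Vertex → Set
  VertexOfG v = ∃ λ e → EdgeOfG e × v MemV.∈ ends h e

  OpenFace : Face → Set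
  OpenFace F = ¬ ClosedFace F × ∃ λ e → e MemE.∈ bd F × EdgeOfG e

  FaceOfG : Face → Set
  FaceOfG F = ClosedFace F ⊎ OpenFace F

  -- Below, es is a duplicate-free enumeration of the edges of G.
  module WithEdges (es : List Edge) where

    degIn : List Edge → Vertex → ℕ
    degIn M v = length (filter (λ e → v MemV.∈? ends h e) M)

    -- M is a perfect matching of G (M is taken among the sublists of es):
    -- every vertex of G lies on exactly one edge of M
    IsPerfectMatching : List Edge → Set
    IsPerfectMatching M = All (λ e → All (λ v → degIn M v ≡ 1) (ends h e)) es

    isPerfectMatching? : (M : List Edge) → Dec (IsPerfectMatching M)
    isPerfectMatching? M = all? (λ e → all? (λ v → degIn M v ℕ.≟ 1) (ends h e)) es

    subsets : List Edge → List (List Edge)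
    subsets []       = [] ∷ []
    subsets (e ∷ xs) = map (e ∷_) (subsets xs) ++ subsets xs

    perfectMatchings : List (List Edge)
    perfectMatchings = filter isPerfectMatching? (subsets es)

    α : List Edge → Face → ℕ
    α M F = length (filter (λ e → e MemE.∈? M) (bd F))

    β : List Edge → Face → ℕ
    β M F = length (filter (λ e → (e MemE.∈? es) ×-dec ¬? (e MemE.∈? M)) (bd F))

    ceilHalf : ℤ → ℤ
    ceilHalf (+ n)    = + ⌈ n /2⌉
    ceilHalf -[1+ n ] = - (+ ⌊ ℕ.suc n /2⌋)

    ε : List Edge → Face → ℤ
    ε M F = ceilHalf (+ β M F - + α M F) - (if does (closed? F) then + 1 else + 0)

    module Weights {lc lℓ} (S : Semifield lc lℓ) (x a b c d : ℤ → ℤ → Semifield.Carrier S)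
                   (fs : List Face) where
      open Semifield S
      open SF S

      λ′ : Edge → Carrier
      λ′ e with label h a b c d e
      ... | just l  = l
      ... | nothing = 1#

      -- the term of the matching M (fs enumerates the faces of G)
      term : List Edge → Carrier
      term M = prod (map λ′ M) * prod (map (λ F → xF F ^ℤ ε M F) fs)
        where xF : Face → Carrier
              xF (i , j) = x i j

      terms : List Carrier
      terms = map term perfectMatchings

{-# OPTIONS --safe #-}

-- Urban renewal. For a perfect matching M of G, ε_M(F) = ⌈k/2⌉ - [F closed] - α_F, where k is the number
-- of boundary edges of F in G, so the term of M is a constant times the product of the weights
-- w(e) = λ(e) / (x(F) x(F′)) of its edges e, where e separates F from F′.  Fix the apex (n, i, j) and let
-- the height function h vary, with x(F) = f(h(F), F).  A closed face of least height is a local minimum of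
-- h; its four sides form a square of G, and raising its height by 2 turns every cross at a corner of the
-- square into a wrench and conversely.  Once the edges elsewhere are fixed, a corner that demands an edge of
-- the square before the move demands none after it, and the octahedron recurrence says precisely that the
-- resulting sums over the square agree up to the factor by which the constant changes.  When no closed face
-- is left, the sum is x(apex) = f(n, i, j).
--
-- A semifield has no zero, hence the sums are computed in the commutative semiring obtained by adjoining
-- one.

module Submission where

open import Defs
open import Level using (Level; _⊔_)
open import Algebra.Bundles using (CommutativeSemiring; CommutativeMonoid; AbelianGroup)
import Algebra.Properties.AbelianGroup as AbelianGroupProperties
import Algebra.Properties.CommutativeSemigroup as CommutativeSemigroupProperties
import Algebra.Solver.CommutativeMonoid as CommutativeMonoidSolver
open import Algebra.Structures using (IsCommutativeSemigroup)
open import Algebra.Structures.Biased using (isCommutativeSemiringˡ)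
open import Data.Bool using (Bool; true; false; if_then_else_; _∧_; _∨_; _xor_; not)
import Data.Bool.Properties as Bool
open import Data.Empty using (⊥-elim)
open import Data.Fin using (Fin; zero; suc; #_)
open import Data.Integer as ℤ using (ℤ; +_; -[1+_]; _+_; _-_; -_; ∣_∣; _≤_)
import Data.Integer.Divisibility.Signed as Signed
import Data.Integer.Properties as ℤ
open import Data.Integer.Tactic.RingSolver using (solve-∀)
open import Data.List using (List; []; _∷_; _++_; map; filter; length; foldr; cartesianProduct; upTo)
import Data.List.Membership.DecPropositional as DecMembership
open import Data.List.Membership.Propositional using (_∈_; _∉_)
open import Data.List.Membership.Propositional.Properties
  using (∈-∃++; ∈-++⁺ˡ; ∈-++⁺ʳ; ∈-++⁻; ∈-filter⁺; ∈-filter⁻; ∈-map⁺; ∈-map⁻; ∈-upTo⁺; ∈-cartesianProduct⁺)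
open import Data.List.Relation.Binary.Permutation.Propositional using (_↭_; ↭-refl; ↭-sym; ↭-trans; prep; swap; ↭⇒↭ₛ)
import Data.List.Relation.Binary.Permutation.Propositional.Properties as Perm
import Data.List.Relation.Binary.Permutation.Setoid.Properties as PermSetoid
open import Data.List.Relation.Unary.All as All using (All; []; _∷_)
open import Data.List.Relation.Unary.AllPairs using ([]; _∷_)
open import Data.List.Relation.Unary.Any using (here; there)
open import Data.List.Relation.Unary.Unique.Propositional using (Unique)
import Data.List.Relation.Unary.Unique.Propositional.Properties as Unique
open import Data.Maybe using (Maybe; just; nothing)
import Data.Maybe.Relation.Binary.Pointwise as Pointwise
open import Data.Nat as ℕ using (ℕ; ⌈_/2⌉; ⌊_/2⌋)
import Data.Nat.Properties as ℕ
import Data.Nat.Tactic.RingSolver as ℕ-Solver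
open import Data.Product using (∃-syntax; _×_; _,_; proj₁; proj₂)
open import Data.Product.Properties using (≡-dec)
open import Data.Sum using (_⊎_; inj₁; inj₂; [_,_]′)
open import Data.Vec as Vec using (Vec; []; _∷_)
open import Function using (_∘_; mk⇔)
open import Function.Bundles using (_⇔_; Equivalence)
open import Relation.Binary.Definitions using (DecidableEquality)
open import Relation.Binary.PropositionalEquality as ≡
  using (_≡_; _≢_; refl; sym; trans; cong; cong₂; subst; subst₂)
import Relation.Binary.Reasoning.Setoid as SetoidReasoning
open import Relation.Nullary using (¬_; Dec; yes; no; does; _×-dec_; ¬?)
open import Relation.Nullary.Decidable using (dec-true; dec-false; does-⇔)

-- Duplicate-free lists

-- The obstacle is that a move changes the graph itself: diagonals appear and disappear, and near
-- the rim sides drop out. Every sum therefore runs over the horizontal and vertical sides of one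
-- box `B` that stays fixed, `admissible` kills the assignments that use an edge outside the current
-- graph, and the diagonal of a block is summed within the weight of that block. Both sides of a
-- move are then sums over the same variables, and what happens in one block is a Boolean identity
-- settled by a truth table. Varying the height function rather than the apex keeps the pyramid
-- fixed; each move uses the recurrence once, at the raised face. That face has least height among
-- all closed faces because this also controls its neighbours: a lower one would be closed as well.
-- The remaining difficulty is the rim, where the raised face or its neighbours may be open; what
-- matters there is which neighbours are nearer the apex.

module _ {a} {A : Set a} where

  Unique-resp-↭ : {xs ys : List A} → xs ↭ ys → Unique xs → Unique ys
  Unique-resp-↭ p = PermSetoid.Unique-resp-↭ (≡.setoid A) (↭⇒↭ₛ p)

  unique-head : ∀ {x} {xs : List A} → Unique (x ∷ xs) → x ∉ xs
  unique-head (p ∷ _) x∈xs = All.lookup p x∈xs refl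

  unique-disjoint : ∀ (xs {ys} : List A) → Unique (xs ++ ys) → ∀ {z} → z ∈ xs → z ∉ ys
  unique-disjoint (x ∷ xs) (p ∷ u) (here refl) z∈ys = All.lookup p (∈-++⁺ʳ xs z∈ys) refl
  unique-disjoint (x ∷ xs) (p ∷ u) (there z∈xs) z∈ys = unique-disjoint xs u z∈xs z∈ys

  unique-++ʳ : ∀ (xs {ys} : List A) → Unique (xs ++ ys) → Unique ys
  unique-++ʳ [] u = u
  unique-++ʳ (x ∷ xs) (_ ∷ u) = unique-++ʳ xs u

  -- The complement comes as a list, which lets sums and products over `ys` be split up to
  -- permutation, without deciding membership.
  split-⊆ : (xs : List A) {ys : List A} → Unique xs → (∀ {z} → z ∈ xs → z ∈ ys) →
            ∃[ zs ] ys ↭ xs ++ zs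
  split-⊆ [] {ys} _ _ = ys , ↭-refl
  split-⊆ (x ∷ xs) {ys} u xs⊆ys with ∈-∃++ (xs⊆ys (here refl))
  ... | ls , rs , refl with split-⊆ xs (unique-++ʳ (x ∷ []) u) rest
    where
    rest : ∀ {z} → z ∈ xs → z ∈ ls ++ rs
    rest z∈xs with Perm.∈-resp-↭ (Perm.shift x ls rs) (xs⊆ys (there z∈xs))
    ... | here refl = ⊥-elim (unique-head u z∈xs)
    ... | there z∈ = z∈
  ... | zs , p = zs , ↭-trans (Perm.shift x ls rs) (prep x p)

  -- Whatever `split-⊆` leaves over is a member of `ys` and would occur twice in `xs`, so nothing is
  -- left over.
  unique-↭ : {xs ys : List A} → Unique xs → Unique ys → (∀ {z} → z ∈ xs → z ∈ ys) →
             (∀ {z} → z ∈ ys → z ∈ xs) → xs ↭ ys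
  unique-↭ {xs} {ys} uxs uys xs⊆ys ys⊆xs with split-⊆ ys uys ys⊆xs
  ... | [] , p = ↭-trans p (Perm.++-identityʳ ys)
  ... | z ∷ zs , p = ⊥-elim (unique-disjoint ys (Unique-resp-↭ p uxs)
                              (xs⊆ys (Perm.∈-resp-↭ (↭-sym p) (∈-++⁺ʳ ys (here refl)))) (here refl))

-- Finite products

module Product {c ℓ} (M : CommutativeMonoid c ℓ) where
  open CommutativeMonoid M
    renaming (refl to ≈-refl; sym to ≈-sym; trans to ≈-trans; reflexive to ≈-reflexive)
  open CommutativeSemigroupProperties commutativeSemigroup using (x∙yz≈y∙xz; interchange)

  ∏ : ∀ {a} {A : Set a} → List A → (A → Carrier) → Carrier
  ∏ []       g = ε
  ∏ (x ∷ xs) g = g x ∙ ∏ xs g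

  module _ {a} {A : Set a} where

    ∏-cong : ∀ (xs : List A) {g g′} → (∀ {x} → x ∈ xs → g x ≈ g′ x) → ∏ xs g ≈ ∏ xs g′
    ∏-cong []       eq = ≈-refl
    ∏-cong (x ∷ xs) eq = ∙-cong (eq (here refl)) (∏-cong xs (eq ∘ there))

    ∏-↭ : ∀ {xs ys : List A} g → xs ↭ ys → ∏ xs g ≈ ∏ ys g
    ∏-↭ g _↭_.refl = ≈-refl
    ∏-↭ g (prep x p) = ∙-congˡ (∏-↭ g p)
    ∏-↭ g (swap x y p) = ≈-trans (x∙yz≈y∙xz _ _ _) (∙-congˡ (∙-congˡ (∏-↭ g p)))
    ∏-↭ g (_↭_.trans p q) = ≈-trans (∏-↭ g p) (∏-↭ g q)

    ∏-++ : ∀ (xs {ys} : List A) g → ∏ (xs ++ ys) g ≈ ∏ xs g ∙ ∏ ys g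
    ∏-++ []       g = ≈-sym (identityˡ _)
    ∏-++ (x ∷ xs) g = ≈-trans (∙-congˡ (∏-++ xs g)) (≈-sym (assoc _ _ _))

    ∏-1 : ∀ (xs : List A) {g} → (∀ {x} → x ∈ xs → g x ≈ ε) → ∏ xs g ≈ ε
    ∏-1 [] _ = ≈-refl
    ∏-1 (x ∷ xs) eq = ≈-trans (∙-cong (eq (here refl)) (∏-1 xs (eq ∘ there))) (identityˡ _)

    ∏-∙ : ∀ (xs : List A) g g′ → ∏ xs (λ x → g x ∙ g′ x) ≈ ∏ xs g ∙ ∏ xs g′
    ∏-∙ []       g g′ = ≈-sym (identityˡ _)
    ∏-∙ (x ∷ xs) g g′ = ≈-trans (∙-congˡ (∏-∙ xs g g′)) (interchange _ _ _ _)

    ∏-⊆ : ∀ {xs ys : List A} {g} → Unique xs → Unique ys → (∀ {z} → z ∈ xs → z ∈ ys) →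
          (∀ {z} → z ∈ ys → z ∉ xs → g z ≈ ε) → ∏ ys g ≈ ∏ xs g
    ∏-⊆ {xs} {ys} {g} uxs uys xs⊆ys outside with split-⊆ xs uxs xs⊆ys
    ... | zs , p = ≈-trans (∏-↭ g p) (≈-trans (∏-++ xs g) (≈-trans (∙-congˡ (∏-1 zs 1-on-zs)) (identityʳ _)))
      where
      1-on-zs : ∀ {z} → z ∈ zs → g z ≈ ε
      1-on-zs z∈zs = outside (Perm.∈-resp-↭ (↭-sym p) (∈-++⁺ʳ xs z∈zs))
                             (λ z∈xs → unique-disjoint xs (Unique-resp-↭ p uys) z∈xs z∈zs)

  ∏-swap : ∀ {a b} {A : Set a} {B : Set b} (xs : List A) (ys : List B) (g : A → B → Carrier) →
           ∏ xs (λ x → ∏ ys (g x)) ≈ ∏ ys (λ y → ∏ xs (λ x → g x y))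
  ∏-swap []       ys g = ≈-sym (∏-1 ys (λ _ → ≈-refl))
  ∏-swap (x ∷ xs) ys g = ≈-trans (∙-congˡ (∏-swap xs ys g)) (≈-sym (∏-∙ ys (g x) _))

  ∏-filter : ∀ {a p} {A : Set a} {P : A → Set p} (P? : ∀ x → Dec (P x)) (xs : List A) g →
             ∏ (filter P? xs) g ≈ ∏ xs (λ x → if does (P? x) then g x else ε)
  ∏-filter P? [] g = ≈-refl
  ∏-filter P? (x ∷ xs) g with does (P? x)
  ... | true = ∙-congˡ (∏-filter P? xs g)
  ... | false = ≈-trans (∏-filter P? xs g) (≈-sym (identityˡ _))

  ∏-map : ∀ {a b} {A : Set a} {B : Set b} (f : B → A) (xs : List B) g → ∏ (map f xs) g ≡ ∏ xs (g ∘ f)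
  ∏-map f []       g = refl
  ∏-map f (x ∷ xs) g = cong (g (f x) ∙_) (∏-map f xs g)

-- Sums over the assignments of truth values to a list of variables

module Assignments {v} {V : Set v} (_≟_ : DecidableEquality V) where

  Assignment : Set v
  Assignment = V → Bool

  put : V → Bool → Assignment → Assignment
  put e b σ e′ = if does (e′ ≟ e) then b else σ e′

  put-≡ : ∀ e b σ → put e b σ e ≡ b
  put-≡ e b σ with e ≟ e
  ... | yes _ = refl
  ... | no e≢e = ⊥-elim (e≢e refl)

  put-≢ : ∀ {e e′} b σ → e′ ≢ e → put e b σ e′ ≡ σ e′
  put-≢ {e} {e′} b σ e′≢e with e′ ≟ e
  ... | yes eq = ⊥-elim (e′≢e eq)
  ... | no _ = refl

  put-ext : ∀ e b {σ τ} → (∀ e′ → σ e′ ≡ τ e′) → ∀ e′ → put e b σ e′ ≡ put e b τ e′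
  put-ext e b σ≗τ e′ with does (e′ ≟ e)
  ... | true = refl
  ... | false = σ≗τ e′

  put-swap : ∀ {e e′} b b′ σ → e ≢ e′ → ∀ e″ → put e b (put e′ b′ σ) e″ ≡ put e′ b′ (put e b σ) e″
  put-swap {e} {e′} b b′ σ e≢e′ e″ with e″ ≟ e | e″ ≟ e′
  ... | yes refl | yes refl = ⊥-elim (e≢e′ refl)
  ... | yes _ | no _ = refl
  ... | no _ | yes _ = refl
  ... | no _ | no _ = refl

  module Sums {c ℓ} (R : CommutativeSemiring c ℓ) where
    open CommutativeSemiring R
      renaming (_+_ to _⊕_; _*_ to _⊗_; 0# to 𝟎; 1# to 𝟏; refl to ≈-refl; sym to ≈-sym; trans to ≈-trans;
                reflexive to ≈-reflexive)
    open CommutativeSemigroupProperties +-commutativeSemigroup using (interchange)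
    open Product *-commutativeMonoid

    -- Assignments are total functions, and the variables outside `L` keep the values of `σ`. Hence
    -- a partial sum is again a function of assignments, and a sum over `L ++ L′` is a nested sum.
    Sum : List V → (Assignment → Carrier) → Assignment → Carrier
    Sum []      Φ σ = Φ σ
    Sum (e ∷ L) Φ σ = Sum L Φ (put e false σ) ⊕ Sum L Φ (put e true σ)

    -- Assignments are compared pointwise only, so a summand must be shown to respect pointwise
    -- equality before variables may be permuted.
    Extensional : (Assignment → Carrier) → Set (v ⊔ ℓ)
    Extensional Φ = ∀ {σ τ} → (∀ e → σ e ≡ τ e) → Φ σ ≈ Φ τ

    Sum-ext : ∀ L {Φ} → Extensional Φ → Extensional (Sum L Φ)
    Sum-ext []      ext σ≗τ = ext σ≗τ
    Sum-ext (e ∷ L) ext σ≗τ = +-cong (Sum-ext L ext (put-ext e false σ≗τ)) (Sum-ext L ext (put-ext e true σ≗τ))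

    Sum-cong : ∀ L {Φ Ψ} → (∀ σ → Φ σ ≈ Ψ σ) → ∀ σ → Sum L Φ σ ≈ Sum L Ψ σ
    Sum-cong []      eq σ = eq σ
    Sum-cong (e ∷ L) eq σ = +-cong (Sum-cong L eq _) (Sum-cong L eq _)

    Sum-++ : ∀ L {L′} Φ σ → Sum (L ++ L′) Φ σ ≡ Sum L (Sum L′ Φ) σ
    Sum-++ []      Φ σ = refl
    Sum-++ (e ∷ L) Φ σ = cong₂ _⊕_ (Sum-++ L Φ _) (Sum-++ L Φ _)

    Sum-*ˡ : ∀ L k Φ σ → k ⊗ Sum L Φ σ ≈ Sum L (λ τ → k ⊗ Φ τ) σ
    Sum-*ˡ []      k Φ σ = ≈-refl
    Sum-*ˡ (e ∷ L) k Φ σ = ≈-trans (distribˡ _ _ _) (+-cong (Sum-*ˡ L k Φ _) (Sum-*ˡ L k Φ _))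

    Sum-↭ : ∀ {L L′ Φ} → Extensional Φ → L ↭ L′ → ∀ σ → Sum L Φ σ ≈ Sum L′ Φ σ
    Sum-↭ ext _↭_.refl σ = ≈-refl
    Sum-↭ ext (prep e p) σ = +-cong (Sum-↭ ext p _) (Sum-↭ ext p _)
    Sum-↭ ext (_↭_.trans p q) σ = ≈-trans (Sum-↭ ext p σ) (Sum-↭ ext q σ)
    -- If the two variables coincide, nothing is exchanged; otherwise the two updates commute and
    -- the four branches are regrouped.
    Sum-↭ {e ∷ e′ ∷ L} {_ ∷ _ ∷ L″} {Φ} ext (swap e e′ p) σ with e ≟ e′
    ... | yes refl = +-cong (+-cong (Sum-↭ ext p _) (Sum-↭ ext p _)) (+-cong (Sum-↭ ext p _) (Sum-↭ ext p _))
    ... | no e≢e′ = ≈-trans (interchange _ _ _ _)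
                      (+-cong (+-cong (step false false) (step false true)) (+-cong (step true false) (step true true)))
      where
      step : ∀ b b′ → Sum L Φ (put e′ b (put e b′ σ)) ≈ Sum L″ Φ (put e b′ (put e′ b σ))
      step b b′ = ≈-trans (Sum-↭ ext p _) (Sum-ext L″ ext (put-swap b b′ σ (λ eq → e≢e′ (sym eq))))

    -- The variable `e` is not among those summed over, so its value `true` survives in every
    -- branch.
    Sum-0 : ∀ L {Φ e} → e ∉ L → (∀ σ → σ e ≡ true → Φ σ ≈ 𝟎) → ∀ σ → σ e ≡ true → Sum L Φ σ ≈ 𝟎
    Sum-0 []       e∉L vanish σ σe = vanish σ σe
    Sum-0 (e′ ∷ L) {e = e} e∉L vanish σ σe =
      ≈-trans (+-cong (branch false) (branch true)) (+-identityˡ _)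
      where
      branch : ∀ b → Sum L _ (put e′ b σ) ≈ 𝟎
      branch b = Sum-0 L (e∉L ∘ there) vanish _ (trans (put-≢ b σ (λ { refl → e∉L (here refl) })) σe)

    Sum-vanishing : ∀ D {Φ} → Unique D → Extensional Φ → (∀ {e} → e ∈ D → ∀ σ → σ e ≡ true → Φ σ ≈ 𝟎) →
                    ∀ σ → (∀ {e} → e ∈ D → σ e ≡ false) → Sum D Φ σ ≈ Φ σ
    Sum-vanishing [] _ ext vanish σ off = ≈-refl
    Sum-vanishing (e ∷ D) {Φ} u ext vanish σ off = ≈-trans (+-cong falseBranch trueBranch) (+-identityʳ _)
      where
      put-false : ∀ e′ → put e false σ e′ ≡ σ e′
      put-false e′ with e′ ≟ e
      ... | yes refl = sym (off (here refl))
      ... | no _ = refl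
      falseBranch : Sum D Φ (put e false σ) ≈ Φ σ
      falseBranch = ≈-trans (Sum-ext D ext put-false)
        (Sum-vanishing D (unique-++ʳ (e ∷ []) u) ext (vanish ∘ there) σ (off ∘ there))
      trueBranch : Sum D Φ (put e true σ) ≈ 𝟎
      trueBranch = Sum-0 D (unique-head u) (vanish (here refl)) _ (put-≡ e true σ)

    -- Passes between the edges of the graph and all edges of a box: a variable outside `L` that is
    -- switched on makes the summand zero, so only the branch with all of them off survives.
    Sum-support : ∀ {L L′ Φ} → Unique L → Unique L′ → (∀ {e} → e ∈ L → e ∈ L′) → Extensional Φ →
                  (∀ {e} → e ∈ L′ → e ∉ L → ∀ σ → σ e ≡ true → Φ σ ≈ 𝟎) →
                  Sum L′ Φ (λ _ → false) ≈ Sum L Φ (λ _ → false)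
    Sum-support {L} {L′} {Φ} uL uL′ L⊆L′ ext vanish with split-⊆ L uL L⊆L′
    ... | D , p = ≈-trans (Sum-↭ ext L′↭ _) (≈-trans (≈-reflexive (Sum-++ D Φ _))
        (Sum-vanishing D (unique-++ʳ L uLD) (Sum-ext L ext)
          (λ e∈D → Sum-0 L (∉L e∈D) (vanish (Perm.∈-resp-↭ (↭-sym p) (∈-++⁺ʳ L e∈D)) (∉L e∈D)))
          _ (λ _ → refl)))
      where
      L′↭ : L′ ↭ D ++ L
      L′↭ = ↭-trans p (Perm.++-comm L D)
      uLD : Unique (L ++ D)
      uLD = Unique-resp-↭ p uL′
      ∉L : ∀ {e} → e ∈ D → e ∉ L
      ∉L e∈D e∈L = unique-disjoint L uLD e∈L e∈D

    -- The distributive law. The factor of `x` reads the variables `d y` only through its last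
    -- argument, which is the value of `d x`; so the sum over all of them is a product of two-term
    -- sums. `Q` collects the factors whose variable the induction has already fixed.
    Sum-factor : ∀ {a} {A : Set a} (d : A → V) (B : List A) (Q : Assignment → Carrier)
                 (G : A → Assignment → Bool → Carrier) → Unique (map d B) →
                 Extensional Q → (∀ x {σ τ} → (∀ e → σ e ≡ τ e) → ∀ b → G x σ b ≈ G x τ b) →
                 (∀ y b σ → Q (put (d y) b σ) ≈ Q σ) →
                 (∀ x y b σ t → G x (put (d y) b σ) t ≈ G x σ t) →
                 ∀ σ → Sum (map d B) (λ τ → Q τ ⊗ ∏ B (λ x → G x τ (τ (d x)))) σ ≈
                       Q σ ⊗ ∏ B (λ x → G x σ false ⊕ G x σ true)
    Sum-factor d [] Q G u _ _ _ _ σ = ≈-refl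
    Sum-factor d (x ∷ B) Q G u Q-ext G-ext Q-put G-put σ = ≈-trans (+-cong (branch false) (branch true)) combine
      where
      open SetoidReasoning setoid
      dx∉ : d x ∉ map d B
      dx∉ = unique-head u
      P : Assignment → Carrier
      P τ = ∏ B (λ y → G y τ false ⊕ G y τ true)
      P-put : ∀ b → P (put (d x) b σ) ≈ P σ
      P-put b = ∏-cong B (λ {y} _ → +-cong (G-put y x b σ false) (G-put y x b σ true))
      branch : ∀ b → Sum (map d B) (λ τ → Q τ ⊗ ∏ (x ∷ B) (λ y → G y τ (τ (d y)))) (put (d x) b σ) ≈
                     (Q σ ⊗ G x σ b) ⊗ P σ
      branch b = begin
        Sum (map d B) (λ τ → Q τ ⊗ (G x τ (τ (d x)) ⊗ ∏ B (λ y → G y τ (τ (d y))))) (put (d x) b σ)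
          ≈⟨ Sum-frozen (map d B) dx∉ (put (d x) b σ) (put-≡ (d x) b σ) ⟩
        Sum (map d B) (λ τ → (Q τ ⊗ G x τ b) ⊗ ∏ B (λ y → G y τ (τ (d y)))) (put (d x) b σ)
          ≈⟨ Sum-factor d B (λ τ → Q τ ⊗ G x τ b) G (unique-++ʳ (d x ∷ []) u)
               (λ eq → *-cong (Q-ext eq) (G-ext x eq b)) G-ext
               (λ y b′ τ → *-cong (Q-put y b′ τ) (G-put x y b′ τ b)) G-put _ ⟩
        (Q (put (d x) b σ) ⊗ G x (put (d x) b σ) b) ⊗ P (put (d x) b σ)
          ≈⟨ *-cong (*-cong (Q-put x b σ) (G-put x x b σ b)) (P-put b) ⟩
        (Q σ ⊗ G x σ b) ⊗ P σ ∎
        where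
        -- The variable `d x` does not occur in the remaining list, so it still has the value `b`
        -- wherever the summand is evaluated.
        Sum-frozen : ∀ L → d x ∉ L → ∀ τ → τ (d x) ≡ b →
          Sum L (λ τ → Q τ ⊗ (G x τ (τ (d x)) ⊗ ∏ B (λ y → G y τ (τ (d y))))) τ ≈
          Sum L (λ τ → (Q τ ⊗ G x τ b) ⊗ ∏ B (λ y → G y τ (τ (d y)))) τ
        Sum-frozen [] _ τ eq rewrite eq = ≈-sym (*-assoc _ _ _)
        Sum-frozen (e ∷ L) ∉eL τ eq = +-cong (rec false) (rec true)
          where
          rec : ∀ b′ → _
          rec b′ = Sum-frozen L (∉eL ∘ there) (put e b′ τ)
                     (trans (put-≢ b′ τ (λ eq′ → ∉eL (here eq′))) eq)
      combine : (Q σ ⊗ G x σ false) ⊗ P σ ⊕ (Q σ ⊗ G x σ true) ⊗ P σ ≈ Q σ ⊗ ((G x σ false ⊕ G x σ true) ⊗ P σ)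
      combine = begin
        (Q σ ⊗ G x σ false) ⊗ P σ ⊕ (Q σ ⊗ G x σ true) ⊗ P σ ≈˘⟨ distribʳ _ _ _ ⟩
        (Q σ ⊗ G x σ false ⊕ Q σ ⊗ G x σ true) ⊗ P σ ≈˘⟨ *-congʳ (distribˡ _ _ _) ⟩
        (Q σ ⊗ (G x σ false ⊕ G x σ true)) ⊗ P σ ≈⟨ *-assoc _ _ _ ⟩
        Q σ ⊗ ((G x σ false ⊕ G x σ true) ⊗ P σ) ∎

-- Semifields: integer powers, monomial identities and an adjoined zero

module SemifieldProperties {c ℓ} (S : Semifield c ℓ) where
  open Semifield S
  open SF S

  *-abelianGroup : AbelianGroup c ℓ
  *-abelianGroup = record { isAbelianGroup = *-isAbelianGroup }

  open AbelianGroup *-abelianGroup public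
    using (setoid; ∙-cong; ∙-congˡ; ∙-congʳ; assoc; comm; identityˡ; identityʳ; inverseˡ; inverseʳ; ⁻¹-cong)
    renaming (refl to ≈-refl; sym to ≈-sym; trans to ≈-trans; reflexive to ≈-reflexive; commutativeMonoid to *-commutativeMonoid)
  open AbelianGroupProperties *-abelianGroup using (ε⁻¹≈ε; ⁻¹-∙-comm; ⁻¹-involutive)
  open CommutativeSemigroupProperties (AbelianGroup.commutativeSemigroup *-abelianGroup) using (interchange)
  module +ₛ = IsCommutativeSemigroup +-isCommutativeSemigroup
  open SetoidReasoning setoid

  ^ℤ-suc : ∀ x z → x ^ℤ ℤ.suc z ≈ x * x ^ℤ z
  ^ℤ-suc x (+ n) = ≈-refl
  ^ℤ-suc x -[1+ ℕ.zero ] = ≈-sym (≈-trans (∙-congˡ (identityʳ _)) (inverseʳ x))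
  ^ℤ-suc x -[1+ ℕ.suc n ] = ≈-sym (≈-trans (≈-sym (assoc _ _ _)) (≈-trans (∙-congʳ (inverseʳ x)) (identityˡ _)))

  ^ℤ-pred : ∀ x z → x ^ℤ ℤ.pred z ≈ x ⁻¹ * x ^ℤ z
  ^ℤ-pred x z = begin
    x ^ℤ ℤ.pred z                 ≈˘⟨ identityˡ _ ⟩
    1# * x ^ℤ ℤ.pred z            ≈˘⟨ ∙-congʳ (inverseˡ x) ⟩
    (x ⁻¹ * x) * x ^ℤ ℤ.pred z    ≈⟨ assoc _ _ _ ⟩
    x ⁻¹ * (x * x ^ℤ ℤ.pred z)    ≈˘⟨ ∙-congˡ (^ℤ-suc x (ℤ.pred z)) ⟩
    x ⁻¹ * x ^ℤ ℤ.suc (ℤ.pred z)  ≡⟨ cong (λ w → x ⁻¹ * x ^ℤ w) (ℤ.suc-pred z) ⟩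
    x ⁻¹ * x ^ℤ z                 ∎

  ^ℤ-+ : ∀ x m n → x ^ℤ (m + n) ≈ x ^ℤ m * x ^ℤ n
  ^ℤ-+ x (+ ℕ.zero) n = ≈-trans (≈-reflexive (cong (x ^ℤ_) (ℤ.+-identityˡ n))) (≈-sym (identityˡ _))
  ^ℤ-+ x (+ ℕ.suc m) n = begin
    x ^ℤ (+ ℕ.suc m + n)        ≡⟨ cong (x ^ℤ_) (ℤ.+-assoc (+ 1) (+ m) n) ⟩
    x ^ℤ ℤ.suc (+ m + n)        ≈⟨ ^ℤ-suc x (+ m + n) ⟩
    x * x ^ℤ (+ m + n)          ≈⟨ ∙-congˡ (^ℤ-+ x (+ m) n) ⟩
    x * (x ^ℤ (+ m) * x ^ℤ n)   ≈˘⟨ assoc _ _ _ ⟩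
    x ^ℤ (+ ℕ.suc m) * x ^ℤ n   ∎
  ^ℤ-+ x -[1+ ℕ.zero ] n = ≈-trans (^ℤ-pred x n) (∙-congʳ (≈-sym (identityʳ _)))
  ^ℤ-+ x -[1+ ℕ.suc m ] n = begin
    x ^ℤ (-[1+ ℕ.suc m ] + n)          ≡⟨ cong (x ^ℤ_) (ℤ.+-assoc -[1+ 0 ] -[1+ m ] n) ⟩
    x ^ℤ ℤ.pred (-[1+ m ] + n)         ≈⟨ ^ℤ-pred x (-[1+ m ] + n) ⟩
    x ⁻¹ * x ^ℤ (-[1+ m ] + n)         ≈⟨ ∙-congˡ (^ℤ-+ x -[1+ m ] n) ⟩
    x ⁻¹ * (x ^ℤ -[1+ m ] * x ^ℤ n)    ≈˘⟨ assoc _ _ _ ⟩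
    x ^ℤ -[1+ ℕ.suc m ] * x ^ℤ n       ∎

  1^ℤ : ∀ z → 1# ^ℤ z ≈ 1#
  1^ℤ (+ ℕ.zero) = ≈-refl
  1^ℤ (+ ℕ.suc n) = ≈-trans (identityˡ _) (1^ℤ (+ n))
  1^ℤ -[1+ ℕ.zero ] = ≈-trans (identityʳ _) ε⁻¹≈ε
  1^ℤ -[1+ ℕ.suc n ] = ≈-trans (∙-cong ε⁻¹≈ε (1^ℤ -[1+ n ])) (identityˡ _)

  ^ℤ-neg : ∀ x z → x ^ℤ (- z) ≈ (x ^ℤ z) ⁻¹
  ^ℤ-neg x z = begin
    x ^ℤ (- z)                           ≈˘⟨ identityʳ _ ⟩
    x ^ℤ (- z) * 1#                      ≈˘⟨ ∙-congˡ (inverseʳ _) ⟩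
    x ^ℤ (- z) * (x ^ℤ z * (x ^ℤ z) ⁻¹)  ≈˘⟨ assoc _ _ _ ⟩
    (x ^ℤ (- z) * x ^ℤ z) * (x ^ℤ z) ⁻¹  ≈˘⟨ ∙-congʳ (^ℤ-+ x (- z) z) ⟩
    x ^ℤ (- z + z) * (x ^ℤ z) ⁻¹         ≡⟨ cong (λ w → x ^ℤ w * (x ^ℤ z) ⁻¹) (ℤ.+-inverseˡ z) ⟩
    1# * (x ^ℤ z) ⁻¹                     ≈⟨ identityˡ _ ⟩
    (x ^ℤ z) ⁻¹                          ∎

  ^ℤ-cong : ∀ {x y} z → x ≈ y → x ^ℤ z ≈ y ^ℤ z
  ^ℤ-cong (+ ℕ.zero) eq = ≈-refl
  ^ℤ-cong (+ ℕ.suc n) eq = ∙-cong eq (^ℤ-cong (+ n) eq)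
  ^ℤ-cong -[1+ ℕ.zero ] eq = ∙-cong (⁻¹-cong eq) ≈-refl
  ^ℤ-cong -[1+ ℕ.suc n ] eq = ∙-cong (⁻¹-cong eq) (^ℤ-cong -[1+ n ] eq)

  -- Identities between monomials, decided by comparing exponent vectors

  infixl 7 _·_
  infix 8 _⁻

  data Monomial (n : ℕ) : Set where
    var : Fin n → Monomial n
    _·_ : Monomial n → Monomial n → Monomial n
    _⁻  : Monomial n → Monomial n
    𝟙   : Monomial n

  v₀ : ∀ {n} → Monomial (1 ℕ.+ n)
  v₀ = var (# 0)
  v₁ : ∀ {n} → Monomial (2 ℕ.+ n)
  v₁ = var (# 1)
  v₂ : ∀ {n} → Monomial (3 ℕ.+ n)
  v₂ = var (# 2)
  v₃ : ∀ {n} → Monomial (4 ℕ.+ n)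
  v₃ = var (# 3)
  v₄ : ∀ {n} → Monomial (5 ℕ.+ n)
  v₄ = var (# 4)
  v₅ : ∀ {n} → Monomial (6 ℕ.+ n)
  v₅ = var (# 5)
  v₆ : ∀ {n} → Monomial (7 ℕ.+ n)
  v₆ = var (# 6)
  v₇ : ∀ {n} → Monomial (8 ℕ.+ n)
  v₇ = var (# 7)
  v₈ : ∀ {n} → Monomial (9 ℕ.+ n)
  v₈ = var (# 8)
  v₉ : ∀ {n} → Monomial (10 ℕ.+ n)
  v₉ = var (# 9)
  v₁₀ : ∀ {n} → Monomial (11 ℕ.+ n)
  v₁₀ = var (# 10)
  v₁₁ : ∀ {n} → Monomial (12 ℕ.+ n)
  v₁₁ = var (# 11)
  v₁₂ : ∀ {n} → Monomial (13 ℕ.+ n)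
  v₁₂ = var (# 12)
  v₁₃ : ∀ {n} → Monomial (14 ℕ.+ n)
  v₁₃ = var (# 13)
  v₁₄ : ∀ {n} → Monomial (15 ℕ.+ n)
  v₁₄ = var (# 14)
  v₁₅ : ∀ {n} → Monomial (16 ℕ.+ n)
  v₁₅ = var (# 15)
  v₁₆ : ∀ {n} → Monomial (17 ℕ.+ n)
  v₁₆ = var (# 16)

  ⟦_⟧ : ∀ {n} → Monomial n → Vec Carrier n → Carrier
  ⟦ var i ⟧ ρ = Vec.lookup ρ i
  ⟦ s · t ⟧ ρ = ⟦ s ⟧ ρ * ⟦ t ⟧ ρ
  ⟦ t ⁻ ⟧   ρ = (⟦ t ⟧ ρ) ⁻¹
  ⟦ 𝟙 ⟧     ρ = 1#

  unitVec : ∀ {n} → Fin n → Vec ℤ n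
  unitVec zero    = + 1 ∷ Vec.replicate _ (+ 0)
  unitVec (suc i) = + 0 ∷ unitVec i

  exponents : ∀ {n} → Monomial n → Vec ℤ n
  exponents (var i) = unitVec i
  exponents (s · t) = Vec.zipWith _+_ (exponents s) (exponents t)
  exponents (t ⁻)   = Vec.map -_ (exponents t)
  exponents 𝟙       = Vec.replicate _ (+ 0)

  power : ∀ {n} → Vec ℤ n → Vec Carrier n → Carrier
  power []       []      = 1#
  power (z ∷ zs) (x ∷ ρ) = x ^ℤ z * power zs ρ

  power-0 : ∀ {n} (ρ : Vec Carrier n) → power (Vec.replicate n (+ 0)) ρ ≈ 1#
  power-0 []      = ≈-refl
  power-0 (x ∷ ρ) = ≈-trans (identityˡ _) (power-0 ρ)

  power-unitVec : ∀ {n} (i : Fin n) ρ → power (unitVec i) ρ ≈ Vec.lookup ρ i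
  power-unitVec zero    (x ∷ ρ) = ≈-trans (∙-cong (identityʳ x) (power-0 ρ)) (identityʳ x)
  power-unitVec (suc i) (x ∷ ρ) = ≈-trans (identityˡ _) (power-unitVec i ρ)

  power-+ : ∀ {n} (ys zs : Vec ℤ n) ρ → power (Vec.zipWith _+_ ys zs) ρ ≈ power ys ρ * power zs ρ
  power-+ []       []       []      = ≈-sym (identityˡ _)
  power-+ (y ∷ ys) (z ∷ zs) (x ∷ ρ) = ≈-trans (∙-cong (^ℤ-+ x y z) (power-+ ys zs ρ)) (interchange _ _ _ _)

  power-neg : ∀ {n} (zs : Vec ℤ n) ρ → power (Vec.map -_ zs) ρ ≈ power zs ρ ⁻¹
  power-neg []       []      = ≈-sym ε⁻¹≈ε
  power-neg (z ∷ zs) (x ∷ ρ) = ≈-trans (∙-cong (^ℤ-neg x z) (power-neg zs ρ)) (⁻¹-∙-comm _ _)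

  power-exponents : ∀ {n} (t : Monomial n) ρ → power (exponents t) ρ ≈ ⟦ t ⟧ ρ
  power-exponents (var i) ρ = power-unitVec i ρ
  power-exponents (s · t) ρ = ≈-trans (power-+ (exponents s) (exponents t) ρ)
                                (∙-cong (power-exponents s ρ) (power-exponents t ρ))
  power-exponents (t ⁻)   ρ = ≈-trans (power-neg (exponents t) ρ) (⁻¹-cong (power-exponents t ρ))
  power-exponents 𝟙       ρ = power-0 ρ

  -- For closed `s` and `t` the exponent vectors are numerals and `eq` is `refl`; arbitrary
  -- elements, such as powers `Y ^ᵇ t`, enter as entries of `ρ`.
  monomial : ∀ {n} (ρ : Vec Carrier n) (s t : Monomial n) → exponents s ≡ exponents t → ⟦ s ⟧ ρ ≈ ⟦ t ⟧ ρ
  monomial ρ s t eq = ≈-trans (≈-sym (power-exponents s ρ))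
                        (≈-trans (≈-reflexive (cong (λ zs → power zs ρ) eq)) (power-exponents t ρ))

  -- The semifield with a zero adjoined

  infixl 6 _⊕_
  infixl 7 _⊗_
  infix 4 _≋_

  _⊕_ : Maybe Carrier → Maybe Carrier → Maybe Carrier
  nothing ⊕ y       = y
  just x  ⊕ nothing = just x
  just x  ⊕ just y  = just (x +ₛ y)

  _⊗_ : Maybe Carrier → Maybe Carrier → Maybe Carrier
  nothing ⊗ _       = nothing
  just x  ⊗ nothing = nothing
  just x  ⊗ just y  = just (x * y)

  _≋_ : Maybe Carrier → Maybe Carrier → Set (c ⊔ ℓ)
  _≋_ = Pointwise.Pointwise _≈_

  ≋-refl : ∀ {x} → x ≋ x
  ≋-refl = Pointwise.refl ≈-refl

  withZero : CommutativeSemiring c (c ⊔ ℓ)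
  withZero = record
    { Carrier = Maybe Carrier ; _≈_ = _≋_ ; _+_ = _⊕_ ; _*_ = _⊗_ ; 0# = nothing ; 1# = just 1#
    ; isCommutativeSemiring = isCommutativeSemiringˡ record
      { +-isCommutativeMonoid = record
        { isMonoid = record
          { isSemigroup = record
            { isMagma = record { isEquivalence = ≋-isEquivalence ; ∙-cong = ⊕-cong }
            ; assoc = ⊕-assoc }
          ; identity = (λ _ → ≋-refl) , ⊕-identityʳ }
        ; comm = ⊕-comm }
      ; *-isCommutativeMonoid = record
        { isMonoid = record
          { isSemigroup = record
            { isMagma = record { isEquivalence = ≋-isEquivalence ; ∙-cong = ⊗-cong }
            ; assoc = ⊗-assoc }
          ; identity = ⊗-identityˡ , ⊗-identityʳ }
        ; comm = ⊗-comm }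
      ; distribʳ = ⊗-distribʳ
      ; zeroˡ = λ _ → nothing
      }
    }
    where
    open Pointwise using (just; nothing)
    ≋-isEquivalence = Pointwise.isEquivalence (AbelianGroup.isEquivalence *-abelianGroup)
    ⊕-cong : ∀ {x y u v} → x ≋ y → u ≋ v → x ⊕ u ≋ y ⊕ v
    ⊕-cong (just p) (just q) = just (+ₛ.∙-cong p q)
    ⊕-cong (just p) nothing  = just p
    ⊕-cong nothing  q        = q
    ⊕-assoc : ∀ x y z → (x ⊕ y) ⊕ z ≋ x ⊕ (y ⊕ z)
    ⊕-assoc nothing  y        z        = ≋-refl
    ⊕-assoc (just x) nothing  z        = ≋-refl
    ⊕-assoc (just x) (just y) nothing  = ≋-refl
    ⊕-assoc (just x) (just y) (just z) = just (+ₛ.assoc x y z)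
    ⊕-comm : ∀ x y → x ⊕ y ≋ y ⊕ x
    ⊕-comm nothing  nothing  = nothing
    ⊕-comm nothing  (just y) = ≋-refl
    ⊕-comm (just x) nothing  = ≋-refl
    ⊕-comm (just x) (just y) = just (+ₛ.comm x y)
    ⊕-identityʳ : ∀ x → x ⊕ nothing ≋ x
    ⊕-identityʳ nothing  = nothing
    ⊕-identityʳ (just x) = ≋-refl
    ⊗-cong : ∀ {x y u v} → x ≋ y → u ≋ v → x ⊗ u ≋ y ⊗ v
    ⊗-cong (just p) (just q) = just (∙-cong p q)
    ⊗-cong (just p) nothing  = nothing
    ⊗-cong nothing  q        = nothing
    ⊗-assoc : ∀ x y z → (x ⊗ y) ⊗ z ≋ x ⊗ (y ⊗ z)
    ⊗-assoc nothing  y        z        = nothing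
    ⊗-assoc (just x) nothing  z        = nothing
    ⊗-assoc (just x) (just y) nothing  = nothing
    ⊗-assoc (just x) (just y) (just z) = just (assoc x y z)
    ⊗-comm : ∀ x y → x ⊗ y ≋ y ⊗ x
    ⊗-comm nothing  nothing  = nothing
    ⊗-comm nothing  (just y) = nothing
    ⊗-comm (just x) nothing  = nothing
    ⊗-comm (just x) (just y) = just (comm x y)
    ⊗-identityˡ : ∀ x → just 1# ⊗ x ≋ x
    ⊗-identityˡ nothing  = nothing
    ⊗-identityˡ (just x) = just (identityˡ x)
    ⊗-identityʳ : ∀ x → x ⊗ just 1# ≋ x
    ⊗-identityʳ nothing  = nothing
    ⊗-identityʳ (just x) = just (identityʳ x)
    ⊗-distribʳ : ∀ x y z → (y ⊕ z) ⊗ x ≋ y ⊗ x ⊕ z ⊗ x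
    ⊗-distribʳ x        nothing  z        = ≋-refl
    ⊗-distribʳ nothing  (just y) nothing  = nothing
    ⊗-distribʳ nothing  (just y) (just z) = nothing
    ⊗-distribʳ (just x) (just y) nothing  = ≋-refl
    ⊗-distribʳ (just x) (just y) (just z) = just (proj₂ distrib x y z)

  open CommutativeSemiring withZero public
    using (*-cong; *-congˡ; *-congʳ; *-assoc; *-comm; *-identityˡ; *-identityʳ; +-cong; +-congˡ; +-congʳ;
           distribˡ; distribʳ; zeroʳ; +-identityʳ)
    renaming (setoid to ≋-setoid; sym to ≋-sym; trans to ≋-trans; reflexive to ≋-reflexive;
              *-commutativeMonoid to ⊗-commutativeMonoid; +-commutativeMonoid to ⊕-commutativeMonoid)

  module ∏ₛ = Product *-commutativeMonoid
  open Product ⊗-commutativeMonoid public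
  open Product ⊕-commutativeMonoid public
    using () renaming (∏ to ∑; ∏-cong to ∑-cong; ∏-++ to ∑-++; ∏-map to ∑-map; ∏-filter to ∑-filter)

  just-∏ : ∀ {a} {A : Set a} (xs : List A) g → just (∏ₛ.∏ xs g) ≋ ∏ xs (just ∘ g)
  just-∏ []       g = ≋-refl
  just-∏ (x ∷ xs) g = *-congˡ {just (g x)} (just-∏ xs g)

  ∑-*ˡ : ∀ {a} {A : Set a} (xs : List A) k g → k ⊗ ∑ xs g ≋ ∑ xs (λ x → k ⊗ g x)
  ∑-*ˡ []       k g = zeroʳ k
  ∑-*ˡ (x ∷ xs) k g = ≋-trans (distribˡ k (g x) (∑ xs g)) (+-congˡ {k ⊗ g x} (∑-*ˡ xs k g))

  foldr-∑ : ∀ t ts → just (foldr _+ₛ_ t ts) ≋ just t ⊕ ∑ ts just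
  foldr-∑ t []       = ≋-refl
  foldr-∑ t (u ∷ ts) = ≋-trans (+-congˡ {just u} (foldr-∑ t ts)) (x∙yz≈y∙xz (just u) (just t) (∑ ts just))
    where open CommutativeSemigroupProperties (CommutativeMonoid.commutativeSemigroup ⊕-commutativeMonoid) using (x∙yz≈y∙xz)

  -- The empty sum is `nothing`, which is never `just s`. The existence of a perfect matching thus
  -- comes out of the computation and needs no argument of its own.
  ∑⇒SumsTo : ∀ ts {s} → ∑ ts just ≋ just s → SumsTo ts s
  ∑⇒SumsTo (t ∷ ts) eq = Pointwise.drop-just (≋-trans (foldr-∑ t ts) eq)

  -- The Iverson bracket.
  [_] : Bool → Maybe Carrier
  [ true  ] = just 1#
  [ false ] = nothing

  [∧] : ∀ b b′ → [ b ∧ b′ ] ≋ [ b ] ⊗ [ b′ ]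
  [∧] true  b′ = ≋-sym (*-identityˡ [ b′ ])
  [∧] false b′ = Pointwise.nothing

  open Assignments _≟E_ public
  open Sums withZero public

  -- Edges chosen earlier in the recursion are recorded in `σ`, hence the disjunction; uniqueness of
  -- `L` ensures that `σ` is still off on the edges to come.
  Sum-subsets : ∀ h n i j es L {Φ} → Unique L → Extensional Φ → ∀ {σ} → (∀ {e} → e ∈ L → σ e ≡ false) →
    Sum L Φ σ ≋ ∑ (Subgraph.WithEdges.subsets h n i j es L) (λ M → Φ (λ e → does (e MemE.∈? M) ∨ σ e))
  Sum-subsets h n i j es [] u ext off = ≋-sym (+-identityʳ _)
  Sum-subsets h n i j es (e ∷ L) {Φ} u ext {σ} off = ≋-trans (+-cong falseBranch trueBranch)
      -- `subsets` lists the sublists containing `e` before the others, whereas `Sum` starts with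
      -- `false`.
      (≋-trans (⊕-comm (∑ Ms (Φ∪ σ)) (∑ (map (e ∷_) Ms) (Φ∪ σ))) (≋-sym (∑-++ (map (e ∷_) Ms) (Φ∪ σ))))
    where
    ⊕-comm = CommutativeSemiring.+-comm withZero
    Ms = Subgraph.WithEdges.subsets h n i j es L
    Φ∪ : Assignment → List Edge → Maybe Carrier
    Φ∪ τ M = Φ (λ e → does (e MemE.∈? M) ∨ τ e)
    put-false : ∀ e′ → put e false σ e′ ≡ σ e′
    put-false e′ with e′ ≟E e
    ... | yes refl = sym (off (here refl))
    ... | no _ = refl
    falseBranch : Sum L Φ (put e false σ) ≋ ∑ Ms (Φ∪ σ)
    falseBranch = ≋-trans (Sum-ext L ext put-false) (Sum-subsets h n i j es L (unique-++ʳ (e ∷ []) u) ext (off ∘ there))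
    ∪-put : ∀ M e′ → does (e′ MemE.∈? M) ∨ put e true σ e′ ≡ does (e′ MemE.∈? (e ∷ M)) ∨ σ e′
    ∪-put M e′ with e′ ≟E e | does (e′ MemE.∈? M)
    ... | yes _ | true = refl
    ... | yes _ | false = refl
    ... | no _  | _ = refl
    trueBranch : Sum L Φ (put e true σ) ≋ ∑ (map (e ∷_) Ms) (Φ∪ σ)
    trueBranch = ≋-trans
      (Sum-subsets h n i j es L (unique-++ʳ (e ∷ []) u) ext
        (λ {e′} e′∈L → trans (put-≢ {e} {e′} true σ (λ { refl → unique-head u e′∈L })) (off (there e′∈L))))
      (≋-trans (∑-cong Ms (λ {M} _ → ext (∪-put M))) (≋-reflexive (sym (∑-map (e ∷_) Ms (Φ∪ σ)))))

-- Blocks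

infixr 4 _⇒_

_⇒_ : Bool → Bool → Bool
true  ⇒ b = b
false ⇒ b = true

exactlyOne₃ : Bool → Bool → Bool → Bool
exactlyOne₃ true  y z = not y ∧ not z
exactlyOne₃ false y z = y xor z

exactlyOne₄ : Bool → Bool → Bool → Bool → Bool
exactlyOne₄ true  x y z = not x ∧ not y ∧ not z
exactlyOne₄ false x y z = exactlyOne₃ x y z

-- Which of the sides s, e, n, w and of the diagonal d of a block may occur in a perfect matching,
-- given which of its four corners are closed: a vertex belongs to G when some incident face is closed.
admissible : Kind → (q00 q10 q01 q11 : Bool) → (s e n w d : Bool) → Bool
admissible k q00 q10 q01 q11 s e n w d =
  (s ⇒ q00 ∨ q10) ∧ (e ⇒ q10 ∨ q11) ∧ (n ⇒ q01 ∨ q11) ∧ (w ⇒ q00 ∨ q01) ∧ vertices k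
  where
  vertices : Kind → Bool
  vertices cross      = not d ∧ (q00 ∨ q10 ∨ q01 ∨ q11 ⇒ exactlyOne₄ s e n w)
  vertices wrenchMain = (d ⇒ q00 ∨ q11) ∧ (q00 ∨ q11 ∨ q10 ⇒ exactlyOne₃ s e d)
                                        ∧ (q00 ∨ q11 ∨ q01 ⇒ exactlyOne₃ w n d)
  vertices wrenchAnti = (d ⇒ q10 ∨ q01) ∧ (q10 ∨ q01 ∨ q00 ⇒ exactlyOne₃ s w d)
                                        ∧ (q10 ∨ q01 ∨ q11 ⇒ exactlyOne₃ e n d)

-- The wrench in which the given corner belongs to the unequal pair. All neighbours of a local
-- minimum have the same height, so no other wrench occurs around it.
wrenchAt : Corner → Kind
wrenchAt c00 = wrenchAnti
wrenchAt c11 = wrenchAnti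
wrenchAt c10 = wrenchMain
wrenchAt c01 = wrenchMain

-- The block seen from its corner X: P and P′ are the neighbours of X in the block, O is opposite to X,
-- and i₁, i₂, o₁, o₂ are the sides X|P, X|P′, O|P, O|P′.
admissibleFrom : Corner → (wrench : Bool) → (qX qP qP′ qO : Bool) → (i₁ i₂ o₁ o₂ d : Bool) → Bool
admissibleFrom X wrench qX qP qP′ qO i₁ i₂ o₁ o₂ d = at-corner X (if wrench then wrenchAt X else cross)
  where
  at-corner : Corner → Kind → Bool
  at-corner c00 k = admissible k qX qP qP′ qO i₁ o₁ o₂ i₂ d
  at-corner c11 k = admissible k qO qP qP′ qX o₁ i₁ i₂ o₂ d
  at-corner c10 k = admissible k qP qX qO qP′ i₁ i₂ o₂ o₁ d
  at-corner c01 k = admissible k qP qO qX qP′ o₁ o₂ i₂ i₁ d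

_==_ : Bool → Bool → Bool
true  == b = b
false == b = not b

==⇒≡ : ∀ b b′ → (b == b′) ≡ true → b ≡ b′
==⇒≡ true  true  _ = refl
==⇒≡ false false _ = refl

-- Proof by truth table: for a closed formula the premise of `instantiate` is settled by evaluating
-- all cases.
holdsEverywhere : ∀ n → (Vec Bool n → Bool) → Bool
holdsEverywhere ℕ.zero    f = f []
holdsEverywhere (ℕ.suc n) f = holdsEverywhere n (f ∘ (true ∷_)) ∧ holdsEverywhere n (f ∘ (false ∷_))

∧-true : ∀ {b b′} → b ∧ b′ ≡ true → b ≡ true × b′ ≡ true
∧-true {true} {true} _ = refl , refl

instantiate : ∀ n f → holdsEverywhere n f ≡ true → ∀ v → f v ≡ true
instantiate ℕ.zero    f eq []          = eq
instantiate (ℕ.suc n) f eq (true ∷ v)  = instantiate n _ (proj₁ (∧-true eq)) v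
instantiate (ℕ.suc n) f eq (false ∷ v) = instantiate n _ (proj₂ (∧-true {holdsEverywhere n (f ∘ (true ∷_))} eq)) v

-- The number of chosen sides is r, read as 0 or 1.
ι : Bool → Bool → Bool → Bool
ι true  i₁ i₂ = i₁ xor i₂
ι false i₁ i₂ = not (i₁ ∨ i₂)

-- The two outer sides end in a common vertex, in a cross and in a wrench alike, so at most one of
-- them is used.
outerOk : (qP qP′ qO o₁ o₂ : Bool) → Bool
outerOk qP qP′ qO o₁ o₂ = (o₁ ⇒ qP ∨ qO) ∧ (o₂ ⇒ qP′ ∨ qO) ∧ not (o₁ ∧ o₂)

-- Vacuous as long as `X` is closed. After the move `X` may be open, and an inner side then remains
-- an edge only if the face beyond it is closed.
innerOk : (qX qP qP′ i₁ i₂ : Bool) → Bool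
innerOk qX qP qP′ i₁ i₂ = (i₁ ⇒ qX ∨ qP) ∧ (i₂ ⇒ qX ∨ qP′)

-- The block lies on the side of X facing away from the apex.
outward : (qP qP′ : Bool) → Bool
outward qP qP′ = not (qP ∨ qP′)

-- The number of sides at X that a matching must use, given whether it uses an outer side.
demand : (wrench out o : Bool) → Bool
demand wrench out o = out ∨ (if wrench then o else not o)

module _ (X : Corner) (wr qP qP′ qO q i₁ i₂ o₁ o₂ : Bool)
         -- Here `q` tells whether `X` is still closed once raised. Where both neighbours of `X` are
         -- open, the opposite corner is open and so is the raised `X`.
         (cond : (outward qP qP′ ⇒ not (qO ∨ q)) ≡ true) where
  private
    out = outward qP qP′
    o = o₁ ∨ o₂
    r = demand wr out o
    v : Vec Bool 9
    v = wr ∷ qP ∷ qP′ ∷ qO ∷ q ∷ i₁ ∷ i₂ ∷ o₁ ∷ o₂ ∷ []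

    Formula : Set
    Formula = (wr qP qP′ qO q i₁ i₂ o₁ o₂ : Bool) → Bool

    check : Formula → Vec Bool 9 → Bool
    check f (wr ∷ qP ∷ qP′ ∷ qO ∷ q ∷ i₁ ∷ i₂ ∷ o₁ ∷ o₂ ∷ []) =
      (outward qP qP′ ⇒ not (qO ∨ q)) ⇒ f wr qP qP′ qO q i₁ i₂ o₁ o₂

    conclude : ∀ (f g : Formula) →
      holdsEverywhere 9 (check λ a b c d e k l m n → f a b c d e k l m n == g a b c d e k l m n) ≡ true →
      f wr qP qP′ qO q i₁ i₂ o₁ o₂ ≡ g wr qP qP′ qO q i₁ i₂ o₁ o₂
    conclude f g eq = ==⇒≡ _ _ (modusPonens _ cond
      (instantiate 9 (check λ a b c d e k l m n → f a b c d e k l m n == g a b c d e k l m n) eq v))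
      where
      modusPonens : ∀ b {b′} → b ≡ true → (b ⇒ b′) ≡ true → b′ ≡ true
      modusPonens true _ eq = eq

    before after : Bool → Formula
    before d wr qP qP′ qO q i₁ i₂ o₁ o₂ =
      let out = outward qP qP′ ; o = o₁ ∨ o₂ ; one = not wr ∨ out ∨ o in
      outerOk qP qP′ qO o₁ o₂ ∧ ι (demand wr out o) i₁ i₂ ∧ (if d then not one else one)
    after d wr qP qP′ qO q i₁ i₂ o₁ o₂ =
      let out = outward qP qP′ ; o = o₁ ∨ o₂ ; one = wr ∨ out ∨ o in
      outerOk qP qP′ qO o₁ o₂ ∧ (ι (not (demand wr out o)) i₁ i₂ ∧ innerOk q qP qP′ i₁ i₂) ∧ (if d then not one else one)

  -- Separates the outer sides from the inner ones: once the outer sides are given, the block acts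
  -- on the square only through the demand `r`, and its diagonal is determined.
  before-flip : ∀ d → admissibleFrom X wr true qP qP′ qO i₁ i₂ o₁ o₂ d ≡
    outerOk qP qP′ qO o₁ o₂ ∧ ι r i₁ i₂ ∧ (if d then not (not wr ∨ out ∨ o) else (not wr ∨ out ∨ o))
  before-flip d = conclude (λ a b c e f k l m n → admissibleFrom X a true b c e k l m n d) (before d) (decide X d)
    where
    decide : ∀ X d → holdsEverywhere 9 (check λ a b c e f k l m n →
               admissibleFrom X a true b c e k l m n d == before d a b c e f k l m n) ≡ true
    decide c00 true = refl
    decide c00 false = refl
    decide c10 true = refl
    decide c10 false = refl
    decide c01 true = refl
    decide c01 false = refl
    decide c11 true = refl
    decide c11 false = refl

  -- The outer condition is unchanged and the demand is negated. A cross and a wrench react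
  -- oppositely to an outer side; an outward block demands an inner side while `X` is closed and
  -- none once `X` is open.
  after-flip : ∀ d → admissibleFrom X (not wr) q qP qP′ qO i₁ i₂ o₁ o₂ d ≡
    outerOk qP qP′ qO o₁ o₂ ∧ (ι (not r) i₁ i₂ ∧ innerOk q qP qP′ i₁ i₂) ∧ (if d then not (wr ∨ out ∨ o) else (wr ∨ out ∨ o))
  after-flip d = conclude (λ a b c e f k l m n → admissibleFrom X (not a) f b c e k l m n d) (after d) (decide X d)
    where
    decide : ∀ X d → holdsEverywhere 9 (check λ a b c e f k l m n →
               admissibleFrom X (not a) f b c e k l m n d == after d a b c e f k l m n) ≡ true
    decide c00 true = refl
    decide c00 false = refl
    decide c10 true = refl
    decide c10 false = refl
    decide c01 true = refl
    decide c01 false = refl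
    decide c11 true = refl
    decide c11 false = refl

-- Urban renewal: the corner blocks and the square between them

module FlipAlgebra {c ℓ} (S : Semifield c ℓ) where
  open Semifield S
  open SemifieldProperties S
  open Pointwise using (just; nothing)

  infix 8 _^ᵇ_

  _^ᵇ_ : Carrier → Bool → Carrier
  Y ^ᵇ true  = Y
  Y ^ᵇ false = 1#

  viaDiagonal : Carrier → (Bool → Bool) → Maybe Carrier
  viaDiagonal y φ = [ φ false ] ⊕ just y ⊗ [ φ true ]

  module CornerFlip (X : Corner) (wr qP qP′ qO q : Bool) (cond : (outward qP qP′ ⇒ not (qO ∨ q)) ≡ true)
                (o₁ o₂ : Bool) (Y : Carrier) where
    out o r : Bool
    out = outward qP qP′
    o = o₁ ∨ o₂
    r = demand wr out o

    -- `Y` will be the product of the values at the two neighbours, so that a diagonal weighs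
    -- `Y ⁻¹`. Besides the condition on its inner sides, the block contributes `common` after the
    -- move, and `common` times `scale` and `Y ^ᵇ r` before it. As `scale` ignores the outer sides,
    -- it can leave every sum.
    scale : Carrier
    scale = (Y ⁻¹) ^ᵇ (wr ∨ out)

    common : Maybe Carrier
    common = [ outerOk qP qP′ qO o₁ o₂ ] ⊗ just ((Y ⁻¹) ^ᵇ not (wr ∨ out ∨ o))

    before-≋ : ∀ y → (wr ≡ true → y ≈ Y ⁻¹) → ∀ i₁ i₂ →
      viaDiagonal y (admissibleFrom X wr true qP qP′ qO i₁ i₂ o₁ o₂) ≋
      (just scale ⊗ common) ⊗ (just (Y ^ᵇ r) ⊗ [ ι r i₁ i₂ ])
    before-≋ y hy i₁ i₂
      rewrite before-flip X wr qP qP′ qO q i₁ i₂ o₁ o₂ cond false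
            | before-flip X wr qP qP′ qO q i₁ i₂ o₁ o₂ cond true
      = values wr out o (outerOk qP qP′ qO o₁ o₂) (λ r → ι r i₁ i₂) hy
      where
      values : ∀ wr out o ok (ι : Bool → Bool) → (wr ≡ true → y ≈ Y ⁻¹) → let r = demand wr out o in
        [ ok ∧ ι r ∧ (not wr ∨ out ∨ o) ] ⊕ just y ⊗ [ ok ∧ ι r ∧ not (not wr ∨ out ∨ o) ] ≋
        (just ((Y ⁻¹) ^ᵇ (wr ∨ out)) ⊗ ([ ok ] ⊗ just ((Y ⁻¹) ^ᵇ not (wr ∨ out ∨ o)))) ⊗
        (just (Y ^ᵇ r) ⊗ [ ι r ])
      values wr out o false ι _ = nothing
      values wr out o true ι hy with ι (demand wr out o)
      values false false false true ι hy | false = nothing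
      values false false true  true ι hy | false = nothing
      values false true  o     true ι hy | false = nothing
      values true  false false true ι hy | false = nothing
      values true  false true  true ι hy | false = nothing
      values true  true  o     true ι hy | false = nothing
      values false false false true ι hy | true = just (monomial (Y ∷ []) 𝟙 ((𝟙 · (𝟙 · v₀ ⁻)) · (v₀ · 𝟙)) refl)
      values false false true  true ι hy | true = just (monomial (Y ∷ []) 𝟙 ((𝟙 · (𝟙 · 𝟙)) · (𝟙 · 𝟙)) refl)
      values false true  o     true ι hy | true = just (monomial (Y ∷ []) 𝟙 ((v₀ ⁻ · (𝟙 · 𝟙)) · (v₀ · 𝟙)) refl)
      values true  false false true ι hy | true = just (≈-trans (∙-congʳ (hy refl))
        (monomial (Y ∷ []) (v₀ ⁻ · 𝟙) ((v₀ ⁻ · (𝟙 · 𝟙)) · (𝟙 · 𝟙)) refl))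
      values true  false true  true ι hy | true = just (monomial (Y ∷ []) 𝟙 ((v₀ ⁻ · (𝟙 · 𝟙)) · (v₀ · 𝟙)) refl)
      values true  true  o     true ι hy | true = just (monomial (Y ∷ []) 𝟙 ((v₀ ⁻ · (𝟙 · 𝟙)) · (v₀ · 𝟙)) refl)

    after-≋ : ∀ y → (not wr ≡ true → y ≈ Y ⁻¹) → ∀ i₁ i₂ →
      viaDiagonal y (admissibleFrom X (not wr) q qP qP′ qO i₁ i₂ o₁ o₂) ≋
      common ⊗ [ ι (not r) i₁ i₂ ∧ innerOk q qP qP′ i₁ i₂ ]
    after-≋ y hy i₁ i₂
      rewrite after-flip X wr qP qP′ qO q i₁ i₂ o₁ o₂ cond false
            | after-flip X wr qP qP′ qO q i₁ i₂ o₁ o₂ cond true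
      = values wr out o (outerOk qP qP′ qO o₁ o₂) (ι (not r) i₁ i₂ ∧ innerOk q qP qP′ i₁ i₂) hy
      where
      values : ∀ wr out o ok b → (not wr ≡ true → y ≈ Y ⁻¹) →
        [ ok ∧ b ∧ (wr ∨ out ∨ o) ] ⊕ just y ⊗ [ ok ∧ b ∧ not (wr ∨ out ∨ o) ] ≋
        ([ ok ] ⊗ just ((Y ⁻¹) ^ᵇ not (wr ∨ out ∨ o))) ⊗ [ b ]
      values wr    out   o     false b     _  = nothing
      values true  out   o     true  false _  = nothing
      values false true  o     true  false _  = nothing
      values false false true  true  false _  = nothing
      values false false false true  false _  = nothing
      values true  out   o     true  true  _  = just (≈-sym (≈-trans (identityʳ _) (identityʳ _)))
      values false true  o     true  true  _  = just (≈-sym (≈-trans (identityʳ _) (identityʳ _)))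
      values false false true  true  true  _  = just (≈-sym (≈-trans (identityʳ _) (identityʳ _)))
      values false false false true  true  hy = just (≈-trans (identityʳ _) (≈-trans (hy refl)
        (≈-sym (≈-trans (identityʳ _) (identityˡ _)))))

  ∑₂ : (Bool → Maybe Carrier) → Maybe Carrier
  ∑₂ φ = φ false ⊕ φ true

  ∑₄ : (Bool → Bool → Maybe Carrier) → Maybe Carrier
  ∑₄ φ = ∑₂ λ s → ∑₂ (φ s)

  ∑₁₆ : (Bool → Bool → Bool → Bool → Maybe Carrier) → Maybe Carrier
  ∑₁₆ φ = ∑₄ λ w e → ∑₄ (φ w e)

  ∑₂-cong : ∀ {φ ψ} → (∀ b → φ b ≋ ψ b) → ∑₂ φ ≋ ∑₂ ψ
  ∑₂-cong eq = +-cong (eq false) (eq true)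

  ∑₄-cong : ∀ {φ ψ} → (∀ s n → φ s n ≋ ψ s n) → ∑₄ φ ≋ ∑₄ ψ
  ∑₄-cong {φ} {ψ} eq = ∑₂-cong {λ s → ∑₂ (φ s)} {λ s → ∑₂ (ψ s)} λ s → ∑₂-cong {φ s} {ψ s} (eq s)

  ∑₁₆-cong : ∀ {φ ψ} → (∀ w e s n → φ w e s n ≋ ψ w e s n) → ∑₁₆ φ ≋ ∑₁₆ ψ
  ∑₁₆-cong {φ} {ψ} eq = ∑₄-cong {λ w e → ∑₄ (φ w e)} {λ w e → ∑₄ (ψ w e)}
                          λ w e → ∑₄-cong {φ w e} {ψ w e} (eq w e)

  ∑₂-*ˡ : ∀ k {φ ψ} → (∀ b → k ⊗ φ b ≋ ψ b) → k ⊗ ∑₂ φ ≋ ∑₂ ψ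
  ∑₂-*ˡ k {φ} eq = ≋-trans (distribˡ k (φ false) (φ true)) (+-cong (eq false) (eq true))

  ∑₄-*ˡ : ∀ k {φ ψ} → (∀ s n → k ⊗ φ s n ≋ ψ s n) → k ⊗ ∑₄ φ ≋ ∑₄ ψ
  ∑₄-*ˡ k {φ} {ψ} eq = ∑₂-*ˡ k {λ s → ∑₂ (φ s)} {λ s → ∑₂ (ψ s)} λ s → ∑₂-*ˡ k {φ s} {ψ s} (eq s)

  ∑₁₆-*ˡ : ∀ k φ → k ⊗ ∑₁₆ φ ≋ ∑₁₆ (λ w e s n → k ⊗ φ w e s n)
  ∑₁₆-*ˡ k φ = ∑₄-*ˡ k {λ w e → ∑₄ (φ w e)} λ w e → ∑₄-*ˡ k {φ w e} λ _ _ → ≋-refl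

  -- Matchings inside the square around a face: the sides W, E, S, N have the given weights and
  -- may be used if allowed, and the corners SW, SE, NW, NE have the given demands.
  module Square (wW wE wS wN : Carrier) (allowed : Bool → Bool → Bool → Bool → Bool) where

    fits : (sw se nw ne : Bool) → (w e s n : Bool) → Bool
    fits sw se nw ne w e s n = ι sw s w ∧ ι se s e ∧ ι nw w n ∧ ι ne e n

    weight : (w e s n : Bool) → Carrier
    weight w e s n = (wW ^ᵇ w * wE ^ᵇ e) * (wS ^ᵇ s * wN ^ᵇ n)

    Z : (sw se nw ne : Bool) → Maybe Carrier
    Z sw se nw ne = ∑₁₆ λ w e s n → [ fits sw se nw ne w e s n ∧ allowed w e s n ] ⊗ just (weight w e s n)

  always : Bool → Bool → Bool → Bool → Bool
  always _ _ _ _ = true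

  sidesOk : (aW aE aS aN : Bool) → Bool → Bool → Bool → Bool → Bool
  sidesOk aW aE aS aN w e s n = (w ⇒ aW) ∧ (e ⇒ aE) ∧ (s ⇒ aS) ∧ (n ⇒ aN)

  -- Urban renewal: flipping the face replaces the square by one with complementary demands.
  module Renewal (F F′ W E S N a b c d : Carrier) (octahedron : F′ * F ≈ a * c * N * S +ₛ b * d * E * W) where

    module Old = Square (c * (F * W) ⁻¹) (a * (F * E) ⁻¹) (d * (F * S) ⁻¹) (b * (F * N) ⁻¹) always
    module New (aW aE aS aN : Bool) =
      Square (a * (F′ * W) ⁻¹) (c * (F′ * E) ⁻¹) (b * (F′ * S) ⁻¹) (d * (F′ * N) ⁻¹) (sidesOk aW aE aS aN)

    private
      ρ : Vec Carrier 10
      ρ = F ∷ F′ ∷ W ∷ E ∷ S ∷ N ∷ a ∷ b ∷ c ∷ d ∷ []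
      f f′ w e s n a′ b′ c′ d′ : Monomial 10
      f = v₀
      f′ = v₁
      w = v₂
      e = v₃
      s = v₄
      n = v₅
      a′ = v₆
      b′ = v₇
      c′ = v₈
      d′ = v₉

      solve : ∀ s t → exponents s ≡ exponents t → ⟦ s ⟧ ρ ≈ ⟦ t ⟧ ρ
      solve = monomial ρ

      distribute : ∀ k x y → k * (x +ₛ y) ≈ k * x +ₛ k * y
      distribute = proj₁ distrib

      open SetoidReasoning setoid

      full : F * (((S * W) * ((S * E) * ((W * N) * (E * N)))) *
               (1# * ((1# * 1#) * (d * (F * S) ⁻¹ * (b * (F * N) ⁻¹))) +ₛ
                1# * ((c * (F * W) ⁻¹ * (a * (F * E) ⁻¹)) * (1# * 1#)))) ≈
             F′ * (W * E * (S * N)) * (1# * ((1# * 1#) * (1# * 1#)))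
      full = begin
        F * (Y * (p +ₛ q))                ≈⟨ ∙-congˡ (distribute Y p q) ⟩
        F * (Y * p +ₛ Y * q)              ≈⟨ distribute F (Y * p) (Y * q) ⟩
        F * (Y * p) +ₛ F * (Y * q)        ≈⟨ +ₛ.comm _ _ ⟩
        F * (Y * q) +ₛ F * (Y * p)
          ≈⟨ +ₛ.∙-cong (solve (f · (y · (𝟙 · ((c′ · (f · w) ⁻ · (a′ · (f · e) ⁻)) · (𝟙 · 𝟙))))) (k · (a′ · c′ · n · s)) refl)
                       (solve (f · (y · (𝟙 · ((𝟙 · 𝟙) · (d′ · (f · s) ⁻ · (b′ · (f · n) ⁻)))))) (k · (b′ · d′ · e · w)) refl) ⟩
        ⟦ k ⟧ ρ * (a * c * N * S) +ₛ ⟦ k ⟧ ρ * (b * d * E * W) ≈˘⟨ distribute _ _ _ ⟩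
        ⟦ k ⟧ ρ * (a * c * N * S +ₛ b * d * E * W)             ≈˘⟨ ∙-congˡ octahedron ⟩
        ⟦ k ⟧ ρ * (F′ * F)                ≈⟨ solve (k · (f′ · f)) (f′ · (w · e · (s · n)) · (𝟙 · ((𝟙 · 𝟙) · (𝟙 · 𝟙)))) refl ⟩
        F′ * (W * E * (S * N)) * (1# * ((1# * 1#) * (1# * 1#))) ∎
        where
        Y = (S * W) * ((S * E) * ((W * N) * (E * N)))
        p = 1# * ((1# * 1#) * (d * (F * S) ⁻¹ * (b * (F * N) ⁻¹)))
        q = 1# * ((c * (F * W) ⁻¹ * (a * (F * E) ⁻¹)) * (1# * 1#))
        y = (s · w) · ((s · e) · ((w · n) · (e · n)))
        k = (w · e · (s · n)) · f ⁻

      empty : F * ((1# * (1# * (1# * 1#))) * (1# * ((1# * 1#) * (1# * 1#)))) ≈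
              F′ * (W * E * (S * N)) *
               (1# * ((1# * 1#) * (b * (F′ * S) ⁻¹ * (d * (F′ * N) ⁻¹))) +ₛ
                1# * ((a * (F′ * W) ⁻¹ * (c * (F′ * E) ⁻¹)) * (1# * 1#)))
      empty = begin
        F * ((1# * (1# * (1# * 1#))) * (1# * ((1# * 1#) * (1# * 1#))))
          ≈⟨ solve (f · ((𝟙 · (𝟙 · (𝟙 · 𝟙))) · (𝟙 · ((𝟙 · 𝟙) · (𝟙 · 𝟙))))) (f′ ⁻ · (f′ · f)) refl ⟩
        F′ ⁻¹ * (F′ * F)                                     ≈⟨ ∙-congˡ octahedron ⟩
        F′ ⁻¹ * (a * c * N * S +ₛ b * d * E * W)              ≈⟨ distribute _ _ _ ⟩
        F′ ⁻¹ * (a * c * N * S) +ₛ F′ ⁻¹ * (b * d * E * W)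
          ≈⟨ +ₛ.∙-cong (solve (f′ ⁻ · (a′ · c′ · n · s)) (x · (𝟙 · ((a′ · (f′ · w) ⁻ · (c′ · (f′ · e) ⁻)) · (𝟙 · 𝟙)))) refl)
                       (solve (f′ ⁻ · (b′ · d′ · e · w)) (x · (𝟙 · ((𝟙 · 𝟙) · (b′ · (f′ · s) ⁻ · (d′ · (f′ · n) ⁻))))) refl) ⟩
        X * q +ₛ X * p  ≈⟨ +ₛ.comm _ _ ⟩
        X * p +ₛ X * q  ≈˘⟨ distribute _ _ _ ⟩
        X * (p +ₛ q)    ∎
        where
        X = F′ * (W * E * (S * N))
        x = f′ · (w · e · (s · n))
        p = 1# * ((1# * 1#) * (b * (F′ * S) ⁻¹ * (d * (F′ * N) ⁻¹)))
        q = 1# * ((a * (F′ * W) ⁻¹ * (c * (F′ * E) ⁻¹)) * (1# * 1#))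

    -- Six demand patterns admit a matching of the square. If all corners or none demand an edge,
    -- there are two matchings on one side of the move and the empty one on the other, which is the
    -- octahedron relation. If two adjacent corners do, there is one matching on each side; it moves
    -- to the opposite side of the square, which then carries the same label. In the other ten
    -- patterns both sums are zero. The hypotheses on `aW` to `aN` guarantee that a side demanded at
    -- both ends after the move is still an edge.
    renewal : ∀ sw se nw ne aW aE aS aN →
      (sw ∨ nw) ∨ aW ≡ true → (se ∨ ne) ∨ aE ≡ true → (sw ∨ se) ∨ aS ≡ true → (nw ∨ ne) ∨ aN ≡ true →
      just F ⊗ (just ((S * W) ^ᵇ sw * ((S * E) ^ᵇ se * ((W * N) ^ᵇ nw * (E * N) ^ᵇ ne))) ⊗ Old.Z sw se nw ne) ≋
      just (F′ * (W * E * (S * N))) ⊗ New.Z aW aE aS aN (not sw) (not se) (not nw) (not ne)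
    renewal true  true  true  true  _ _ _ _ _ _ _ _ = just full
    renewal false false false false .true .true .true .true refl refl refl refl = just empty
    renewal true  true  false false _ _ _ .true _ _ _ refl = just (solve
      (f · (((s · w) · ((s · e) · (𝟙 · 𝟙))) · (𝟙 · ((𝟙 · 𝟙) · ((d′ · (f · s) ⁻) · 𝟙)))))
      ((f′ · (w · e · (s · n))) · (𝟙 · ((𝟙 · 𝟙) · (𝟙 · (d′ · (f′ · n) ⁻))))) refl)
    renewal false false true  true  _ _ .true _ _ _ refl _ = just (solve
      (f · ((𝟙 · (𝟙 · ((w · n) · (e · n)))) · (𝟙 · ((𝟙 · 𝟙) · (𝟙 · (b′ · (f · n) ⁻))))))
      ((f′ · (w · e · (s · n))) · (𝟙 · ((𝟙 · 𝟙) · ((b′ · (f′ · s) ⁻) · 𝟙)))) refl)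
    renewal true  false true  false _ .true _ _ _ refl _ _ = just (solve
      (f · (((s · w) · (𝟙 · ((w · n) · 𝟙))) · (𝟙 · (((c′ · (f · w) ⁻) · 𝟙) · (𝟙 · 𝟙)))))
      ((f′ · (w · e · (s · n))) · (𝟙 · ((𝟙 · (c′ · (f′ · e) ⁻)) · (𝟙 · 𝟙)))) refl)
    renewal false true  false true  .true _ _ _ refl _ _ _ = just (solve
      (f · ((𝟙 · ((s · e) · (𝟙 · (e · n)))) · (𝟙 · ((𝟙 · (a′ · (f · e) ⁻)) · (𝟙 · 𝟙)))))
      ((f′ · (w · e · (s · n))) · (𝟙 · (((a′ · (f′ · w) ⁻) · 𝟙) · (𝟙 · 𝟙)))) refl)
    renewal true  false false true  _ _ _ _ _ _ _ _ = nothing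
    renewal false true  true  false _ _ _ _ _ _ _ _ = nothing
    renewal true  false false false _ _ _ _ _ _ _ _ = nothing
    renewal false true  false false _ _ _ _ _ _ _ _ = nothing
    renewal false false true  false _ _ _ _ _ _ _ _ = nothing
    renewal false false false true  _ _ _ _ _ _ _ _ = nothing
    renewal true  true  true  false _ _ _ _ _ _ _ _ = nothing
    renewal true  true  false true  _ _ _ _ _ _ _ _ = nothing
    renewal true  false true  true  _ _ _ _ _ _ _ _ = nothing
    renewal false true  true  true  _ _ _ _ _ _ _ _ = nothing

-- Heights around a block

-- `kind` as a function of the four heights, so that heights known only up to an equation can be
-- substituted.
kindOf : (z₀₀ z₁₀ z₀₁ z₁₁ : ℤ) → Kind
kindOf z₀₀ z₁₀ z₀₁ z₁₁ with z₀₀ ℤ.≟ z₁₁ | z₁₀ ℤ.≟ z₀₁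
... | yes _ | yes _ = cross
... | yes _ | no  _ = wrenchMain
... | no  _ | _     = wrenchAnti

kind≡kindOf : ∀ h i j → kind h i j ≡ kindOf (h i j) (h (i + + 1) j) (h i (j + + 1)) (h (i + + 1) (j + + 1))
kind≡kindOf h i j with h i j ℤ.≟ h (i + + 1) (j + + 1) | h (i + + 1) j ℤ.≟ h i (j + + 1)
... | yes _ | yes _ = refl
... | yes _ | no  _ = refl
... | no  _ | _     = refl

kindFrom : Corner → (zX zP zP′ zO : ℤ) → Kind
kindFrom c00 zX zP zP′ zO = kindOf zX zP zP′ zO
kindFrom c11 zX zP zP′ zO = kindOf zO zP zP′ zX
kindFrom c10 zX zP zP′ zO = kindOf zP zX zO zP′
kindFrom c01 zX zP zP′ zO = kindOf zP zO zX zP′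

-- Equal neighbours leave two possibilities, a cross and the wrench with `X` in the unequal pair;
-- the corner opposite to `X` decides between them.
kindFrom-≡ : ∀ X {zX zP zP′ zO} → zP ≡ zP′ → (wr : Bool) → (if wr then zX ≢ zO else zX ≡ zO) →
             kindFrom X zX zP zP′ zO ≡ (if wr then wrenchAt X else cross)
kindFrom-≡ c00 {zX} {zP} {zP′} {zO} eq false eq′ with zX ℤ.≟ zO | zP ℤ.≟ zP′
... | yes _ | yes _ = refl
... | yes _ | no  p = ⊥-elim (p eq)
... | no  p | _     = ⊥-elim (p eq′)
kindFrom-≡ c00 {zX} {zP} {zP′} {zO} eq true ne with zX ℤ.≟ zO | zP ℤ.≟ zP′
... | yes p | _     = ⊥-elim (ne p)
... | no  _ | _     = refl
kindFrom-≡ c11 {zX} {zP} {zP′} {zO} eq false eq′ with zO ℤ.≟ zX | zP ℤ.≟ zP′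
... | yes _ | yes _ = refl
... | yes _ | no  p = ⊥-elim (p eq)
... | no  p | _     = ⊥-elim (p (sym eq′))
kindFrom-≡ c11 {zX} {zP} {zP′} {zO} eq true ne with zO ℤ.≟ zX | zP ℤ.≟ zP′
... | yes p | _     = ⊥-elim (ne (sym p))
... | no  _ | _     = refl
kindFrom-≡ c10 {zX} {zP} {zP′} {zO} eq false eq′ with zP ℤ.≟ zP′ | zX ℤ.≟ zO
... | yes _ | yes _ = refl
... | yes _ | no  p = ⊥-elim (p eq′)
... | no  p | _     = ⊥-elim (p eq)
kindFrom-≡ c10 {zX} {zP} {zP′} {zO} eq true ne with zP ℤ.≟ zP′ | zX ℤ.≟ zO
... | yes _ | yes p = ⊥-elim (ne p)
... | yes _ | no  _ = refl
... | no  p | _     = ⊥-elim (p eq)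
kindFrom-≡ c01 {zX} {zP} {zP′} {zO} eq false eq′ with zP ℤ.≟ zP′ | zO ℤ.≟ zX
... | yes _ | yes _ = refl
... | yes _ | no  p = ⊥-elim (p (sym eq′))
... | no  p | _     = ⊥-elim (p eq)
kindFrom-≡ c01 {zX} {zP} {zP′} {zO} eq true ne with zP ℤ.≟ zP′ | zO ℤ.≟ zX
... | yes _ | yes p = ⊥-elim (ne (sym p))
... | yes _ | no  _ = refl
... | no  p | _     = ⊥-elim (p eq)

z≢z+suc : ∀ {z} k → z ≢ z + + ℕ.suc k
z≢z+suc {z} k eq = ℤ.<-irrefl eq (subst (ℤ._< z + + ℕ.suc k) (ℤ.+-identityʳ z) (ℤ.+-monoʳ-< z (ℤ.+<+ (ℕ.s≤s ℕ.z≤n))))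

+1-injective : ∀ {i k} → i + + 1 ≡ k + + 1 → i ≡ k
+1-injective {i} {k} eq = ∙-cancelʳ (+ 1) i k eq
  where open AbelianGroupProperties ℤ.+-0-abelianGroup using (∙-cancelʳ)

cancelᵢ : ∀ {i j k l} → _≡_ {A = Face} (i + + 1 , j) (k + + 1 , l) → (i , j) ≡ (k , l)
cancelᵢ {i} {k = k} eq = cong₂ _,_ (+1-injective {i} {k} (cong proj₁ eq)) (cong proj₂ eq)

cancelⱼ : ∀ {i j k l} → _≡_ {A = Face} (i , j + + 1) (k , l + + 1) → (i , j) ≡ (k , l)
cancelⱼ {j = j} {l = l} eq = cong₂ _,_ (cong proj₁ eq) (+1-injective {j} {l} (cong proj₂ eq))

hE-injective : ∀ {i j k l} → hE i j ≡ hE k l → (i , j) ≡ (k , l)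
hE-injective refl = refl

vE-injective : ∀ {i j k l} → vE i j ≡ vE k l → (i , j) ≡ (k , l)
vE-injective refl = refl

dE-injective : ∀ {i j k l} → dE i j ≡ dE k l → (i , j) ≡ (k , l)
dE-injective refl = refl

_≟F_ : DecidableEquality Face
_≟F_ = ≡-dec ℤ._≟_ ℤ._≟_

-- The raised face is written (i + 1, j + 1), so that the indices around it need no subtraction.
record Raise (h h′ : ℤ → ℤ → ℤ) (i j : ℤ) : Set where
  I  = i + + 1
  J  = j + + 1
  I₂ = I + + 1
  J₂ = J + + 1
  m  = h I J
  field
    raised : h′ I J ≡ m + + 2
    same   : ∀ i′ j′ → (i′ , j′) ≢ (I , J) → h′ i′ j′ ≡ h i′ j′
    zW     : h i J ≡ m + + 1
    zE     : h I₂ J ≡ m + + 1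
    zS     : h I j ≡ m + + 1
    zN     : h I J₂ ≡ m + + 1
    zSW    : h i j ≡ m ⊎ h i j ≡ m + + 2
    zSE    : h I₂ j ≡ m ⊎ h I₂ j ≡ m + + 2
    zNW    : h i J₂ ≡ m ⊎ h i J₂ ≡ m + + 2
    zNE    : h I₂ J₂ ≡ m ⊎ h I₂ J₂ ≡ m + + 2

  off-i : ∀ {j′} → (i , j′) ≢ (I , J)
  off-i eq = z≢z+suc 0 (cong proj₁ eq)
  off-j : ∀ {i′} → (i′ , j) ≢ (I , J)
  off-j eq = z≢z+suc 0 (cong proj₂ eq)
  off-I₂ : ∀ {j′} → (I₂ , j′) ≢ (I , J)
  off-I₂ eq = z≢z+suc 0 (sym (cong proj₁ eq))
  off-J₂ : ∀ {i′} → (i′ , J₂) ≢ (I , J)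
  off-J₂ eq = z≢z+suc 0 (sym (cong proj₂ eq))

  wrench : ∀ {z} → z ≡ m ⊎ z ≡ m + + 2 → Bool
  wrench (inj₁ _) = false
  wrench (inj₂ _) = true

  wrSW wrSE wrNW wrNE : Bool
  wrSW = wrench zSW
  wrSE = wrench zSE
  wrNW = wrench zNW
  wrNE = wrench zNE

  private
    opposite : ∀ {z} (o : z ≡ m ⊎ z ≡ m + + 2) → if wrench o then m ≢ z else m ≡ z
    opposite (inj₁ eq) = sym eq
    opposite (inj₂ eq) = λ eq′ → z≢z+suc 1 (trans eq′ eq)

    opposite′ : ∀ {z} (o : z ≡ m ⊎ z ≡ m + + 2) → if not (wrench o) then m + + 2 ≢ z else m + + 2 ≡ z
    opposite′ (inj₁ eq) = λ eq′ → z≢z+suc 1 (sym (trans eq′ eq))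
    opposite′ (inj₂ eq) = sym eq

    kind′ : ∀ i j {z₀₀ z₁₀ z₀₁ z₁₁ k} → h′ i j ≡ z₀₀ → h′ (i + + 1) j ≡ z₁₀ → h′ i (j + + 1) ≡ z₀₁ →
            h′ (i + + 1) (j + + 1) ≡ z₁₁ → kindOf z₀₀ z₁₀ z₀₁ z₁₁ ≡ k → kind h′ i j ≡ k
    kind′ i j refl refl refl refl eq = trans (kind≡kindOf h′ i j) eq

  kindSW : kind h i j ≡ (if wrSW then wrenchAnti else cross)
  kindSW = trans (kind≡kindOf h i j) (kindFrom-≡ c11 (trans zS (sym zW)) wrSW (opposite zSW))
  kindSE : kind h I j ≡ (if wrSE then wrenchMain else cross)
  kindSE = trans (kind≡kindOf h I j) (kindFrom-≡ c01 (trans zS (sym zE)) wrSE (opposite zSE))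
  kindNW : kind h i J ≡ (if wrNW then wrenchMain else cross)
  kindNW = trans (kind≡kindOf h i J) (kindFrom-≡ c10 (trans zW (sym zN)) wrNW (opposite zNW))
  kindNE : kind h I J ≡ (if wrNE then wrenchAnti else cross)
  kindNE = trans (kind≡kindOf h I J) (kindFrom-≡ c00 (trans zE (sym zN)) wrNE (opposite zNE))

  kindSW′ : kind h′ i j ≡ (if not wrSW then wrenchAnti else cross)
  kindSW′ = kind′ i j (same _ _ off-i) (same _ _ off-j) (same _ _ off-i) raised
    (kindFrom-≡ c11 (trans zS (sym zW)) (not wrSW) (opposite′ zSW))
  kindSE′ : kind h′ I j ≡ (if not wrSE then wrenchMain else cross)
  kindSE′ = kind′ I j (same _ _ off-j) (same _ _ off-I₂) raised (same _ _ off-I₂)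
    (kindFrom-≡ c01 (trans zS (sym zE)) (not wrSE) (opposite′ zSE))
  kindNW′ : kind h′ i J ≡ (if not wrNW then wrenchMain else cross)
  kindNW′ = kind′ i J (same _ _ off-i) raised (same _ _ off-i) (same _ _ off-J₂)
    (kindFrom-≡ c10 (trans zW (sym zN)) (not wrNW) (opposite′ zNW))
  kindNE′ : kind h′ I J ≡ (if not wrNE then wrenchAnti else cross)
  kindNE′ = kind′ I J raised (same _ _ off-I₂) (same _ _ off-J₂) (same _ _ off-I₂)
    (kindFrom-≡ c00 (trans zE (sym zN)) (not wrNE) (opposite′ zNE))

  kind-same : ∀ i′ j′ → (i′ , j′) ≢ (I , J) → (i′ + + 1 , j′) ≢ (I , J) → (i′ , j′ + + 1) ≢ (I , J) →
              (i′ + + 1 , j′ + + 1) ≢ (I , J) → kind h′ i′ j′ ≡ kind h i′ j′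
  kind-same i′ j′ n₀₀ n₁₀ n₀₁ n₁₁ =
    kind′ i′ j′ (same _ _ n₀₀) (same _ _ n₁₀) (same _ _ n₀₁) (same _ _ n₁₁) (sym (kind≡kindOf h i′ j′))

-- Closed faces, faces of edges

module Cone (n₀ i₀ j₀ : ℤ) where

  isClosed : (ℤ → ℤ → ℤ) → Face → Bool
  isClosed h F = does (Subgraph.closed? h n₀ i₀ j₀ F)

  isClosed-cong : ∀ {h h′} i j → h′ i j ≡ h i j → isClosed h′ (i , j) ≡ isClosed h (i , j)
  isClosed-cong i j eq = cong (λ z → does (z ℤ.<? pyr n₀ i₀ j₀ i j)) eq

  isApex : Face → Bool
  isApex (i , j) = does (i ℤ.≟ i₀) ∧ does (j ℤ.≟ j₀)

  -- The position of the raised face in the cone: inX says that its neighbour X is closer to the apex.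
  record Position (h h′ : ℤ → ℤ → ℤ) (i j : ℤ) : Set where
    I = i + + 1
    J = j + + 1
    I₂ = I + + 1
    J₂ = J + + 1
    q = isClosed h′ (I , J)
    field
      closed : isClosed h (I , J) ≡ true
      inW inE inS inN : Bool
      inWE : inW ∧ inE ≡ false
      inSN : inS ∧ inN ≡ false
      clW : isClosed h (i , J) ≡ inW ∨ q
      clE : isClosed h (I₂ , J) ≡ inE ∨ q
      clS : isClosed h (I , j) ≡ inS ∨ q
      clN : isClosed h (I , J₂) ≡ inN ∨ q
      clSW : (isClosed h (i , j) ⇒ inS ∨ inW ∨ q) ≡ true
      clSE : (isClosed h (I₂ , j) ⇒ inS ∨ inE ∨ q) ≡ true
      clNW : (isClosed h (i , J₂) ⇒ inW ∨ inN ∨ q) ≡ true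
      clNE : (isClosed h (I₂ , J₂) ⇒ inE ∨ inN ∨ q) ≡ true
      apex : isApex (I , J) ≡ not (inW ∨ inE ∨ inS ∨ inN)
      -- At the rim the exponent of an outer neighbour changes correctly only if none of its edges
      -- away from the raised face is in the graph; the last four fields provide this.
      farW : isClosed h (i , J) ≡ false → isClosed h (I , j) ≡ false → isClosed h (I , J₂) ≡ false →
             isClosed h (i - + 1 , j) ≡ false × isClosed h (i - + 1 , J) ≡ false × isClosed h (i - + 1 , J₂) ≡ false
      farE : isClosed h (I₂ , J) ≡ false → isClosed h (I , j) ≡ false → isClosed h (I , J₂) ≡ false →
             isClosed h (I₂ + + 1 , j) ≡ false × isClosed h (I₂ + + 1 , J) ≡ false × isClosed h (I₂ + + 1 , J₂) ≡ false
      farS : isClosed h (I , j) ≡ false → isClosed h (i , J) ≡ false → isClosed h (I₂ , J) ≡ false →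
             isClosed h (i , j - + 1) ≡ false × isClosed h (I , j - + 1) ≡ false × isClosed h (I₂ , j - + 1) ≡ false
      farN : isClosed h (I , J₂) ≡ false → isClosed h (i , J) ≡ false → isClosed h (I₂ , J) ≡ false →
             isClosed h (i , J₂ + + 1) ≡ false × isClosed h (I , J₂ + + 1) ≡ false × isClosed h (I₂ , J₂ + + 1) ≡ false

  diagonalFaces : Kind → ℤ → ℤ → List Face
  diagonalFaces cross      i j = []
  diagonalFaces wrenchMain i j = (i , j) ∷ (i + + 1 , j + + 1) ∷ []
  diagonalFaces wrenchAnti i j = (i + + 1 , j) ∷ (i , j + + 1) ∷ []

  -- The incidence of `boundary` read from the edge; `boundary⇒faces` and `faces⇒boundary` identify
  -- the two. The diagonal of a cross gets no face, hence never counts as an edge of the graph.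
  faces : (ℤ → ℤ → ℤ) → Edge → List Face
  faces h (hE i j) = (i , j) ∷ (i + + 1 , j) ∷ []
  faces h (vE i j) = (i , j) ∷ (i , j + + 1) ∷ []
  faces h (dE i j) = diagonalFaces (kind h i j) i j

horizontal vertical diagonal : Face → Edge
horizontal (i , j) = hE i j
vertical   (i , j) = vE i j
diagonal   (i , j) = dE i j

-- A block owns its south side, its west side and its diagonal; in this way every edge has exactly
-- one owner.
sides : List Face → List Edge
sides B = map horizontal B ++ map vertical B

-- The partition function of a height function on a box

module PartitionFunction {c ℓ} (S : Semifield c ℓ) (a b c d : ℤ → ℤ → Semifield.Carrier S)
                         (f : ℤ → ℤ → ℤ → Semifield.Carrier S) (n₀ i₀ j₀ : ℤ) where
  open Semifield S
  open SF S
  open SemifieldProperties S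
  open FlipAlgebra S
  open Cone n₀ i₀ j₀

  x : (ℤ → ℤ → ℤ) → Face → Carrier
  x h (i , j) = f (h i j) i j

  labelOf : (ℤ → ℤ → ℤ) → Edge → Carrier
  labelOf h (hE i j) = if does (h i j ℤ.<? h (i + + 1) j) then a (i + + 1 + h i j) j else c (i + + 1 - h i j) j
  labelOf h (vE i j) = if does (h i j ℤ.<? h i (j + + 1)) then b i (j + + 1 + h i j) else d i (j + + 1 - h i j)
  labelOf h (dE i j) = 1#

  weightOf : (ℤ → ℤ → ℤ) → Edge → Carrier
  weightOf h e = labelOf h e * ∏ₛ.∏ (faces h e) (λ F → x h F ⁻¹)

  admissibleBlock : (ℤ → ℤ → ℤ) → Face → Assignment → Bool → Bool
  admissibleBlock h (i , j) σ =
    admissible (kind h i j) (isClosed h (i , j)) (isClosed h (i + + 1 , j)) (isClosed h (i , j + + 1)) (isClosed h (i + + 1 , j + + 1))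
               (σ (hE i j)) (σ (vE (i + + 1) j)) (σ (hE i (j + + 1))) (σ (vE i j))

  blockWeight : (ℤ → ℤ → ℤ) → Assignment → Face → Maybe Carrier
  blockWeight h σ F = viaDiagonal (weightOf h (diagonal F)) (admissibleBlock h F σ)

  sideWeight : (ℤ → ℤ → ℤ) → Assignment → Edge → Maybe Carrier
  sideWeight h σ e = just (weightOf h e ^ᵇ σ e)

  configWeight : (ℤ → ℤ → ℤ) → List Face → Assignment → Maybe Carrier
  configWeight h B σ = ∏ (sides B) (sideWeight h σ) ⊗ ∏ B (blockWeight h σ)

  -- The range of summation does not depend on `h`: sides of the box that are not in the graph are
  -- ruled out by `admissibleBlock`.
  Zᴮ : (ℤ → ℤ → ℤ) → List Face → Maybe Carrier
  Zᴮ h B = Sum (sides B) (configWeight h B) (λ _ → false)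

  admissibleBlock-ext : ∀ h F {σ τ} → (∀ e → σ e ≡ τ e) → ∀ t → admissibleBlock h F σ t ≡ admissibleBlock h F τ t
  admissibleBlock-ext h (i , j) eq t
    rewrite eq (hE i j) | eq (vE (i + + 1) j) | eq (hE i (j + + 1)) | eq (vE i j) = refl

  viaDiagonal-≡ : ∀ {y y′ φ ψ} → y ≡ y′ → (∀ t → φ t ≡ ψ t) → viaDiagonal y φ ≡ viaDiagonal y′ ψ
  viaDiagonal-≡ {y} refl eq = cong₂ (λ p p′ → [ p ] ⊕ just y ⊗ [ p′ ]) (eq false) (eq true)

  configWeight-ext : ∀ h B → Extensional (configWeight h B)
  configWeight-ext h B eq = *-cong
    (∏-cong (sides B) (λ {e} _ → ≋-reflexive (cong (λ t → just (weightOf h e ^ᵇ t)) (eq e))))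
    (∏-cong B (λ {F} _ → ≋-reflexive (viaDiagonal-≡ refl (admissibleBlock-ext h F eq))))

admissible-cong : ∀ {k k′ q₁ q₁′ q₂ q₂′ q₃ q₃′ q₄ q₄′ s s′ e e′ n n′ w w′} →
  k ≡ k′ → q₁ ≡ q₁′ → q₂ ≡ q₂′ → q₃ ≡ q₃′ → q₄ ≡ q₄′ → s ≡ s′ → e ≡ e′ → n ≡ n′ → w ≡ w′ →
  ∀ d → admissible k q₁ q₂ q₃ q₄ s e n w d ≡ admissible k′ q₁′ q₂′ q₃′ q₄′ s′ e′ n′ w′ d
admissible-cong refl refl refl refl refl refl refl refl refl d = refl

sides-unique : ∀ {B} → Unique B → Unique (sides B)
sides-unique uB = Unique.++⁺ (Unique.map⁺ (λ { refl → refl }) uB) (Unique.map⁺ (λ { refl → refl }) uB) disjoint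
  where
  disjoint : ∀ {B e} → ¬ (e ∈ map horizontal B × e ∈ map vertical B)
  disjoint (e∈h , e∈v) with ∈-map⁻ horizontal e∈h | ∈-map⁻ vertical e∈v
  ... | _ , _ , refl | _ , _ , ()

horizontal∈ : ∀ {B i j} → (i , j) ∈ B → hE i j ∈ sides B
horizontal∈ F∈B = ∈-++⁺ˡ (∈-map⁺ horizontal F∈B)

vertical∈ : ∀ {B i j} → (i , j) ∈ B → vE i j ∈ sides B
vertical∈ {B} F∈B = ∈-++⁺ʳ (map horizontal B) (∈-map⁺ vertical F∈B)

-- If both neighbours are open, then `inP`, `inP′` and `q` are all false, and the implication opens
-- the opposite corner.
outward-cond : ∀ qO inP inP′ q {qP qP′} → qP ≡ inP ∨ q → qP′ ≡ inP′ ∨ q → (qO ⇒ inP ∨ inP′ ∨ q) ≡ true →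
               (outward qP qP′ ⇒ not (qO ∨ q)) ≡ true
outward-cond false false false false refl refl eq = refl
outward-cond qO    true  inP′  q     refl refl eq = refl
outward-cond qO    false true  true  refl refl eq = refl
outward-cond qO    false true  false refl refl eq = refl
outward-cond qO    false false true  refl refl eq = refl

-- The partition function under raising a face

module Flip {c ℓ} (S : Semifield c ℓ) (a b cc d : ℤ → ℤ → Semifield.Carrier S)
            (f : ℤ → ℤ → ℤ → Semifield.Carrier S) (n₀ i₀ j₀ : ℤ) where
  open Semifield S
  open SemifieldProperties S
  open FlipAlgebra S
  open Cone n₀ i₀ j₀
  open PartitionFunction S a b cc d f n₀ i₀ j₀
  open CommutativeMonoidSolver ⊗-commutativeMonoid using (solve; _⊜_) renaming (_⊕_ to _⊙_)

  label-≤ : ∀ h i j {z} → h i j ≡ z → h (i + + 1) j ≡ z + + 1 → labelOf h (hE i j) ≡ a (i + + 1 + z) j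
  label-≤ h i j {z} refl eq = cong (λ t → if t then a (i + + 1 + z) j else cc (i + + 1 - z) j)
    (dec-true (h i j ℤ.<? h (i + + 1) j) (subst (z ℤ.<_) (sym eq) (z<z+1 z)))
    where z<z+1 : ∀ z → z ℤ.< z + + 1
          z<z+1 z = ℤ.suc[i]≤j⇒i<j (ℤ.≤-reflexive (ℤ.+-comm (+ 1) z))

  label-≥ : ∀ h i j {z} → h i j ≡ z + + 1 → h (i + + 1) j ≡ z → labelOf h (hE i j) ≡ cc (i + + 1 - (z + + 1)) j
  label-≥ h i j {z} eq refl rewrite eq = cong (λ t → if t then a (i + + 1 + (z + + 1)) j else cc (i + + 1 - (z + + 1)) j)
    (dec-false (z + + 1 ℤ.<? z) (ℤ.≤⇒≯ (ℤ.i≤i+j z (+ 1))))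

  labelᵛ-≤ : ∀ h i j {z} → h i j ≡ z → h i (j + + 1) ≡ z + + 1 → labelOf h (vE i j) ≡ b i (j + + 1 + z)
  labelᵛ-≤ h i j {z} refl eq = cong (λ t → if t then b i (j + + 1 + z) else d i (j + + 1 - z))
    (dec-true (h i j ℤ.<? h i (j + + 1)) (subst (z ℤ.<_) (sym eq) (z<z+1 z)))
    where z<z+1 : ∀ z → z ℤ.< z + + 1
          z<z+1 z = ℤ.suc[i]≤j⇒i<j (ℤ.≤-reflexive (ℤ.+-comm (+ 1) z))

  labelᵛ-≥ : ∀ h i j {z} → h i j ≡ z + + 1 → h i (j + + 1) ≡ z → labelOf h (vE i j) ≡ d i (j + + 1 - (z + + 1))
  labelᵛ-≥ h i j {z} eq refl rewrite eq = cong (λ t → if t then b i (j + + 1 + (z + + 1)) else d i (j + + 1 - (z + + 1)))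
    (dec-false (z + + 1 ℤ.<? z) (ℤ.≤⇒≯ (ℤ.i≤i+j z (+ 1))))

  two-faces : ∀ {l l′ p p′ t} → l ≡ l′ → t ≈ p * p′ → l * (p ⁻¹ * (p′ ⁻¹ * 1#)) ≈ l′ * t ⁻¹
  two-faces {l} {p = p} {p′} refl eq = ≈-trans
    (monomial (l ∷ p ∷ p′ ∷ []) (v₀ · (v₁ ⁻ · (v₂ ⁻ · 𝟙)))
                                (v₀ · (v₁ · v₂) ⁻) refl)
    (∙-congˡ (⁻¹-cong (≈-sym eq)))

  four : (p q r s : Maybe Carrier) → Maybe Carrier
  four p q r s = p ⊗ (q ⊗ (r ⊗ s))

  four-⊗ : ∀ p q r s p′ q′ r′ s′ → four (p ⊗ p′) (q ⊗ q′) (r ⊗ r′) (s ⊗ s′) ≋ four p q r s ⊗ four p′ q′ r′ s′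
  four-⊗ = solve 8 (λ p q r s p′ q′ r′ s′ →
    ((p ⊙ p′) ⊙ ((q ⊙ q′) ⊙ ((r ⊙ r′) ⊙ (s ⊙ s′)))) ⊜ ((p ⊙ (q ⊙ (r ⊙ s))) ⊙ (p′ ⊙ (q′ ⊙ (r′ ⊙ s′))))) ≋-refl

  four-cong : ∀ {p q r s p′ q′ r′ s′} → p ≋ p′ → q ≋ q′ → r ≋ r′ → s ≋ s′ → four p q r s ≋ four p′ q′ r′ s′
  four-cong p q r s = *-cong p (*-cong q (*-cong r s))

  four-[] : ∀ p q r s → four [ p ] [ q ] [ r ] [ s ] ≋ [ p ∧ q ∧ r ∧ s ]
  four-[] p q r s = ≋-sym (≋-trans ([∧] p (q ∧ r ∧ s)) (*-congˡ {[ p ]} (≋-trans ([∧] q (r ∧ s)) (*-congˡ {[ q ]} ([∧] r s)))))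

  weight-cong : ∀ w e s n {wW wE wS wN wW′ wE′ wS′ wN′} → wW ≈ wW′ → wE ≈ wE′ → wS ≈ wS′ → wN ≈ wN′ →
    (wW ^ᵇ w * wE ^ᵇ e) * (wS ^ᵇ s * wN ^ᵇ n) ≈ (wW′ ^ᵇ w * wE′ ^ᵇ e) * (wS′ ^ᵇ s * wN′ ^ᵇ n)
  weight-cong w e s n p q r t = ∙-cong (∙-cong (^ᵇ-cong w p) (^ᵇ-cong e q)) (∙-cong (^ᵇ-cong s r) (^ᵇ-cong n t))
    where
    ^ᵇ-cong : ∀ t {y y′} → y ≈ y′ → y ^ᵇ t ≈ y′ ^ᵇ t
    ^ᵇ-cong true  eq = eq
    ^ᵇ-cong false eq = ≈-refl

  module _ {h h′ : ℤ → ℤ → ℤ} {i j : ℤ} (R : Raise h h′ i j) (P : Position h h′ i j) where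
    open Raise R
    open Position P hiding (I; J; I₂; J₂)

    F F′ W E Sₒ N A Bb C D : Carrier
    F  = x h (I , J)
    F′ = x h′ (I , J)
    W  = x h (i , J)
    E  = x h (I₂ , J)
    Sₒ = x h (I , j)
    N  = x h (I , J₂)
    A  = a (I + (m + + 2) - + 1) J
    Bb = b I (J + (m + + 2) - + 1)
    C  = cc (I - (m + + 2) + + 1) J
    D  = d I (J - (m + + 2) + + 1)

    qW qE qS qN qSW qSE qNW qNE : Bool
    qW  = isClosed h (i , J)
    qE  = isClosed h (I₂ , J)
    qS  = isClosed h (I , j)
    qN  = isClosed h (I , J₂)
    qSW = isClosed h (i , j)
    qSE = isClosed h (I₂ , j)
    qNW = isClosed h (i , J₂)
    qNE = isClosed h (I₂ , J₂)

    eW eE eS eN : Edge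
    eW = hE i J
    eE = hE I J
    eS = vE I j
    eN = vE I J

    inner : List Edge
    inner = eW ∷ eE ∷ eS ∷ eN ∷ []

    private
      arith₁ : ∀ i z → i + (z + + 1) ≡ i + (z + + 2) - + 1
      arith₁ = solve-∀
      arith₂ : ∀ i z → i - (z + + 1) ≡ i - (z + + 2) + + 1
      arith₂ = solve-∀
      arith₃ : ∀ i z → i + + 1 + z ≡ i + (z + + 2) - + 1
      arith₃ = solve-∀
      arith₄ : ∀ i z → i + + 1 - (z + + 1 + + 1) ≡ i - (z + + 2) + + 1
      arith₄ = solve-∀
      +2≡+1+1 : ∀ z → z + + 2 ≡ z + + 1 + + 1
      +2≡+1+1 = solve-∀

      raised₁ : h′ I J ≡ m + + 1 + + 1
      raised₁ = trans raised (+2≡+1+1 m)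
      same-x : ∀ {i′ j′} → (i′ , j′) ≢ (I , J) → x h′ (i′ , j′) ≡ x h (i′ , j′)
      same-x {i′} {j′} ne = cong (λ z → f z i′ j′) (same i′ j′ ne)

    -- The coefficients are those of the recurrence at height `m + 2`. A label depends on which of
    -- the two faces is higher, so raising the face exchanges `A` with `C` and `Bb` with `D`, that
    -- is, the labels of opposite sides.
    weight-W : weightOf h eW ≈ C * (F * W) ⁻¹
    weight-W = two-faces (trans (label-≥ h i J zW refl) (cong (λ z → cc z J) (arith₂ I m))) (comm F W)
    weight-E : weightOf h eE ≈ A * (F * E) ⁻¹
    weight-E = two-faces (trans (label-≤ h I J refl zE) (cong (λ z → a z J) (arith₃ I m))) ≈-refl
    weight-S : weightOf h eS ≈ D * (F * Sₒ) ⁻¹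
    weight-S = two-faces (trans (labelᵛ-≥ h I j zS refl) (cong (d I) (arith₂ J m))) (comm F Sₒ)
    weight-N : weightOf h eN ≈ Bb * (F * N) ⁻¹
    weight-N = two-faces (trans (labelᵛ-≤ h I J refl zN) (cong (b I) (arith₃ J m))) ≈-refl

    weight-W′ : weightOf h′ eW ≈ A * (F′ * W) ⁻¹
    weight-W′ = two-faces (trans (label-≤ h′ i J (trans (same _ _ off-i) zW) raised₁) (cong (λ z → a z J) (arith₁ I m)))
                  (≈-trans (comm F′ W) (∙-congʳ (≈-reflexive (sym (same-x off-i)))))
    weight-E′ : weightOf h′ eE ≈ C * (F′ * E) ⁻¹
    weight-E′ = two-faces (trans (label-≥ h′ I J raised₁ (trans (same _ _ off-I₂) zE)) (cong (λ z → cc z J) (arith₄ I m)))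
                  (∙-congˡ (≈-reflexive (sym (same-x off-I₂))))
    weight-S′ : weightOf h′ eS ≈ Bb * (F′ * Sₒ) ⁻¹
    weight-S′ = two-faces (trans (labelᵛ-≤ h′ I j (trans (same _ _ off-j) zS) raised₁) (cong (b I) (arith₁ J m)))
                  (≈-trans (comm F′ Sₒ) (∙-congʳ (≈-reflexive (sym (same-x off-j)))))
    weight-N′ : weightOf h′ eN ≈ D * (F′ * N) ⁻¹
    weight-N′ = two-faces (trans (labelᵛ-≥ h′ I J raised₁ (trans (same _ _ off-J₂) zN)) (cong (d I) (arith₄ J m)))
                  (∙-congˡ (≈-reflexive (sym (same-x off-J₂))))

    private
      diagonal-weight : ∀ X h i j {k} {p p′ t} (wr : Bool) → kind h i j ≡ k → k ≡ (if wr then wrenchAt X else cross) →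
        ∏ₛ.∏ (diagonalFaces (wrenchAt X) i j) (λ G → x h G ⁻¹) ≡ p ⁻¹ * (p′ ⁻¹ * 1#) → t ≈ p * p′ →
        wr ≡ true → weightOf h (dE i j) ≈ t ⁻¹
      diagonal-weight X h i j {p = p} {p′} true refl eq faces≡ t≈ refl = ≈-trans
        (∙-congˡ (≈-reflexive (trans (cong (λ k → ∏ₛ.∏ (diagonalFaces k i j) (λ G → x h G ⁻¹)) eq) faces≡)))
        (≈-trans (two-faces refl t≈) (identityˡ _))

      pair : ∀ {p q p′ q′} → p ≡ p′ → q ≡ q′ → p * q ≈ p′ * q′
      pair refl refl = ≈-refl

    condSW : (outward qS qW ⇒ not (qSW ∨ q)) ≡ true
    condSW = outward-cond qSW inS inW q clS clW clSW
    condSE : (outward qS qE ⇒ not (qSE ∨ q)) ≡ true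
    condSE = outward-cond qSE inS inE q clS clE clSE
    condNW : (outward qW qN ⇒ not (qNW ∨ q)) ≡ true
    condNW = outward-cond qNW inW inN q clW clN clNW
    condNE : (outward qE qN ⇒ not (qNE ∨ q)) ≡ true
    condNE = outward-cond qNE inE inN q clE clN clNE

    module _ (σ : Assignment) where

      module SW = CornerFlip c11 wrSW qS qW qSW q condSW (σ (hE i j)) (σ (vE i j)) (Sₒ * W)
      module SE = CornerFlip c01 wrSE qS qE qSE q condSE (σ (hE I j)) (σ (vE I₂ j)) (Sₒ * E)
      module NW = CornerFlip c10 wrNW qW qN qNW q condNW (σ (vE i J)) (σ (hE i J₂)) (W * N)
      module NE = CornerFlip c00 wrNE qE qN qNE q condNE (σ (vE I₂ J)) (σ (hE I J₂)) (E * N)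

      assign : (w e s n : Bool) → Assignment
      assign w e s n = put eN n (put eS s (put eE e (put eW w σ)))

      assign-off : ∀ w e s n {e′} → e′ ∉ inner → assign w e s n e′ ≡ σ e′
      assign-off w e s n {e′} e′∉ =
        trans (put-≢ {eN} {e′} n (put eS s (put eE e (put eW w σ))) (λ { refl → e′∉ (there (there (there (here refl)))) }))
        (trans (put-≢ {eS} {e′} s (put eE e (put eW w σ)) (λ { refl → e′∉ (there (there (here refl))) }))
        (trans (put-≢ {eE} {e′} e (put eW w σ) (λ { refl → e′∉ (there (here refl)) }))
                 (put-≢ {eW} {e′} w σ (λ { refl → e′∉ (here refl) }))))

      assign-W : ∀ w e s n → assign w e s n eW ≡ w
      assign-W w e s n = trans (put-≢ {eE} {eW} e (put eW w σ) (λ eq → z≢z+suc 0 (cong proj₁ (hE-injective eq)))) (put-≡ eW w σ)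
      assign-E : ∀ w e s n → assign w e s n eE ≡ e
      assign-E w e s n = put-≡ eE e (put eW w σ)
      assign-S : ∀ w e s n → assign w e s n eS ≡ s
      assign-S w e s n = trans (put-≢ {eN} {eS} n (put eS s (put eE e (put eW w σ))) (λ eq → z≢z+suc 0 (cong proj₂ (vE-injective eq))))
                           (put-≡ eS s (put eE e (put eW w σ)))
      assign-N : ∀ w e s n → assign w e s n eN ≡ n
      assign-N w e s n = put-≡ eN n (put eS s (put eE e (put eW w σ)))

      private
        hE∉ : ∀ {i′ j′} → j′ ≢ J ⊎ (i′ ≢ i × i′ ≢ I) → hE i′ j′ ∉ inner
        hE∉ (inj₁ ne) (here refl) = ne refl
        hE∉ (inj₁ ne) (there (here refl)) = ne refl
        hE∉ (inj₂ (ne , _)) (here refl) = ne refl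
        hE∉ (inj₂ (_ , ne)) (there (here refl)) = ne refl
        hE∉ _ (there (there (here ())))
        hE∉ _ (there (there (there (here ()))))

        vE∉ : ∀ {i′ j′} → i′ ≢ I ⊎ (j′ ≢ j × j′ ≢ J) → vE i′ j′ ∉ inner
        vE∉ (inj₁ ne) (there (there (here refl))) = ne refl
        vE∉ (inj₁ ne) (there (there (there (here refl)))) = ne refl
        vE∉ (inj₂ (ne , _)) (there (there (here refl))) = ne refl
        vE∉ (inj₂ (_ , ne)) (there (there (there (here refl)))) = ne refl

        i≢I : i ≢ I
        i≢I = z≢z+suc 0
        j≢J : j ≢ J
        j≢J = z≢z+suc 0
        I₂≢I : I₂ ≢ I
        I₂≢I eq = z≢z+suc 0 (sym eq)
        J₂≢J : J₂ ≢ J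
        J₂≢J eq = z≢z+suc 0 (sym eq)

        cl-same : ∀ i′ j′ → (i′ , j′) ≢ (I , J) → isClosed h′ (i′ , j′) ≡ isClosed h (i′ , j′)
        cl-same i′ j′ ne = isClosed-cong {h} {h′} i′ j′ (same i′ j′ ne)

      module _ (w e s n : Bool) where
        private
          τ = assign w e s n
          off = assign-off w e s n

        blockSW : ∀ t → admissibleBlock h (i , j) τ t ≡ admissibleFrom c11 wrSW true qS qW qSW s w (σ (hE i j)) (σ (vE i j)) t
        blockSW = admissible-cong kindSW refl refl refl closed
          (off (hE∉ (inj₁ j≢J))) (assign-S w e s n) (assign-W w e s n) (off (vE∉ (inj₁ i≢I)))
        blockSE : ∀ t → admissibleBlock h (I , j) τ t ≡ admissibleFrom c01 wrSE true qS qE qSE s e (σ (hE I j)) (σ (vE I₂ j)) t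
        blockSE = admissible-cong kindSE refl refl closed refl
          (off (hE∉ (inj₁ j≢J))) (off (vE∉ (inj₁ I₂≢I))) (assign-E w e s n) (assign-S w e s n)
        blockNW : ∀ t → admissibleBlock h (i , J) τ t ≡ admissibleFrom c10 wrNW true qW qN qNW w n (σ (vE i J)) (σ (hE i J₂)) t
        blockNW = admissible-cong kindNW refl closed refl refl
          (assign-W w e s n) (assign-N w e s n) (off (hE∉ (inj₁ J₂≢J))) (off (vE∉ (inj₁ i≢I)))
        blockNE : ∀ t → admissibleBlock h (I , J) τ t ≡ admissibleFrom c00 wrNE true qE qN qNE e n (σ (vE I₂ J)) (σ (hE I J₂)) t
        blockNE = admissible-cong kindNE closed refl refl refl
          (assign-E w e s n) (off (vE∉ (inj₁ I₂≢I))) (off (hE∉ (inj₁ J₂≢J))) (assign-N w e s n)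

        blockSW′ : ∀ t → admissibleBlock h′ (i , j) τ t ≡ admissibleFrom c11 (not wrSW) q qS qW qSW s w (σ (hE i j)) (σ (vE i j)) t
        blockSW′ = admissible-cong kindSW′ (cl-same _ _ off-i) (cl-same _ _ off-j) (cl-same _ _ off-i) refl
          (off (hE∉ (inj₁ j≢J))) (assign-S w e s n) (assign-W w e s n) (off (vE∉ (inj₁ i≢I)))
        blockSE′ : ∀ t → admissibleBlock h′ (I , j) τ t ≡ admissibleFrom c01 (not wrSE) q qS qE qSE s e (σ (hE I j)) (σ (vE I₂ j)) t
        blockSE′ = admissible-cong kindSE′ (cl-same _ _ off-j) (cl-same _ _ off-I₂) refl (cl-same _ _ off-I₂)
          (off (hE∉ (inj₁ j≢J))) (off (vE∉ (inj₁ I₂≢I))) (assign-E w e s n) (assign-S w e s n)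
        blockNW′ : ∀ t → admissibleBlock h′ (i , J) τ t ≡ admissibleFrom c10 (not wrNW) q qW qN qNW w n (σ (vE i J)) (σ (hE i J₂)) t
        blockNW′ = admissible-cong kindNW′ (cl-same _ _ off-i) refl (cl-same _ _ off-i) (cl-same _ _ off-J₂)
          (assign-W w e s n) (assign-N w e s n) (off (hE∉ (inj₁ J₂≢J))) (off (vE∉ (inj₁ i≢I)))
        blockNE′ : ∀ t → admissibleBlock h′ (I , J) τ t ≡ admissibleFrom c00 (not wrNE) q qE qN qNE e n (σ (vE I₂ J)) (σ (hE I J₂)) t
        blockNE′ = admissible-cong kindNE′ refl (cl-same _ _ off-I₂) (cl-same _ _ off-J₂) (cl-same _ _ off-I₂)
          (assign-E w e s n) (off (vE∉ (inj₁ I₂≢I))) (off (hE∉ (inj₁ J₂≢J))) (assign-N w e s n)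

        fourBlocks : ∀ g → Maybe Carrier
        fourBlocks g = four (blockWeight g τ (i , j)) (blockWeight g τ (I , j)) (blockWeight g τ (i , J)) (blockWeight g τ (I , J))

        commons scales demands : Maybe Carrier
        commons = four SW.common SE.common NW.common NE.common
        scales  = four (just SW.scale) (just SE.scale) (just NW.scale) (just NE.scale)
        demands = four (just ((Sₒ * W) ^ᵇ SW.r)) (just ((Sₒ * E) ^ᵇ SE.r)) (just ((W * N) ^ᵇ NW.r)) (just ((E * N) ^ᵇ NE.r))

        private
          corner : ∀ {y φ ψ z} → (∀ t → φ t ≡ ψ t) → viaDiagonal y ψ ≋ z → viaDiagonal y φ ≋ z
          corner eq p = ≋-trans (≋-reflexive (viaDiagonal-≡ refl eq)) p

          regroup : ∀ a b c d w e s n → ((a ∧ s ∧ w) ∧ (b ∧ s ∧ e) ∧ (c ∧ w ∧ n) ∧ (d ∧ e ∧ n)) ≡ (a ∧ b ∧ c ∧ d) ∧ (w ∧ e ∧ s ∧ n)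
          regroup a b c d w e s n = ==⇒≡ _ _ (instantiate 8 (λ { (a ∷ b ∷ c ∷ d ∷ w ∷ e ∷ s ∷ n ∷ []) →
              ((a ∧ s ∧ w) ∧ (b ∧ s ∧ e) ∧ (c ∧ w ∧ n) ∧ (d ∧ e ∧ n)) == ((a ∧ b ∧ c ∧ d) ∧ (w ∧ e ∧ s ∧ n)) }) refl
              (a ∷ b ∷ c ∷ d ∷ w ∷ e ∷ s ∷ n ∷ []))

        -- Only the bracket depends on the sides of the square. The `∧ true` matches the square
        -- `Old`, whose sides are all edges because the face is closed before the move.
        fourBlocks-before : fourBlocks h ≋ (scales ⊗ commons) ⊗ (demands ⊗ [ (ι SW.r s w ∧ ι SE.r s e ∧ ι NW.r w n ∧ ι NE.r e n) ∧ true ])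
        fourBlocks-before = ≋-trans
          (four-cong (corner blockSW (SW.before-≋ _ (diagonal-weight c11 h i j wrSW refl kindSW refl ≈-refl) s w))
                     (corner blockSE (SE.before-≋ _ (diagonal-weight c01 h I j wrSE refl kindSE refl ≈-refl) s e))
                     (corner blockNW (NW.before-≋ _ (diagonal-weight c10 h i J wrNW refl kindNW refl ≈-refl) w n))
                     (corner blockNE (NE.before-≋ _ (diagonal-weight c00 h I J wrNE refl kindNE refl ≈-refl) e n)))
          (≋-trans (four-⊗ _ _ _ _ _ _ _ _)
            (*-cong (four-⊗ _ _ _ _ _ _ _ _)
              (≋-trans (four-⊗ _ _ _ _ _ _ _ _)
                (*-congˡ {demands} (≋-trans (four-[] _ _ _ _) (≋-reflexive (cong [_] (sym (Bool.∧-identityʳ _)))))))))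

        fourBlocks-after : fourBlocks h′ ≋
          commons ⊗ [ (ι (not SW.r) s w ∧ ι (not SE.r) s e ∧ ι (not NW.r) w n ∧ ι (not NE.r) e n) ∧ sidesOk (q ∨ qW) (q ∨ qE) (q ∨ qS) (q ∨ qN) w e s n ]
        fourBlocks-after = ≋-trans
          (four-cong (corner blockSW′ (SW.after-≋ _ (diagonal-weight c11 h′ i j (not wrSW) refl kindSW′ refl (pair (sym (same-x off-j)) (sym (same-x off-i)))) s w))
                     (corner blockSE′ (SE.after-≋ _ (diagonal-weight c01 h′ I j (not wrSE) refl kindSE′ refl (pair (sym (same-x off-j)) (sym (same-x off-I₂)))) s e))
                     (corner blockNW′ (NW.after-≋ _ (diagonal-weight c10 h′ i J (not wrNW) refl kindNW′ refl (pair (sym (same-x off-i)) (sym (same-x off-J₂)))) w n))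
                     (corner blockNE′ (NE.after-≋ _ (diagonal-weight c00 h′ I J (not wrNE) refl kindNE′ refl (pair (sym (same-x off-I₂)) (sym (same-x off-J₂)))) e n)))
          (≋-trans (four-⊗ _ _ _ _ _ _ _ _)
            (*-congˡ {commons} (≋-trans (four-[] _ _ _ _)
              (≋-reflexive (cong [_] (regroup (ι (not SW.r) s w) (ι (not SE.r) s e) (ι (not NW.r) w n) (ι (not NE.r) e n)
                                              (w ⇒ q ∨ qW) (e ⇒ q ∨ qE) (s ⇒ q ∨ qS) (n ⇒ q ∨ qN)))))))

    corners : List Face
    corners = (i , j) ∷ (I , j) ∷ (i , J) ∷ (I , J) ∷ []

    scale : Carrier
    scale = ((Sₒ * W) ⁻¹) ^ᵇ (wrSW ∨ outward qS qW) * (((Sₒ * E) ⁻¹) ^ᵇ (wrSE ∨ outward qS qE) *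
           (((W * N) ⁻¹) ^ᵇ (wrNW ∨ outward qW qN) * ((E * N) ⁻¹) ^ᵇ (wrNE ∨ outward qE qN)))

    private
      NotRaised : Face → Set
      NotRaised G = G ≢ (I , J)

      hE-faces : ∀ {i′ j′} → hE i′ j′ ∉ inner → NotRaised (i′ , j′) × NotRaised (i′ + + 1 , j′)
      hE-faces e∉ = (λ { refl → e∉ (there (here refl)) }) ,
        (λ eq → e∉ (here (cong (λ { (k , l) → hE k l }) (cancelᵢ eq))))

      vE-faces : ∀ {i′ j′} → vE i′ j′ ∉ inner → NotRaised (i′ , j′) × NotRaised (i′ , j′ + + 1)
      vE-faces e∉ = (λ { refl → e∉ (there (there (there (here refl)))) }) ,
        (λ eq → e∉ (there (there (here (cong (λ { (k , l) → vE k l }) (cancelⱼ eq))))))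

      x⁻¹-same : ∀ {G} → NotRaised G → x h′ G ⁻¹ ≡ x h G ⁻¹
      x⁻¹-same ne = cong _⁻¹ (same-x ne)

      -- A side off the square does not border the raised face, so neither its label nor the values
      -- at its faces change.
      weight-same : ∀ {B e} → e ∈ sides B → e ∉ inner → weightOf h′ e ≡ weightOf h e
      weight-same {B} e∈ e∉ with ∈-++⁻ (map horizontal B) e∈
      weight-same e∈ e∉ | inj₁ e∈h with ∈-map⁻ horizontal e∈h
      ... | (i′ , j′) , _ , refl with hE-faces e∉
      ...   | ne , ne′ = cong₂ _*_
              (cong₂ (λ z z′ → if does (z ℤ.<? z′) then a (i′ + + 1 + z) j′ else cc (i′ + + 1 - z) j′)
                (same _ _ ne) (same _ _ ne′))
              (cong₂ (λ y y′ → y * (y′ * 1#)) (x⁻¹-same ne) (x⁻¹-same ne′))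
      weight-same e∈ e∉ | inj₂ e∈v with ∈-map⁻ vertical e∈v
      ... | (i′ , j′) , _ , refl with vE-faces e∉
      ...   | ne , ne′ = cong₂ _*_
              (cong₂ (λ z z′ → if does (z ℤ.<? z′) then b i′ (j′ + + 1 + z) else d i′ (j′ + + 1 - z))
                (same _ _ ne) (same _ _ ne′))
              (cong₂ (λ y y′ → y * (y′ * 1#)) (x⁻¹-same ne) (x⁻¹-same ne′))

      module _ {i′ j′ : ℤ} (F∉ : (i′ , j′) ∉ corners) where
        n₀₀ : NotRaised (i′ , j′)
        n₀₀ refl = F∉ (there (there (there (here refl))))
        n₁₀ : NotRaised (i′ + + 1 , j′)
        n₁₀ eq = F∉ (there (there (here (cancelᵢ eq))))
        n₀₁ : NotRaised (i′ , j′ + + 1)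
        n₀₁ eq = F∉ (there (here (cancelⱼ eq)))
        n₁₁ : NotRaised (i′ + + 1 , j′ + + 1)
        n₁₁ eq = F∉ (here (cancelⱼ (cancelᵢ eq)))

        diagonal-same : weightOf h′ (dE i′ j′) ≡ weightOf h (dE i′ j′)
        diagonal-same = cong (1# *_) (trans
          (cong (λ k → ∏ₛ.∏ (diagonalFaces k i′ j′) (λ G → x h′ G ⁻¹)) (kind-same i′ j′ n₀₀ n₁₀ n₀₁ n₁₁))
          (factors (kind h i′ j′)))
          where
          factors : ∀ k → ∏ₛ.∏ (diagonalFaces k i′ j′) (λ G → x h′ G ⁻¹) ≡ ∏ₛ.∏ (diagonalFaces k i′ j′) (λ G → x h G ⁻¹)
          factors cross      = refl
          factors wrenchMain = cong₂ (λ y y′ → y * (y′ * 1#)) (x⁻¹-same n₀₀) (x⁻¹-same n₁₁)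
          factors wrenchAnti = cong₂ (λ y y′ → y * (y′ * 1#)) (x⁻¹-same n₁₀) (x⁻¹-same n₀₁)

        module _ (σ : Assignment) (w e s n : Bool) where
          private
            off = assign-off σ w e s n
            s∉ : hE i′ j′ ∉ inner
            s∉ (here refl) = F∉ (there (there (here refl)))
            s∉ (there (here refl)) = F∉ (there (there (there (here refl))))
            s∉ (there (there (here ())))
            s∉ (there (there (there (here ()))))
            w∉ : vE i′ j′ ∉ inner
            w∉ (there (there (here refl))) = F∉ (there (here refl))
            w∉ (there (there (there (here refl)))) = F∉ (there (there (there (here refl))))
            n∉ : hE i′ (j′ + + 1) ∉ inner
            n∉ (here eq) = F∉ (here (cancelⱼ (hE-injective eq)))
            n∉ (there (here eq)) = F∉ (there (here (cancelⱼ (hE-injective eq))))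
            n∉ (there (there (here ())))
            n∉ (there (there (there (here ()))))
            e∉ : vE (i′ + + 1) j′ ∉ inner
            e∉ (there (there (here eq))) = F∉ (here (cancelᵢ (vE-injective eq)))
            e∉ (there (there (there (here eq)))) = F∉ (there (there (here (cancelᵢ (vE-injective eq)))))

          block-off : blockWeight h (assign σ w e s n) (i′ , j′) ≡ blockWeight h σ (i′ , j′)
          block-off = viaDiagonal-≡ refl
            (admissible-cong (refl {x = kind h i′ j′}) (refl {x = isClosed h (i′ , j′)}) (refl {x = isClosed h (i′ + + 1 , j′)})
              (refl {x = isClosed h (i′ , j′ + + 1)}) (refl {x = isClosed h (i′ + + 1 , j′ + + 1)}) (off s∉) (off e∉) (off n∉) (off w∉))

          block-off′ : blockWeight h′ (assign σ w e s n) (i′ , j′) ≡ blockWeight h σ (i′ , j′)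
          block-off′ = viaDiagonal-≡ diagonal-same
            (admissible-cong (kind-same i′ j′ n₀₀ n₁₀ n₀₁ n₁₁) (cl i′ j′ n₀₀) (cl _ _ n₁₀) (cl _ _ n₀₁) (cl _ _ n₁₁)
              (off s∉) (off e∉) (off n∉) (off w∉))
            where
            cl : ∀ i′ j′ → NotRaised (i′ , j′) → isClosed h′ (i′ , j′) ≡ isClosed h (i′ , j′)
            cl i′ j′ ne = isClosed-cong {h} {h′} i′ j′ (same i′ j′ ne)

    private
      out-true : ∀ {qX qP inP} → qP ≡ inP ∨ q → qX ≡ false → inP ≡ false → q ≡ false → outward qX qP ≡ true
      out-true refl refl refl q≡ rewrite q≡ = refl

      out-true′ : ∀ {qX qP inP} → qP ≡ inP ∨ q → qX ≡ false → inP ≡ false → q ≡ false → outward qP qX ≡ true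
      out-true′ refl refl refl q≡ rewrite q≡ = refl

      -- Supplies the hypotheses of `renewal`. If a side is missing after the move, the face beyond
      -- it is open and `q` is false. Of the two flanking neighbours at most one is nearer the apex,
      -- so another one is open too; the corner between the two open faces is outward, and before
      -- the move an outward corner always demands.
      covered : ∀ qX {inP inP′ out out′} wr wr′ o o′ → inP ∧ inP′ ≡ false →
        (qX ≡ false → inP ≡ false → q ≡ false → out ≡ true) →
        (qX ≡ false → inP′ ≡ false → q ≡ false → out′ ≡ true) →
        (demand wr out o ∨ demand wr′ out′ o′) ∨ (q ∨ qX) ≡ true
      covered qX {inP} {inP′} {out} {out′} wr wr′ o o′ one p p′ with q in q≡ | qX | inP | inP′
      ... | true  | _     | _     | _ = Bool.∨-zeroʳ _
      ... | false | true  | _     | _ = Bool.∨-zeroʳ _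
      ... | false | false | false | _ rewrite p refl refl refl = refl
      ... | false | false | true  | false rewrite p′ refl refl refl = cong (_∨ false) (Bool.∨-zeroʳ _)

    private
      inner-unique : Unique inner
      inner-unique = ((λ eq → z≢z+suc 0 (cong proj₁ (hE-injective eq))) ∷ (λ ()) ∷ (λ ()) ∷ []) ∷
                     ((λ ()) ∷ (λ ()) ∷ []) ∷ ((λ eq → z≢z+suc 0 (cong proj₂ (vE-injective eq))) ∷ []) ∷ [] ∷ []

      corners-unique : Unique corners
      corners-unique = ((λ eq → z≢z+suc 0 (cong proj₁ eq)) ∷ (λ eq → z≢z+suc 0 (cong proj₂ eq)) ∷ (λ eq → z≢z+suc 0 (cong proj₁ eq)) ∷ []) ∷
                       ((λ eq → z≢z+suc 0 (cong proj₂ eq)) ∷ (λ eq → z≢z+suc 0 (cong proj₂ eq)) ∷ []) ∷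
                       ((λ eq → z≢z+suc 0 (cong proj₁ eq)) ∷ []) ∷ [] ∷ []

    X : Carrier
    X = F′ * (W * E * (Sₒ * N))

    module _ {B B₀ : List Face} {L₀ : List Edge} (uB : Unique B)
             (sides-↭ : sides B ↭ inner ++ L₀) (B-↭ : B ↭ corners ++ B₀)
             (octahedron : F′ * F ≈ A * C * N * Sₒ +ₛ Bb * D * E * W) where
      open Renewal F F′ W E Sₒ N A Bb C D octahedron

      private
        L₀∉ : ∀ {e} → e ∈ L₀ → e ∉ inner
        L₀∉ e∈ e∈′ = unique-disjoint inner (Unique-resp-↭ sides-↭ (sides-unique uB)) e∈′ e∈
        L₀⊆ : ∀ {e} → e ∈ L₀ → e ∈ sides B
        L₀⊆ e∈ = Perm.∈-resp-↭ (↭-sym sides-↭) (∈-++⁺ʳ inner e∈)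
        B₀∉ : ∀ {G} → G ∈ B₀ → G ∉ corners
        B₀∉ G∈ G∈′ = unique-disjoint corners (Unique-resp-↭ B-↭ uB) G∈′ G∈

        module New′ = New (q ∨ qW) (q ∨ qE) (q ∨ qS) (q ∨ qN)

        allowed : (w e s n : Bool) → Bool
        allowed = sidesOk (q ∨ qW) (q ∨ qE) (q ∨ qS) (q ∨ qN)

        combine : ∀ {φ φ′} rest sc com dem sw se nw ne →
          (∀ w e s n → φ w e s n ≋ ((rest ⊗ (just sc ⊗ com)) ⊗ dem) ⊗ ([ Old.fits sw se nw ne w e s n ∧ true ] ⊗ just (Old.weight w e s n))) →
          (∀ w e s n → φ′ w e s n ≋ (rest ⊗ com) ⊗
            ([ New′.fits (not sw) (not se) (not nw) (not ne) w e s n ∧ allowed w e s n ] ⊗ just (New′.weight w e s n))) →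
          just F ⊗ (dem ⊗ Old.Z sw se nw ne) ≋ just X ⊗ New′.Z (not sw) (not se) (not nw) (not ne) →
          just F ⊗ ∑₁₆ φ ≋ just (sc * X) ⊗ ∑₁₆ φ′
        combine {φ} {φ′} rest sc com dem sw se nw ne before after renew = begin
          just F ⊗ ∑₁₆ φ                                     ≈⟨ *-congˡ {just F} (∑₁₆-cong {φ} {λ w e s n → K ⊗ old w e s n} before) ⟩
          just F ⊗ ∑₁₆ (λ w e s n → K ⊗ old w e s n)         ≈⟨ *-congˡ {just F} (∑₁₆-*ˡ K old) ⟨
          just F ⊗ (K ⊗ Old.Z sw se nw ne)
            ≈⟨ solve 6 (λ f r m g y z → (f ⊙ (((r ⊙ (m ⊙ g)) ⊙ y) ⊙ z)) ⊜ ((r ⊙ (m ⊙ g)) ⊙ (f ⊙ (y ⊙ z)))) ≋-refl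
                 (just F) rest (just sc) com dem (Old.Z sw se nw ne) ⟩
          (rest ⊗ (just sc ⊗ com)) ⊗ (just F ⊗ (dem ⊗ Old.Z sw se nw ne))  ≈⟨ *-congˡ {rest ⊗ (just sc ⊗ com)} renew ⟩
          (rest ⊗ (just sc ⊗ com)) ⊗ (just X ⊗ Z′)
            ≈⟨ solve 5 (λ r m g x z → ((r ⊙ (m ⊙ g)) ⊙ (x ⊙ z)) ⊜ ((m ⊙ x) ⊙ ((r ⊙ g) ⊙ z))) ≋-refl rest (just sc) com (just X) Z′ ⟩
          just (sc * X) ⊗ ((rest ⊗ com) ⊗ Z′)                ≈⟨ *-congˡ {just (sc * X)} (∑₁₆-*ˡ (rest ⊗ com) new) ⟩
          just (sc * X) ⊗ ∑₁₆ (λ w e s n → (rest ⊗ com) ⊗ new w e s n)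
            ≈⟨ *-congˡ {just (sc * X)} (∑₁₆-cong {φ′} {λ w e s n → (rest ⊗ com) ⊗ new w e s n} after) ⟨
          just (sc * X) ⊗ ∑₁₆ φ′ ∎
          where
          open SetoidReasoning ≋-setoid
          K = (rest ⊗ (just sc ⊗ com)) ⊗ dem
          Z′ = New′.Z (not sw) (not se) (not nw) (not ne)
          old new : Bool → Bool → Bool → Bool → Maybe Carrier
          old w e s n = [ Old.fits sw se nw ne w e s n ∧ true ] ⊗ just (Old.weight w e s n)
          new w e s n = [ New′.fits (not sw) (not se) (not nw) (not ne) w e s n ∧ allowed w e s n ] ⊗ just (New′.weight w e s n)

      module _ (σ : Assignment) where
        open SW σ using () renaming (r to rSW)
        open SE σ using () renaming (r to rSE)
        open NW σ using () renaming (r to rNW)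
        open NE σ using () renaming (r to rNE)

        private
          restSides restBlocks rest commonsσ demandsσ : Maybe Carrier
          restSides  = ∏ L₀ (sideWeight h σ)
          restBlocks = ∏ B₀ (blockWeight h σ)
          rest = restSides ⊗ restBlocks
          commonsσ = commons σ false false false false
          demandsσ = demands σ false false false false

          -- Serves `h` and `h′` alike: `ω` and `Ω` stand for the contributions of the inner sides
          -- and of the four corner blocks, while everything else agrees in both.
          expand : ∀ g w e s n {ω Ω} → let τ = assign σ w e s n in
            (∀ {e′} → e′ ∈ L₀ → sideWeight g τ e′ ≡ sideWeight h σ e′) →
            (∀ {G} → G ∈ B₀ → blockWeight g τ G ≡ blockWeight h σ G) →
            (weightOf g eW ^ᵇ w * weightOf g eE ^ᵇ e) * (weightOf g eS ^ᵇ s * weightOf g eN ^ᵇ n) ≈ ω →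
            fourBlocks σ w e s n g ≋ Ω →
            configWeight g B τ ≋ (just ω ⊗ restSides) ⊗ (Ω ⊗ restBlocks)
          expand g w e s n {ω} {Ω} sides≡ blocks≡ ω≈ Ω≋ = *-cong
            (≋-trans (∏-↭ (sideWeight g τ) sides-↭) (≋-trans (∏-++ inner {L₀} (sideWeight g τ))
              (*-cong innerProduct (∏-cong L₀ (≋-reflexive ∘ sides≡)))))
            (≋-trans (∏-↭ (blockWeight g τ) B-↭) (≋-trans (∏-++ corners {B₀} (blockWeight g τ))
              (*-cong cornerProduct (∏-cong B₀ (≋-reflexive ∘ blocks≡)))))
            where
            τ = assign σ w e s n
            side : ∀ e′ {t} → τ e′ ≡ t → sideWeight g τ e′ ≋ just (weightOf g e′ ^ᵇ t)
            side e′ eq = ≋-reflexive (cong (λ t → just (weightOf g e′ ^ᵇ t)) eq)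
            innerProduct : ∏ inner (sideWeight g τ) ≋ just ω
            innerProduct = ≋-trans
              (*-cong (side eW (assign-W σ w e s n)) (*-cong (side eE (assign-E σ w e s n))
                (*-cong (side eS (assign-S σ w e s n)) (*-congʳ {just 1#} (side eN (assign-N σ w e s n))))))
              (Pointwise.just (≈-trans
                (monomial (_ ∷ _ ∷ _ ∷ _ ∷ []) (v₀ · (v₁ · (v₂ · (v₃ · 𝟙)))) ((v₀ · v₁) · (v₂ · v₃)) refl) ω≈))
            cornerProduct : ∏ corners (blockWeight g τ) ≋ Ω
            cornerProduct = ≋-trans
              (*-congˡ {blockWeight g τ (i , j)} (*-congˡ {blockWeight g τ (I , j)}
                (*-congˡ {blockWeight g τ (i , J)} (*-identityʳ _)))) Ω≋

          side-off : ∀ w e s n {e′} → e′ ∈ L₀ → sideWeight h (assign σ w e s n) e′ ≡ sideWeight h σ e′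
          side-off w e s n {e′} e′∈ = cong (λ t → just (weightOf h e′ ^ᵇ t)) (assign-off σ w e s n (L₀∉ e′∈))

          side-off′ : ∀ w e s n {e′} → e′ ∈ L₀ → sideWeight h′ (assign σ w e s n) e′ ≡ sideWeight h σ e′
          side-off′ w e s n {e′} e′∈ = cong₂ (λ y t → just (y ^ᵇ t))
            (weight-same {B} (L₀⊆ e′∈) (L₀∉ e′∈)) (assign-off σ w e s n (L₀∉ e′∈))

          before : ∀ w e s n → configWeight h B (assign σ w e s n) ≋
            ((rest ⊗ (just scale ⊗ commonsσ)) ⊗ demandsσ) ⊗
            ([ Old.fits rSW rSE rNW rNE w e s n ∧ true ] ⊗ just (Old.weight w e s n))
          before w e s n = ≋-trans
            (expand h w e s n (side-off w e s n) (λ {G} G∈ → block-off (B₀∉ G∈) σ w e s n)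
              (weight-cong w e s n weight-W weight-E weight-S weight-N) (fourBlocks-before σ w e s n))
            (solve 7 (λ ω rs rb m g y fits →
              ((ω ⊙ rs) ⊙ (((m ⊙ g) ⊙ (y ⊙ fits)) ⊙ rb)) ⊜ ((((rs ⊙ rb) ⊙ (m ⊙ g)) ⊙ y) ⊙ (fits ⊙ ω))) ≋-refl
              (just (Old.weight w e s n)) restSides restBlocks (just scale) commonsσ demandsσ [ Old.fits rSW rSE rNW rNE w e s n ∧ true ])

          after : ∀ w e s n → configWeight h′ B (assign σ w e s n) ≋
            (rest ⊗ commonsσ) ⊗
            ([ New′.fits (not rSW) (not rSE) (not rNW) (not rNE) w e s n ∧ allowed w e s n ] ⊗ just (New′.weight w e s n))
          after w e s n = ≋-trans
            (expand h′ w e s n (side-off′ w e s n) (λ {G} G∈ → block-off′ (B₀∉ G∈) σ w e s n)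
              (weight-cong w e s n weight-W′ weight-E′ weight-S′ weight-N′) (fourBlocks-after σ w e s n))
            (solve 5 (λ ω rs rb g fits → ((ω ⊙ rs) ⊙ ((g ⊙ fits) ⊙ rb)) ⊜ (((rs ⊙ rb) ⊙ g) ⊙ (fits ⊙ ω))) ≋-refl
              (just (New′.weight w e s n)) restSides restBlocks commonsσ
              [ New′.fits (not rSW) (not rSE) (not rNW) (not rNE) w e s n ∧ allowed w e s n ])

        -- The sides off the square are frozen in `σ`. Neither `scale` nor `X` depends on them, so
        -- the identity survives the summation over them.
        inner-flip : just F ⊗ Sum inner (configWeight h B) σ ≋ just (scale * X) ⊗ Sum inner (configWeight h′ B) σ
        inner-flip = combine rest scale commonsσ demandsσ rSW rSE rNW rNE before after
          (renewal rSW rSE rNW rNE (q ∨ qW) (q ∨ qE) (q ∨ qS) (q ∨ qN)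
            (covered qW wrSW wrNW _ _ inSN (out-true′ clS) (out-true clN))
            (covered qE wrSE wrNE _ _ inSN (out-true′ clS) (out-true clN))
            (covered qS wrSW wrSE _ _ inWE (out-true clW) (out-true clE))
            (covered qN wrNW wrNE _ _ inWE (out-true′ clW) (out-true′ clE)))

      Zᴮ-flip-split : just F ⊗ Zᴮ h B ≋ just (scale * X) ⊗ Zᴮ h′ B
      Zᴮ-flip-split = begin
        just F ⊗ Zᴮ h B                                               ≈⟨ *-congˡ {just F} (split h) ⟩
        just F ⊗ Sum L₀ (Sum inner (configWeight h B)) _              ≈⟨ Sum-*ˡ L₀ (just F) _ _ ⟩
        Sum L₀ (λ σ → just F ⊗ Sum inner (configWeight h B) σ) _      ≈⟨ Sum-cong L₀ inner-flip _ ⟩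
        Sum L₀ (λ σ → just (scale * X) ⊗ Sum inner (configWeight h′ B) σ) _ ≈⟨ Sum-*ˡ L₀ (just (scale * X)) _ _ ⟨
        just (scale * X) ⊗ Sum L₀ (Sum inner (configWeight h′ B)) _   ≈⟨ *-congˡ {just (scale * X)} (split h′) ⟨
        just (scale * X) ⊗ Zᴮ h′ B ∎
        where
        open SetoidReasoning ≋-setoid
        split : ∀ g → Zᴮ g B ≋ Sum L₀ (Sum inner (configWeight g B)) (λ _ → false)
        split g = ≋-trans (Sum-↭ (configWeight-ext g B) (↭-trans sides-↭ (Perm.++-comm inner L₀)) _)
                    (≋-reflexive (Sum-++ L₀ (configWeight g B) _))

    Zᴮ-flip : ∀ {B} → Unique B → (i , j) ∈ B → (I , j) ∈ B → (i , J) ∈ B → (I , J) ∈ B →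
      F′ * F ≈ A * C * N * Sₒ +ₛ Bb * D * E * W → just F ⊗ Zᴮ h B ≋ just (scale * X) ⊗ Zᴮ h′ B
    Zᴮ-flip {B} uB SW∈ SE∈ NW∈ NE∈ octahedron with split-⊆ inner inner-unique inner⊆ | split-⊆ corners corners-unique corners⊆
      where
      inner⊆ : ∀ {e} → e ∈ inner → e ∈ sides B
      inner⊆ (here refl) = horizontal∈ NW∈
      inner⊆ (there (here refl)) = horizontal∈ NE∈
      inner⊆ (there (there (here refl))) = vertical∈ SE∈
      inner⊆ (there (there (there (here refl)))) = vertical∈ NE∈
      corners⊆ : ∀ {G} → G ∈ corners → G ∈ B
      corners⊆ (here refl) = SW∈
      corners⊆ (there (here refl)) = SE∈
      corners⊆ (there (there (here refl))) = NW∈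
      corners⊆ (there (there (there (here refl)))) = NE∈
    ... | L₀ , sides-↭ | B₀ , B-↭ = Zᴮ-flip-split uB sides-↭ B-↭ octahedron

-- Exponents

bit : Bool → ℕ
bit true  = 1
bit false = 0

count : ∀ {a} {A : Set a} → (A → Bool) → List A → ℕ
count p []       = 0
count p (x ∷ xs) = bit (p x) ℕ.+ count p xs

count-++ : ∀ {a} {A : Set a} (p : A → Bool) xs ys → count p (xs ++ ys) ≡ count p xs ℕ.+ count p ys
count-++ p []       ys = refl
count-++ p (x ∷ xs) ys = trans (cong (bit (p x) ℕ.+_) (count-++ p xs ys)) (sym (ℕ.+-assoc (bit (p x)) _ _))

+1-1 : ∀ i → i + + 1 - + 1 ≡ i
+1-1 = solve-∀

-1+1 : ∀ i → i - + 1 + + 1 ≡ i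
-1+1 = solve-∀

-- A diagonal of a corner block bounds the neighbour of the raised face exactly when the block is a
-- wrench. So, if all edges involved stay in the graph, the degree of the neighbour grows by two and
-- drops by two for each block that was a wrench. At the rim the shared side leaves the graph and
-- diagonals may be missing; the outward flags make up for this. If the neighbour and both flanks
-- are open, the rest of the degree must be zero.
raise-ceiling : ∀ q inX inP₁ inP₂ wr₁ wr₂ rest {qX qP₁ qP₂} → inP₁ ∧ inP₂ ≡ false →
  qX ≡ inX ∨ q → qP₁ ≡ inP₁ ∨ q → qP₂ ≡ inP₂ ∨ q →
  (qX ≡ false → qP₁ ≡ false → qP₂ ≡ false → rest ≡ 0) →
  1 ℕ.+ ⌈ 1 ℕ.+ ((if wr₁ then bit (qX ∨ qP₁) else 0) ℕ.+ ((if wr₂ then bit (qX ∨ qP₂) else 0) ℕ.+ rest)) /2⌉ ≡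
  bit (wr₁ ∨ outward qX qP₁) ℕ.+ (bit (wr₂ ∨ outward qX qP₂) ℕ.+
    ⌈ bit (q ∨ qX) ℕ.+ ((if not wr₁ then bit (qX ∨ qP₁) else 0) ℕ.+ ((if not wr₂ then bit (qX ∨ qP₂) else 0) ℕ.+ rest)) /2⌉)
raise-ceiling true  inX inP₁ inP₂ wr₁ wr₂ rest one eq eq₁ eq₂ far
  rewrite trans eq (Bool.∨-zeroʳ inX) | trans eq₁ (Bool.∨-zeroʳ inP₁) | trans eq₂ (Bool.∨-zeroʳ inP₂) = closed wr₁ wr₂
  where
  closed : ∀ wr₁ wr₂ →
    1 ℕ.+ ⌈ 1 ℕ.+ ((if wr₁ then 1 else 0) ℕ.+ ((if wr₂ then 1 else 0) ℕ.+ rest)) /2⌉ ≡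
    bit (wr₁ ∨ false) ℕ.+ (bit (wr₂ ∨ false) ℕ.+
      ⌈ 1 ℕ.+ ((if not wr₁ then 1 else 0) ℕ.+ ((if not wr₂ then 1 else 0) ℕ.+ rest)) /2⌉)
  closed true true = refl
  closed true false = refl
  closed false true = refl
  closed false false = refl
raise-ceiling false true inP₁ inP₂ true  true  rest one refl refl refl far = refl
raise-ceiling false true inP₁ inP₂ true  false rest one refl refl refl far = refl
raise-ceiling false true inP₁ inP₂ false true  rest one refl refl refl far = refl
raise-ceiling false true inP₁ inP₂ false false rest one refl refl refl far = refl
raise-ceiling false false true false true  true  rest one refl refl refl far = refl
raise-ceiling false false true false true  false rest one refl refl refl far = refl
raise-ceiling false false true false false true  rest one refl refl refl far = refl
raise-ceiling false false true false false false rest one refl refl refl far = refl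
raise-ceiling false false false true true  true  rest one refl refl refl far = refl
raise-ceiling false false false true true  false rest one refl refl refl far = refl
raise-ceiling false false false true false true  rest one refl refl refl far = refl
raise-ceiling false false false true false false rest one refl refl refl far = refl
raise-ceiling false false false false wr₁ wr₂ rest one refl refl refl far rewrite far refl refl refl = open-end wr₁ wr₂
  where
  open-end : ∀ wr₁ wr₂ →
    1 ℕ.+ ⌈ 1 ℕ.+ ((if wr₁ then 0 else 0) ℕ.+ ((if wr₂ then 0 else 0) ℕ.+ 0)) /2⌉ ≡
    bit (wr₁ ∨ true) ℕ.+ (bit (wr₂ ∨ true) ℕ.+ ⌈ (if not wr₁ then 0 else 0) ℕ.+ ((if not wr₂ then 0 else 0) ℕ.+ 0) /2⌉)
  open-end true true = refl
  open-end true false = refl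
  open-end false true = refl
  open-end false false = refl

module Degrees (n₀ i₀ j₀ : ℤ) where
  open Cone n₀ i₀ j₀

  inGraph : (ℤ → ℤ → ℤ) → Edge → Bool
  inGraph h e = foldr (λ F t → isClosed h F ∨ t) false (faces h e)

  degree : (ℤ → ℤ → ℤ) → Face → ℕ
  degree h (i , j) = count (inGraph h) (boundary h i j)

  -- The apex term makes the formula hold for the empty graph, which has no faces.
  correction : (ℤ → ℤ → ℤ) → Face → ℤ
  correction h F = + bit (isApex F ∧ not (isClosed h F)) - + bit (isClosed h F)

  exponent : (ℤ → ℤ → ℤ) → Face → ℤ
  exponent h F = + ⌈ degree h F /2⌉ + correction h F

  diagonalDegree : (ℤ → ℤ → ℤ) → ℤ → ℤ → Corner → ℕ
  diagonalDegree h i j X = if inEqualPair (kind h i j) X then bit (inGraph h (dE i j)) else 0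

  count-diagIf : ∀ h i j X → count (inGraph h) (diagIf h i j X) ≡ diagonalDegree h i j X
  count-diagIf h i j X with inEqualPair (kind h i j) X
  ... | true = ℕ.+-identityʳ _
  ... | false = refl

  sideDegree : (ℤ → ℤ → ℤ) → Edge → ℕ
  sideDegree h e = bit (inGraph h e)

  -- The predecessors are separate arguments, so that at a neighbour of the raised face no term
  -- `I₂ - 1` has to be simplified.
  degreeAt : (ℤ → ℤ → ℤ) → (i⁻ i j⁻ j : ℤ) → ℕ
  degreeAt h i⁻ i j⁻ j =
    sideDegree h (hE i⁻ j) ℕ.+ (sideDegree h (hE i j) ℕ.+ (sideDegree h (vE i j⁻) ℕ.+ (sideDegree h (vE i j) ℕ.+
      (diagonalDegree h i j c00 ℕ.+ (diagonalDegree h i⁻ j c10 ℕ.+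
      (diagonalDegree h i j⁻ c01 ℕ.+ diagonalDegree h i⁻ j⁻ c11))))))

  degree-at : ∀ h i j → degree h (i , j) ≡ degreeAt h (i - + 1) i (j - + 1) j
  degree-at h i j = cong (λ z → sideDegree h (hE i⁻ j) ℕ.+ (sideDegree h (hE i j) ℕ.+ (sideDegree h (vE i j⁻) ℕ.+
                                (sideDegree h (vE i j) ℕ.+ z))))
    (trans (count-++ p (D i j c00) (D i⁻ j c10 ++ D i j⁻ c01 ++ D i⁻ j⁻ c11)) (cong₂ ℕ._+_ (count-diagIf h i j c00)
    (trans (count-++ p (D i⁻ j c10) (D i j⁻ c01 ++ D i⁻ j⁻ c11)) (cong₂ ℕ._+_ (count-diagIf h i⁻ j c10)
    (trans (count-++ p (D i j⁻ c01) (D i⁻ j⁻ c11)) (cong₂ ℕ._+_ (count-diagIf h i j⁻ c01)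
                                                                  (count-diagIf h i⁻ j⁻ c11)))))))
    where
    i⁻ = i - + 1
    j⁻ = j - + 1
    p = inGraph h
    D = diagIf h

  degree-at′ : ∀ h i⁻ i j⁻ j → i - + 1 ≡ i⁻ → j - + 1 ≡ j⁻ → degree h (i , j) ≡ degreeAt h i⁻ i j⁻ j
  degree-at′ h i⁻ i j⁻ j refl refl = degree-at h i j

  module _ {h h′ : ℤ → ℤ → ℤ} {i j : ℤ} (R : Raise h h′ i j) (P : Position h h′ i j) where
    open Raise R
    open Position P hiding (I; J; I₂; J₂)

    private
      qW = isClosed h (i , J)
      qE = isClosed h (I₂ , J)
      qS = isClosed h (I , j)
      qN = isClosed h (I , J₂)

      NotRaised : Face → Set
      NotRaised G = G ≢ (I , J)

      cl-same : ∀ i′ j′ → NotRaised (i′ , j′) → isClosed h′ (i′ , j′) ≡ isClosed h (i′ , j′)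
      cl-same i′ j′ ne = isClosed-cong {h} {h′} i′ j′ (same i′ j′ ne)

      pair-same : ∀ i₁ j₁ i₂ j₂ → NotRaised (i₁ , j₁) → NotRaised (i₂ , j₂) →
        isClosed h′ (i₁ , j₁) ∨ (isClosed h′ (i₂ , j₂) ∨ false) ≡ isClosed h (i₁ , j₁) ∨ (isClosed h (i₂ , j₂) ∨ false)
      pair-same i₁ j₁ i₂ j₂ ne ne′ = cong₂ (λ t t′ → t ∨ (t′ ∨ false)) (cl-same i₁ j₁ ne) (cl-same i₂ j₂ ne′)

      ∨-false : ∀ t t′ → t ∨ (t′ ∨ false) ≡ t ∨ t′
      ∨-false t t′ = cong (t ∨_) (Bool.∨-identityʳ t′)

    hE-same : ∀ i′ j′ → NotRaised (i′ , j′) → NotRaised (i′ + + 1 , j′) → inGraph h′ (hE i′ j′) ≡ inGraph h (hE i′ j′)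
    hE-same i′ j′ = pair-same i′ j′ (i′ + + 1) j′

    vE-same : ∀ i′ j′ → NotRaised (i′ , j′) → NotRaised (i′ , j′ + + 1) → inGraph h′ (vE i′ j′) ≡ inGraph h (vE i′ j′)
    vE-same i′ j′ = pair-same i′ j′ i′ (j′ + + 1)

    diagonalDegree-same : ∀ i′ j′ X → NotRaised (i′ , j′) → NotRaised (i′ + + 1 , j′) → NotRaised (i′ , j′ + + 1) →
      NotRaised (i′ + + 1 , j′ + + 1) → diagonalDegree h′ i′ j′ X ≡ diagonalDegree h i′ j′ X
    diagonalDegree-same i′ j′ X n₀₀ n₁₀ n₀₁ n₁₁ =
      cong₂ (λ k t → if inEqualPair k X then bit t else 0) kinds
        (trans (cong (λ k → foldr (λ F t → isClosed h′ F ∨ t) false (diagonalFaces k i′ j′)) kinds) (closedness (kind h i′ j′)))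
      where
      kinds = kind-same i′ j′ n₀₀ n₁₀ n₀₁ n₁₁
      closedness : ∀ k → foldr (λ F t → isClosed h′ F ∨ t) false (diagonalFaces k i′ j′) ≡
                         foldr (λ F t → isClosed h F ∨ t) false (diagonalFaces k i′ j′)
      closedness cross = refl
      closedness wrenchMain = pair-same i′ j′ (i′ + + 1) (j′ + + 1) n₀₀ n₁₁
      closedness wrenchAnti = pair-same (i′ + + 1) j′ i′ (j′ + + 1) n₁₀ n₀₁

    -- A corner of the unequal pair is not bounded by the diagonal. Hence the raised face has only
    -- its four sides as boundary edges, before and after the move.
    diagonalDegree-0 : ∀ g i′ j′ X t → kind g i′ j′ ≡ (if t then wrenchAt X else cross) → diagonalDegree g i′ j′ X ≡ 0
    diagonalDegree-0 g i′ j′ X t eq rewrite eq = not-in-pair X t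
      where
      not-in-pair : ∀ X t {z : ℕ} → (if inEqualPair (if t then wrenchAt X else cross) X then z else 0) ≡ 0
      not-in-pair c00 true = refl
      not-in-pair c00 false = refl
      not-in-pair c10 true = refl
      not-in-pair c10 false = refl
      not-in-pair c01 true = refl
      not-in-pair c01 false = refl
      not-in-pair c11 true = refl
      not-in-pair c11 false = refl

    private
      paired : ∀ g i′ j′ X k t → kind g i′ j′ ≡ (if t then k else cross) → inEqualPair k X ≡ true →
        diagonalDegree g i′ j′ X ≡ (if t then bit (foldr (λ F t → isClosed g F ∨ t) false (diagonalFaces k i′ j′)) else 0)
      paired g i′ j′ X k false eq _ rewrite eq = refl
      paired g i′ j′ X k true eq eq′ rewrite eq | eq′ = refl

      -- the diagonal of a block at the raised face, seen from a neighbour X whose opposite is P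
      before : ∀ i′ j′ X k t qX qP → kind h i′ j′ ≡ (if t then k else cross) → inEqualPair k X ≡ true →
        foldr (λ F t → isClosed h F ∨ t) false (diagonalFaces k i′ j′) ≡ qX ∨ qP →
        diagonalDegree h i′ j′ X ≡ (if t then bit (qX ∨ qP) else 0)
      before i′ j′ X k t qX qP eq eq′ eq″ = trans (paired h i′ j′ X k t eq eq′) (cong (λ b → if t then bit b else 0) eq″)

      after : ∀ i′ j′ X k t qX qP → kind h′ i′ j′ ≡ (if not t then k else cross) → inEqualPair k X ≡ true →
        foldr (λ F t → isClosed h′ F ∨ t) false (diagonalFaces k i′ j′) ≡ qX ∨ qP →
        diagonalDegree h′ i′ j′ X ≡ (if not t then bit (qX ∨ qP) else 0)
      after i′ j′ X k t qX qP eq eq′ eq″ = trans (paired h′ i′ j′ X k (not t) eq eq′) (cong (λ b → if not t then bit b else 0) eq″)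

      -- For each direction, the side shared with the raised face and the two diagonals affected by
      -- the move come before the five terms that stay the same.
      reorderE : ∀ g i⁻ i j⁻ j → degreeAt g i⁻ i j⁻ j ≡
        sideDegree g (hE i⁻ j) ℕ.+ (diagonalDegree g i⁻ j c10 ℕ.+ (diagonalDegree g i⁻ j⁻ c11 ℕ.+ (sideDegree g (hE i j) ℕ.+ (sideDegree g (vE i j⁻) ℕ.+ (sideDegree g (vE i j) ℕ.+ (diagonalDegree g i j c00 ℕ.+ (diagonalDegree g i j⁻ c01)))))))
      reorderE g i⁻ i j⁻ j = arrange (sideDegree g (hE i⁻ j)) (sideDegree g (hE i j)) (sideDegree g (vE i j⁻)) (sideDegree g (vE i j)) (diagonalDegree g i j c00) (diagonalDegree g i⁻ j c10) (diagonalDegree g i j⁻ c01) (diagonalDegree g i⁻ j⁻ c11)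
        where arrange : ∀ a b c d e f g k → a ℕ.+ (b ℕ.+ (c ℕ.+ (d ℕ.+ (e ℕ.+ (f ℕ.+ (g ℕ.+ k)))))) ≡
                        a ℕ.+ (f ℕ.+ (k ℕ.+ (b ℕ.+ (c ℕ.+ (d ℕ.+ (e ℕ.+ (g)))))))
              arrange = ℕ-Solver.solve-∀
      reorderW : ∀ g i⁻ i j⁻ j → degreeAt g i⁻ i j⁻ j ≡
        sideDegree g (hE i j) ℕ.+ (diagonalDegree g i j⁻ c01 ℕ.+ (diagonalDegree g i j c00 ℕ.+ (sideDegree g (hE i⁻ j) ℕ.+ (sideDegree g (vE i j⁻) ℕ.+ (sideDegree g (vE i j) ℕ.+ (diagonalDegree g i⁻ j c10 ℕ.+ (diagonalDegree g i⁻ j⁻ c11)))))))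
      reorderW g i⁻ i j⁻ j = arrange (sideDegree g (hE i⁻ j)) (sideDegree g (hE i j)) (sideDegree g (vE i j⁻)) (sideDegree g (vE i j)) (diagonalDegree g i j c00) (diagonalDegree g i⁻ j c10) (diagonalDegree g i j⁻ c01) (diagonalDegree g i⁻ j⁻ c11)
        where arrange : ∀ a b c d e f g k → a ℕ.+ (b ℕ.+ (c ℕ.+ (d ℕ.+ (e ℕ.+ (f ℕ.+ (g ℕ.+ k)))))) ≡
                        b ℕ.+ (g ℕ.+ (e ℕ.+ (a ℕ.+ (c ℕ.+ (d ℕ.+ (f ℕ.+ (k)))))))
              arrange = ℕ-Solver.solve-∀
      reorderS : ∀ g i⁻ i j⁻ j → degreeAt g i⁻ i j⁻ j ≡
        sideDegree g (vE i j) ℕ.+ (diagonalDegree g i⁻ j c10 ℕ.+ (diagonalDegree g i j c00 ℕ.+ (sideDegree g (vE i j⁻) ℕ.+ (sideDegree g (hE i⁻ j) ℕ.+ (sideDegree g (hE i j) ℕ.+ (diagonalDegree g i j⁻ c01 ℕ.+ (diagonalDegree g i⁻ j⁻ c11)))))))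
      reorderS g i⁻ i j⁻ j = arrange (sideDegree g (hE i⁻ j)) (sideDegree g (hE i j)) (sideDegree g (vE i j⁻)) (sideDegree g (vE i j)) (diagonalDegree g i j c00) (diagonalDegree g i⁻ j c10) (diagonalDegree g i j⁻ c01) (diagonalDegree g i⁻ j⁻ c11)
        where arrange : ∀ a b c d e f g k → a ℕ.+ (b ℕ.+ (c ℕ.+ (d ℕ.+ (e ℕ.+ (f ℕ.+ (g ℕ.+ k)))))) ≡
                        d ℕ.+ (f ℕ.+ (e ℕ.+ (c ℕ.+ (a ℕ.+ (b ℕ.+ (g ℕ.+ (k)))))))
              arrange = ℕ-Solver.solve-∀
      reorderN : ∀ g i⁻ i j⁻ j → degreeAt g i⁻ i j⁻ j ≡
        sideDegree g (vE i j⁻) ℕ.+ (diagonalDegree g i⁻ j⁻ c11 ℕ.+ (diagonalDegree g i j⁻ c01 ℕ.+ (sideDegree g (vE i j) ℕ.+ (sideDegree g (hE i⁻ j) ℕ.+ (sideDegree g (hE i j) ℕ.+ (diagonalDegree g i j c00 ℕ.+ (diagonalDegree g i⁻ j c10)))))))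
      reorderN g i⁻ i j⁻ j = arrange (sideDegree g (hE i⁻ j)) (sideDegree g (hE i j)) (sideDegree g (vE i j⁻)) (sideDegree g (vE i j)) (diagonalDegree g i j c00) (diagonalDegree g i⁻ j c10) (diagonalDegree g i j⁻ c01) (diagonalDegree g i⁻ j⁻ c11)
        where arrange : ∀ a b c d e f g k → a ℕ.+ (b ℕ.+ (c ℕ.+ (d ℕ.+ (e ℕ.+ (f ℕ.+ (g ℕ.+ k)))))) ≡
                        c ℕ.+ (k ℕ.+ (g ℕ.+ (d ℕ.+ (a ℕ.+ (b ℕ.+ (e ℕ.+ (f)))))))
              arrange = ℕ-Solver.solve-∀
      z-1≢z+1 : ∀ z → z - + 1 ≢ z + + 1
      z-1≢z+1 z eq = z≢z+suc 1 (trans eq (rearrange z))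
        where rearrange : ∀ z → z + + 1 ≡ z - + 1 + + 2
              rearrange = solve-∀
      z-1+1≢z+1 : ∀ z → z - + 1 + + 1 ≢ z + + 1
      z-1+1≢z+1 z eq = z≢z+suc 0 (trans (sym (-1+1 z)) eq)
      z+2≢z : ∀ z → z + + 1 + + 1 ≢ z
      z+2≢z z eq = z≢z+suc 1 (trans (sym eq) (ℤ.+-assoc z (+ 1) (+ 1)))

      offᵢ : ∀ {i′ j′} → i′ ≢ I → NotRaised (i′ , j′)
      offᵢ ne eq = ne (cong proj₁ eq)
      offⱼ : ∀ {i′ j′} → j′ ≢ J → NotRaised (i′ , j′)
      offⱼ ne eq = ne (cong proj₂ eq)
      i≢I : i ≢ I
      i≢I = z≢z+suc 0
      j≢J : j ≢ J
      j≢J = z≢z+suc 0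
      I₂≢I : I₂ ≢ I
      I₂≢I eq = z≢z+suc 0 (sym eq)
      J₂≢J : J₂ ≢ J
      J₂≢J eq = z≢z+suc 0 (sym eq)

      diagonalDegree-open : ∀ i′ j′ X → inEqualPair wrenchMain X ≡ true →
        isClosed h (i′ , j′) ≡ false → isClosed h (i′ + + 1 , j′ + + 1) ≡ false → diagonalDegree h i′ j′ X ≡ 0
      diagonalDegree-open i′ j′ X main q₁ q₂ with kind h i′ j′
      ... | cross = refl
      ... | wrenchMain rewrite main | q₁ | q₂ = refl
      diagonalDegree-open i′ j′ c00 main q₁ q₂ | wrenchAnti = refl
      diagonalDegree-open i′ j′ c11 main q₁ q₂ | wrenchAnti = refl

      diagonalDegree-open′ : ∀ i′ j′ X → inEqualPair wrenchAnti X ≡ true →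
        isClosed h (i′ + + 1 , j′) ≡ false → isClosed h (i′ , j′ + + 1) ≡ false → diagonalDegree h i′ j′ X ≡ 0
      diagonalDegree-open′ i′ j′ X anti q₁ q₂ with kind h i′ j′
      ... | cross = refl
      ... | wrenchAnti rewrite anti | q₁ | q₂ = refl
      diagonalDegree-open′ i′ j′ c10 anti q₁ q₂ | wrenchMain = refl
      diagonalDegree-open′ i′ j′ c01 anti q₁ q₂ | wrenchMain = refl

      open-side : ∀ {b b′} → b ≡ false → b′ ≡ false → bit (b ∨ (b′ ∨ false)) ≡ 0
      open-side refl refl = refl

      zeros : ∀ {a b c d e} → a ≡ 0 → b ≡ 0 → c ≡ 0 → d ≡ 0 → e ≡ 0 → a ℕ.+ (b ℕ.+ (c ℕ.+ (d ℕ.+ e))) ≡ 0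
      zeros refl refl refl refl refl = refl

      fives : ∀ {a b c d e a′ b′ c′ d′ e′ : ℕ} → a ≡ a′ → b ≡ b′ → c ≡ c′ → d ≡ d′ → e ≡ e′ →
              a ℕ.+ (b ℕ.+ (c ℕ.+ (d ℕ.+ e))) ≡ a′ ℕ.+ (b′ ℕ.+ (c′ ℕ.+ (d′ ℕ.+ e′)))
      fives refl refl refl refl refl = refl

      open-corner : ∀ qO {inP inP′ qP qP′} → (qO ⇒ inP ∨ inP′ ∨ q) ≡ true → qP ≡ inP ∨ q → qP′ ≡ inP′ ∨ q →
                    qP ≡ false → qP′ ≡ false → qO ≡ false
      open-corner false _ _ _ _ _ = refl
      open-corner true {false} {false} eq eq₁ eq₂ eq₃ _ with () ← trans (sym eq) (trans (sym eq₁) eq₃)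
      open-corner true {true} {inP′} eq refl eq₂ () _
      open-corner true {false} {true} eq eq₁ refl _ ()

      combine : ∀ {k k′ side side′ d₁ d₂ d₁′ d₂′ rest rest′ qX qP₁ qP₂} inX inP₁ inP₂ wr₁ wr₂ →
        inP₁ ∧ inP₂ ≡ false → qX ≡ inX ∨ q → qP₁ ≡ inP₁ ∨ q → qP₂ ≡ inP₂ ∨ q →
        k ≡ bit side ℕ.+ (d₁ ℕ.+ (d₂ ℕ.+ rest)) → k′ ≡ bit side′ ℕ.+ (d₁′ ℕ.+ (d₂′ ℕ.+ rest′)) →
        side ≡ true → side′ ≡ q ∨ qX →
        d₁ ≡ (if wr₁ then bit (qX ∨ qP₁) else 0) → d₂ ≡ (if wr₂ then bit (qX ∨ qP₂) else 0) →
        d₁′ ≡ (if not wr₁ then bit (qX ∨ qP₁) else 0) → d₂′ ≡ (if not wr₂ then bit (qX ∨ qP₂) else 0) →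
        rest′ ≡ rest → (qX ≡ false → qP₁ ≡ false → qP₂ ≡ false → rest ≡ 0) →
        1 ℕ.+ ⌈ k /2⌉ ≡ bit (wr₁ ∨ outward qX qP₁) ℕ.+ (bit (wr₂ ∨ outward qX qP₂) ℕ.+ ⌈ k′ /2⌉)
      combine {rest = rest} inX inP₁ inP₂ wr₁ wr₂ one eq eq₁ eq₂ refl refl refl refl refl refl refl refl refl far =
        raise-ceiling q inX inP₁ inP₂ wr₁ wr₂ rest one eq eq₁ eq₂ far

      seen : ∀ {b b′} → b ≡ true → b ∨ b′ ≡ true
      seen refl = refl
      seen′ : ∀ {b b′} → b′ ≡ true → b ∨ (b′ ∨ false) ≡ true
      seen′ {b} refl = Bool.∨-zeroʳ b

      first : ∀ {b b′ c c′} → b ≡ c → b′ ≡ c′ → b ∨ (b′ ∨ false) ≡ c ∨ c′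
      first {b} {b′} refl refl = ∨-false b b′
      second : ∀ {b b′ c c′} → b ≡ c → b′ ≡ c′ → b ∨ (b′ ∨ false) ≡ c′ ∨ c
      second {b} {b′} refl refl = trans (∨-false b b′) (Bool.∨-comm b b′)

    qW′ : isClosed h′ (i , J) ≡ qW
    qW′ = cl-same i J (offᵢ i≢I)
    qE′ : isClosed h′ (I₂ , J) ≡ qE
    qE′ = cl-same I₂ J (offᵢ I₂≢I)
    qS′ : isClosed h′ (I , j) ≡ qS
    qS′ = cl-same I j (offⱼ j≢J)
    qN′ : isClosed h′ (I , J₂) ≡ qN
    qN′ = cl-same I J₂ (offⱼ J₂≢J)

    ceiling-E : 1 ℕ.+ ⌈ degree h (I₂ , J) /2⌉ ≡
      bit (wrNE ∨ outward qE qN) ℕ.+ (bit (wrSE ∨ outward qE qS) ℕ.+ ⌈ degree h′ (I₂ , J) /2⌉)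
    ceiling-E = combine inE inN inS wrNE wrSE (trans (Bool.∧-comm inN inS) inSN) clE clN clS
      (trans (degree-at′ h I I₂ j J (+1-1 I) (+1-1 j)) (reorderE h I I₂ j J))
      (trans (degree-at′ h′ I I₂ j J (+1-1 I) (+1-1 j)) (reorderE h′ I I₂ j J))
      (seen closed) (first {q} refl qE′)
      (before I J c10 wrenchAnti wrNE qE qN kindNE refl (first {qE} {qN} refl refl)) (before I j c11 wrenchMain wrSE qE qS kindSE refl (second {qS} {qE} refl refl))
      (after I J c10 wrenchAnti wrNE qE qN kindNE′ refl (first qE′ qN′)) (after I j c11 wrenchMain wrSE qE qS kindSE′ refl (second qS′ qE′))
      (fives (cong bit (hE-same I₂ J (offᵢ I₂≢I) (offᵢ (z+2≢z I)))) (cong bit (vE-same I₂ j (offᵢ I₂≢I) (offᵢ I₂≢I)))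
        (cong bit (vE-same I₂ J (offᵢ I₂≢I) (offᵢ I₂≢I)))
        (diagonalDegree-same I₂ J c00 (offᵢ I₂≢I) (offᵢ (z+2≢z I)) (offᵢ I₂≢I) (offᵢ (z+2≢z I)))
        (diagonalDegree-same I₂ j c01 (offᵢ I₂≢I) (offᵢ (z+2≢z I)) (offᵢ I₂≢I) (offᵢ (z+2≢z I))))
      λ E0 N0 S0 → let far₁ , far₂ , far₃ = farE E0 S0 N0
                       NE0 = open-corner _ clNE clE clN E0 N0
                       SE0 = open-corner _ clSE clS clE S0 E0 in
        zeros (open-side E0 far₂) (open-side SE0 E0) (open-side E0 NE0)
          (diagonalDegree-open I₂ J c00 refl E0 far₃) (diagonalDegree-open′ I₂ j c01 refl far₁ E0)

    ceiling-W : 1 ℕ.+ ⌈ degree h (i , J) /2⌉ ≡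
      bit (wrSW ∨ outward qW qS) ℕ.+ (bit (wrNW ∨ outward qW qN) ℕ.+ ⌈ degree h′ (i , J) /2⌉)
    ceiling-W = combine inW inS inN wrSW wrNW inSN clW clS clN
      (trans (degree-at′ h i⁻ i j J refl (+1-1 j)) (reorderW h i⁻ i j J))
      (trans (degree-at′ h′ i⁻ i j J refl (+1-1 j)) (reorderW h′ i⁻ i j J))
      (seen′ {qW} closed) (second {b′ = q} qW′ refl)
      (before i j c01 wrenchAnti wrSW qW qS kindSW refl (second {qS} {qW} refl refl)) (before i J c00 wrenchMain wrNW qW qN kindNW refl (first {qW} {qN} refl refl))
      (after i j c01 wrenchAnti wrSW qW qS kindSW′ refl (second qS′ qW′)) (after i J c00 wrenchMain wrNW qW qN kindNW′ refl (first qW′ qN′))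
      (fives (cong bit (hE-same i⁻ J (offᵢ (z-1≢z+1 i)) (offᵢ (z-1+1≢z+1 i)))) (cong bit (vE-same i j (offᵢ i≢I) (offᵢ i≢I)))
        (cong bit (vE-same i J (offᵢ i≢I) (offᵢ i≢I)))
        (diagonalDegree-same i⁻ J c10 (offᵢ (z-1≢z+1 i)) (offᵢ (z-1+1≢z+1 i)) (offᵢ (z-1≢z+1 i)) (offᵢ (z-1+1≢z+1 i)))
        (diagonalDegree-same i⁻ j c11 (offᵢ (z-1≢z+1 i)) (offᵢ (z-1+1≢z+1 i)) (offᵢ (z-1≢z+1 i)) (offᵢ (z-1+1≢z+1 i))))
      λ W0 S0 N0 → let far₁ , far₂ , far₃ = farW W0 S0 N0
                       NW0 = open-corner _ clNW clW clN W0 N0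
                       SW0 = open-corner _ clSW clS clW S0 W0
                       W0′ = trans (cong (λ z → isClosed h (z , J)) (-1+1 i)) W0 in
        zeros (open-side far₂ W0′) (open-side SW0 W0) (open-side W0 NW0)
          (diagonalDegree-open′ i⁻ J c10 refl W0′ far₃) (diagonalDegree-open i⁻ j c11 refl far₁ W0′)
      where i⁻ = i - + 1

    ceiling-S : 1 ℕ.+ ⌈ degree h (I , j) /2⌉ ≡
      bit (wrSW ∨ outward qS qW) ℕ.+ (bit (wrSE ∨ outward qS qE) ℕ.+ ⌈ degree h′ (I , j) /2⌉)
    ceiling-S = combine inS inW inE wrSW wrSE inWE clS clW clE
      (trans (degree-at′ h i I j⁻ j (+1-1 i) refl) (reorderS h i I j⁻ j))
      (trans (degree-at′ h′ i I j⁻ j (+1-1 i) refl) (reorderS h′ i I j⁻ j))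
      (seen′ {qS} closed) (second {b′ = q} qS′ refl)
      (before i j c10 wrenchAnti wrSW qS qW kindSW refl (first {qS} {qW} refl refl)) (before I j c00 wrenchMain wrSE qS qE kindSE refl (first {qS} {qE} refl refl))
      (after i j c10 wrenchAnti wrSW qS qW kindSW′ refl (first qS′ qW′)) (after I j c00 wrenchMain wrSE qS qE kindSE′ refl (first qS′ qE′))
      (fives (cong bit (vE-same I j⁻ (offⱼ (z-1≢z+1 j)) (offⱼ (z-1+1≢z+1 j)))) (cong bit (hE-same i j (offⱼ j≢J) (offⱼ j≢J)))
        (cong bit (hE-same I j (offⱼ j≢J) (offⱼ j≢J)))
        (diagonalDegree-same I j⁻ c01 (offⱼ (z-1≢z+1 j)) (offⱼ (z-1≢z+1 j)) (offⱼ (z-1+1≢z+1 j)) (offⱼ (z-1+1≢z+1 j)))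
        (diagonalDegree-same i j⁻ c11 (offⱼ (z-1≢z+1 j)) (offⱼ (z-1≢z+1 j)) (offⱼ (z-1+1≢z+1 j)) (offⱼ (z-1+1≢z+1 j))))
      λ S0 W0 E0 → let far₁ , far₂ , far₃ = farS S0 W0 E0
                       SE0 = open-corner _ clSE clS clE S0 E0
                       SW0 = open-corner _ clSW clS clW S0 W0
                       S0′ = trans (cong (λ z → isClosed h (I , z)) (-1+1 j)) S0 in
        zeros (open-side far₂ S0′) (open-side SW0 S0) (open-side S0 SE0)
          (diagonalDegree-open′ I j⁻ c01 refl far₃ S0′) (diagonalDegree-open i j⁻ c11 refl far₁ S0′)
      where j⁻ = j - + 1

    ceiling-N : 1 ℕ.+ ⌈ degree h (I , J₂) /2⌉ ≡
      bit (wrNW ∨ outward qN qW) ℕ.+ (bit (wrNE ∨ outward qN qE) ℕ.+ ⌈ degree h′ (I , J₂) /2⌉)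
    ceiling-N = combine inN inW inE wrNW wrNE inWE clN clW clE
      (trans (degree-at′ h i I J J₂ (+1-1 i) (+1-1 J)) (reorderN h i I J J₂))
      (trans (degree-at′ h′ i I J J₂ (+1-1 i) (+1-1 J)) (reorderN h′ i I J J₂))
      (seen closed) (first {q} refl qN′)
      (before i J c11 wrenchMain wrNW qN qW kindNW refl (second {qW} {qN} refl refl)) (before I J c01 wrenchAnti wrNE qN qE kindNE refl (second {qE} {qN} refl refl))
      (after i J c11 wrenchMain wrNW qN qW kindNW′ refl (second qW′ qN′)) (after I J c01 wrenchAnti wrNE qN qE kindNE′ refl (second qE′ qN′))
      (fives (cong bit (vE-same I J₂ (offⱼ J₂≢J) (offⱼ (z+2≢z J)))) (cong bit (hE-same i J₂ (offⱼ J₂≢J) (offⱼ J₂≢J)))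
        (cong bit (hE-same I J₂ (offⱼ J₂≢J) (offⱼ J₂≢J)))
        (diagonalDegree-same I J₂ c00 (offⱼ J₂≢J) (offⱼ J₂≢J) (offⱼ (z+2≢z J)) (offⱼ (z+2≢z J)))
        (diagonalDegree-same i J₂ c10 (offⱼ J₂≢J) (offⱼ J₂≢J) (offⱼ (z+2≢z J)) (offⱼ (z+2≢z J))))
      λ N0 W0 E0 → let far₁ , far₂ , far₃ = farN N0 W0 E0
                       NE0 = open-corner _ clNE clE clN E0 N0
                       NW0 = open-corner _ clNW clW clN W0 N0 in
        zeros (open-side N0 far₂) (open-side NW0 N0) (open-side N0 NE0)
          (diagonalDegree-open I J₂ c00 refl N0 far₃) (diagonalDegree-open′ i J₂ c10 refl N0 far₁)

    private
      degree-of : ∀ g → degree g (I , J) ≡ degreeAt g i I j J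
      degree-of g = degree-at′ g i I j J (+1-1 i) (+1-1 j)

      eights : ∀ {a b c d e f g k a′ b′ c′ d′ : ℕ} → a ≡ a′ → b ≡ b′ → c ≡ c′ → d ≡ d′ → e ≡ 0 → f ≡ 0 → g ≡ 0 → k ≡ 0 →
        a ℕ.+ (b ℕ.+ (c ℕ.+ (d ℕ.+ (e ℕ.+ (f ℕ.+ (g ℕ.+ k)))))) ≡ a′ ℕ.+ (b′ ℕ.+ (c′ ℕ.+ (d′ ℕ.+ 0)))
      eights refl refl refl refl refl refl refl refl = refl

      bit-q : ∀ {qX inX : Bool} → qX ≡ inX ∨ q → q ∨ qX ≡ inX ∨ q
      bit-q {inX = inX} refl with q
      ... | true  = sym (Bool.∨-zeroʳ inX)
      ... | false = refl

      exponent-≡ : ∀ g G {k cl} → degree g G ≡ k → isClosed g G ≡ cl →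
        exponent g G ≡ + ⌈ k /2⌉ + (+ bit (isApex G ∧ not cl) - + bit cl)
      exponent-≡ g G refl refl = refl

    exponent-F : exponent h (I , J) ≡ + 1
    exponent-F = trans
      (exponent-≡ h (I , J)
        (trans (degree-of h) (eights
          (cong bit (seen′ {qW} closed)) (cong bit (seen closed)) (cong bit (seen′ {qS} closed)) (cong bit (seen closed))
          (diagonalDegree-0 h I J c00 wrNE kindNE) (diagonalDegree-0 h i J c10 wrNW kindNW)
          (diagonalDegree-0 h I j c01 wrSE kindSE) (diagonalDegree-0 h i j c11 wrSW kindSW))) closed)
      (cong (λ t → + 2 + (+ bit t - + 1)) (Bool.∧-zeroʳ (isApex (I , J))))

    -- If the face stays closed, all four sides count and the exponent is 2 - 1. If it becomes open,
    -- the sides towards its one or two neighbours nearer the apex remain, with ceiling 1; if there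
    -- is no such neighbour, the face is the apex and `correction` contributes the 1.
    exponent-F′ : exponent h′ (I , J) ≡ + 1
    exponent-F′ = trans
      (exponent-≡ h′ (I , J)
        (trans (degree-of h′) (eights
          (cong bit (trans (second {b′ = q} qW′ refl) (bit-q clW))) (cong bit (trans (first {q} refl qE′) (bit-q clE)))
          (cong bit (trans (second {b′ = q} qS′ refl) (bit-q clS))) (cong bit (trans (first {q} refl qN′) (bit-q clN)))
          (diagonalDegree-0 h′ I J c00 (not wrNE) kindNE′) (diagonalDegree-0 h′ i J c10 (not wrNW) kindNW′)
          (diagonalDegree-0 h′ I j c01 (not wrSE) kindSE′) (diagonalDegree-0 h′ i j c11 (not wrSW) kindSW′))) refl)
      (trans (cong (λ t → + ⌈ bit (inW ∨ q) ℕ.+ (bit (inE ∨ q) ℕ.+ (bit (inS ∨ q) ℕ.+ (bit (inN ∨ q) ℕ.+ 0))) /2⌉ +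
                            (+ bit (t ∧ not q) - + bit q)) apex)
        (values q inW inE inS inN inWE inSN))
      where
      values : ∀ q w e s n → w ∧ e ≡ false → s ∧ n ≡ false →
        + ⌈ bit (w ∨ q) ℕ.+ (bit (e ∨ q) ℕ.+ (bit (s ∨ q) ℕ.+ (bit (n ∨ q) ℕ.+ 0))) /2⌉ +
        (+ bit (not (w ∨ e ∨ s ∨ n) ∧ not q) - + bit q) ≡ + 1
      values true  w e s n _ _
        rewrite Bool.∨-zeroʳ w | Bool.∨-zeroʳ e | Bool.∨-zeroʳ s | Bool.∨-zeroʳ n | Bool.∧-zeroʳ (not (w ∨ e ∨ s ∨ n)) = refl
      values false true  false true  false _ _ = refl
      values false true  false false true  _ _ = refl
      values false true  false false false _ _ = refl
      values false false true  true  false _ _ = refl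
      values false false true  false true  _ _ = refl
      values false false true  false false _ _ = refl
      values false false false true  false _ _ = refl
      values false false false false true  _ _ = refl
      values false false false false false _ _ = refl

    exponent-X : ∀ X {t t′} → isClosed h′ X ≡ isClosed h X →
      1 ℕ.+ ⌈ degree h X /2⌉ ≡ bit t ℕ.+ (bit t′ ℕ.+ ⌈ degree h′ X /2⌉) →
      + 1 + exponent h X ≡ + bit t + (+ bit t′ + exponent h′ X)
    exponent-X X {t} {t′} cl eq = trans (sym (ℤ.+-assoc (+ 1) (+ ⌈ degree h X /2⌉) (correction h X)))
      (trans (cong₂ (λ z b → + z + (+ bit (isApex X ∧ not b) - + bit b)) eq (sym cl))
        (arrange (+ bit t) (+ bit t′) (+ ⌈ degree h′ X /2⌉) (correction h′ X)))
      where
      arrange : ∀ a b c d → a + (b + c) + d ≡ a + (b + (c + d))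
      arrange = solve-∀

    -- The only doubtful faces are those opposite to the raised face in a corner block. They too lie
    -- in the unequal pair, so the diagonals that come and go do not bound them.
    exponent-same : ∀ G → G ∉ (I , J) ∷ (i , J) ∷ (I₂ , J) ∷ (I , j) ∷ (I , J₂) ∷ [] → exponent h′ G ≡ exponent h G
    exponent-same (k , l) G∉ = shifted (k - + 1) (l - + 1) (-1+1 k) (-1+1 l)
      where
      shifted : ∀ i′ j′ → i′ + + 1 ≡ k → j′ + + 1 ≡ l → exponent h′ (k , l) ≡ exponent h (k , l)
      shifted i′ j′ refl refl = cong₂ (λ e b → + ⌈ e /2⌉ + (+ bit (isApex (k , l) ∧ not b) - + bit b))
          (trans (degree-at′ h′ i′ k j′ l (+1-1 i′) (+1-1 j′)) (trans
            (cong₂ ℕ._+_ (cong bit (hE-same i′ l ≢W G≢))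
            (cong₂ ℕ._+_ (cong bit (hE-same k l G≢ ≢E))
            (cong₂ ℕ._+_ (cong bit (vE-same k j′ ≢S G≢))
            (cong₂ ℕ._+_ (cong bit (vE-same k l G≢ ≢N))
            (cong₂ ℕ._+_ corner00 (cong₂ ℕ._+_ corner10 (cong₂ ℕ._+_ corner01 corner11)))))))
            (sym (degree-at′ h i′ k j′ l (+1-1 i′) (+1-1 j′)))))
          (cl-same k l G≢)
        where
        G≢ : NotRaised (k , l)
        G≢ eq = G∉ (here eq)
        ≢W : NotRaised (i′ , l)
        ≢W eq = G∉ (there (there (here (cong₂ _,_ (cong (_+ + 1) (cong proj₁ eq)) (cong proj₂ eq)))))
        ≢E : NotRaised (k + + 1 , l)
        ≢E eq = G∉ (there (here (cancelᵢ eq)))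
        ≢S : NotRaised (k , j′)
        ≢S eq = G∉ (there (there (there (there (here (cong₂ _,_ (cong proj₁ eq) (cong (_+ + 1) (cong proj₂ eq))))))))
        ≢N : NotRaised (k , l + + 1)
        ≢N eq = G∉ (there (there (there (here (cancelⱼ eq)))))

        at-opposite : ∀ i₁ j₁ i₂ j₂ X t → i₁ ≡ i₂ → j₁ ≡ j₂ → kind h i₂ j₂ ≡ (if t then wrenchAt X else cross) →
          kind h′ i₂ j₂ ≡ (if not t then wrenchAt X else cross) → diagonalDegree h′ i₁ j₁ X ≡ diagonalDegree h i₁ j₁ X
        at-opposite i₁ j₁ _ _ X t refl refl eq eq′ =
          trans (diagonalDegree-0 h′ i₁ j₁ X (not t) eq′) (sym (diagonalDegree-0 h i₁ j₁ X t eq))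

        corner00 : diagonalDegree h′ k l c00 ≡ diagonalDegree h k l c00
        corner00 with (k + + 1 , l + + 1) ≟F (I , J)
        ... | yes eq = at-opposite k l i j c00 wrSW (+1-injective (cong proj₁ eq)) (+1-injective (cong proj₂ eq)) kindSW kindSW′
        ... | no ne = diagonalDegree-same k l c00 G≢ ≢E ≢N ne
        corner10 : diagonalDegree h′ i′ l c10 ≡ diagonalDegree h i′ l c10
        corner10 with (i′ , l + + 1) ≟F (I , J)
        ... | yes eq = at-opposite i′ l I j c10 wrSE (cong proj₁ eq) (+1-injective (cong proj₂ eq)) kindSE kindSE′
        ... | no ne = diagonalDegree-same i′ l c10 ≢W G≢ ne ≢N
        corner01 : diagonalDegree h′ k j′ c01 ≡ diagonalDegree h k j′ c01
        corner01 with (k + + 1 , j′) ≟F (I , J)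
        ... | yes eq = at-opposite k j′ i J c01 wrNW (+1-injective (cong proj₁ eq)) (cong proj₂ eq) kindNW kindNW′
        ... | no ne = diagonalDegree-same k j′ c01 ≢S ne G≢ ≢E
        corner11 : diagonalDegree h′ i′ j′ c11 ≡ diagonalDegree h i′ j′ c11
        corner11 with (i′ , j′) ≟F (I , J)
        ... | yes eq = at-opposite i′ j′ I J c11 wrNE (cong proj₁ eq) (cong proj₂ eq) kindNE kindNE′
        ... | no ne = diagonalDegree-same i′ j′ c11 ne ≢S ≢W G≢

-- The factor common to all matchings

module Constants {c ℓ} (S : Semifield c ℓ) (a b cc d : ℤ → ℤ → Semifield.Carrier S)
                 (f : ℤ → ℤ → ℤ → Semifield.Carrier S) (n₀ i₀ j₀ : ℤ) where
  open Semifield S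
  open SF S
  open SemifieldProperties S
  open FlipAlgebra S
  open Cone n₀ i₀ j₀
  open Degrees n₀ i₀ j₀
  open PartitionFunction S a b cc d f n₀ i₀ j₀
  open Flip S a b cc d f n₀ i₀ j₀ using (scale; X; A; C; Bb; D; Zᴮ-flip)

  𝒞 : (ℤ → ℤ → ℤ) → List Face → Carrier
  𝒞 h B = ∏ₛ.∏ B (λ G → x h G ^ℤ exponent h G)

  ^ᵇ-bit : ∀ y t → y ^ℤ (+ bit t) ≈ y ^ᵇ t
  ^ᵇ-bit y true  = identityʳ y
  ^ᵇ-bit y false = ≈-refl

  power-shift : ∀ y {t t′ z z′} → + 1 + z ≡ + bit t + (+ bit t′ + z′) → y * y ^ℤ z ≈ y ^ᵇ t * (y ^ᵇ t′ * y ^ℤ z′)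
  power-shift y {t} {t′} {z} {z′} eq = begin
    y * y ^ℤ z                                        ≈⟨ ^ℤ-suc y z ⟨
    y ^ℤ (+ 1 + z)                                    ≡⟨ cong (y ^ℤ_) eq ⟩
    y ^ℤ (+ bit t + (+ bit t′ + z′))                  ≈⟨ ^ℤ-+ y (+ bit t) (+ bit t′ + z′) ⟩
    y ^ℤ (+ bit t) * y ^ℤ (+ bit t′ + z′)             ≈⟨ ∙-cong (^ᵇ-bit y t) (^ℤ-+ y (+ bit t′) z′) ⟩
    y ^ᵇ t * (y ^ℤ (+ bit t′) * y ^ℤ z′)              ≈⟨ ∙-congˡ (∙-congʳ (^ᵇ-bit y t′)) ⟩
    y ^ᵇ t * (y ^ᵇ t′ * y ^ℤ z′)                      ∎
    where open SetoidReasoning setoid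

  inverse-^ᵇ : ∀ y y′ t → ((y * y′) ⁻¹) ^ᵇ t * (y ^ᵇ t * y′ ^ᵇ t) ≈ 1#
  inverse-^ᵇ y y′ true  = inverseˡ (y * y′)
  inverse-^ᵇ y y′ false = ≈-trans (identityˡ _) (identityˡ _)

  module _ {h h′ : ℤ → ℤ → ℤ} {i j : ℤ} (R : Raise h h′ i j) (P : Position h h′ i j) where
    open Raise R
    open Position P hiding (I; J; I₂; J₂)

    private
      qW = isClosed h (i , J)
      qE = isClosed h (I₂ , J)
      qS = isClosed h (I , j)
      qN = isClosed h (I , J₂)
      F = x h (I , J)
      F′ = x h′ (I , J)
      W = x h (i , J)
      E = x h (I₂ , J)
      Sₒ = x h (I , j)
      N = x h (I , J₂)
      tSW = wrSW ∨ outward qS qW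
      tSE = wrSE ∨ outward qS qE
      tNW = wrNW ∨ outward qW qN
      tNE = wrNE ∨ outward qE qN

      p p′ : Face → Carrier
      p G = x h G ^ℤ exponent h G
      p′ G = x h G ^ℤ exponent h′ G

      five : List Face
      five = (I , J) ∷ (i , J) ∷ (I₂ , J) ∷ (I , j) ∷ (I , J₂) ∷ []

      five-unique : Unique five
      five-unique = (¹ (λ eq → z≢z+suc 0 (sym eq)) ∷ ¹ (λ eq → z≢z+suc 0 eq) ∷ ² (λ eq → z≢z+suc 0 (sym eq)) ∷ ² (z≢z+suc 0) ∷ []) ∷
                    (¹ (λ eq → z≢z+suc 1 (trans eq (ℤ.+-assoc i (+ 1) (+ 1)))) ∷ ¹ (z≢z+suc 0) ∷ ¹ (z≢z+suc 0) ∷ []) ∷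
                    (¹ (λ eq → z≢z+suc 0 (sym eq)) ∷ ¹ (λ eq → z≢z+suc 0 (sym eq)) ∷ []) ∷
                    (² (λ eq → z≢z+suc 1 (trans eq (ℤ.+-assoc j (+ 1) (+ 1)))) ∷ []) ∷ [] ∷ []
        where
        ¹ : ∀ {k l k′ l′ : ℤ} → k ≢ k′ → (k , l) ≢ (k′ , l′)
        ¹ ne eq = ne (cong proj₁ eq)
        ² : ∀ {k l k′ l′ : ℤ} → l ≢ l′ → (k , l) ≢ (k′ , l′)
        ² ne eq = ne (cong proj₂ eq)

      swap-outward : ∀ t u v → t ∨ outward u v ≡ t ∨ outward v u
      swap-outward t u v = cong (λ s → t ∨ not s) (Bool.∨-comm u v)

      shift : ∀ y X {t t′ s s′} → t ≡ s → t′ ≡ s′ → isClosed h′ X ≡ isClosed h X →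
        1 ℕ.+ ⌈ degree h X /2⌉ ≡ bit t ℕ.+ (bit t′ ℕ.+ ⌈ degree h′ X /2⌉) →
        y * y ^ℤ exponent h X ≈ y ^ᵇ s * (y ^ᵇ s′ * y ^ℤ exponent h′ X)
      shift y X {t} {t′} refl refl cl eq = power-shift y {t} {t′} {exponent h X} {exponent h′ X} (exponent-X R P X {t} {t′} cl eq)

      -- `X` supplies each neighbour once, and `scale` removes both neighbours at every corner whose
      -- flag `wr ∨ outward` is set. By the four ceiling lemmas this is exactly how the exponent of
      -- each neighbour changes: by one minus the flags at its two corners.
      exponents-shift : ∀ rest →
        ((F ^ℤ (+ 1) * (p (i , J) * (p (I₂ , J) * (p (I , j) * (p (I , J₂) * 1#))))) * rest) * (scale R P * X R P) ≈
        ((F′ ^ℤ (+ 1) * (p′ (i , J) * (p′ (I₂ , J) * (p′ (I , j) * (p′ (I , J₂) * 1#))))) * rest) * F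
      exponents-shift rest = begin
        ((F ^ℤ (+ 1) * (pW * (pE * (pS * (pN * 1#))))) * rest) * ((sSW * (sSE * (sNW * sNE))) * (F′ * (W * E * (Sₒ * N))))
          ≈⟨ monomial (F ∷ F′ ∷ rest ∷ pW ∷ pE ∷ pS ∷ pN ∷ sSW ∷ sSE ∷ sNW ∷ sNE ∷ W ∷ E ∷ Sₒ ∷ N ∷ [])
               (((v₀ · 𝟙) · (v₃ · (v₄ · (v₅ · (v₆ · 𝟙)))) · v₂) · ((v₇ · (v₈ · (v₉ · v₁₀))) · (v₁ · (v₁₁ · v₁₂ · (v₁₃ · v₁₄)))))
               (((v₀ · v₁) · v₂) · ((v₇ · (v₈ · (v₉ · v₁₀))) · ((v₁₁ · v₃) · ((v₁₂ · v₄) · ((v₁₃ · v₅) · (v₁₄ · v₆))))))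
               refl ⟩
        ((F * F′) * rest) * ((sSW * (sSE * (sNW * sNE))) * ((W * pW) * ((E * pE) * ((Sₒ * pS) * (N * pN)))))
          ≈⟨ ∙-congˡ (∙-congˡ (∙-cong (shift W (i , J) (swap-outward wrSW qW qS) (refl {x = tNW}) (qW′ R P) (ceiling-W R P))
               (∙-cong (shift E (I₂ , J) (refl {x = tNE}) (swap-outward wrSE qE qS) (qE′ R P) (ceiling-E R P))
               (∙-cong (shift Sₒ (I , j) (refl {x = tSW}) (refl {x = tSE}) (qS′ R P) (ceiling-S R P))
                       (shift N (I , J₂) (swap-outward wrNW qN qW) (swap-outward wrNE qN qE) (qN′ R P) (ceiling-N R P)))))) ⟩
        ((F * F′) * rest) * ((sSW * (sSE * (sNW * sNE))) *
          ((W ^ᵇ tSW * (W ^ᵇ tNW * pW′)) * ((E ^ᵇ tNE * (E ^ᵇ tSE * pE′)) *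
          ((Sₒ ^ᵇ tSW * (Sₒ ^ᵇ tSE * pS′)) * (N ^ᵇ tNW * (N ^ᵇ tNE * pN′))))))
          ≈⟨ monomial ((F * F′) * rest ∷ sSW ∷ sSE ∷ sNW ∷ sNE ∷ W ^ᵇ tSW ∷ W ^ᵇ tNW ∷ pW′ ∷ E ^ᵇ tNE ∷ E ^ᵇ tSE ∷ pE′ ∷
                       Sₒ ^ᵇ tSW ∷ Sₒ ^ᵇ tSE ∷ pS′ ∷ N ^ᵇ tNW ∷ N ^ᵇ tNE ∷ pN′ ∷ [])
               (v₀ · ((v₁ · (v₂ · (v₃ · v₄))) · ((v₅ · (v₆ · v₇)) · ((v₈ · (v₉ · v₁₀)) · ((v₁₁ · (v₁₂ · v₁₃)) · (v₁₄ · (v₁₅ · v₁₆)))))))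
               ((v₀ · (v₇ · (v₁₀ · (v₁₃ · v₁₆)))) · ((v₁ · (v₁₁ · v₅)) · ((v₂ · (v₁₂ · v₉)) · ((v₃ · (v₆ · v₁₄)) · (v₄ · (v₈ · v₁₅))))))
               refl ⟩
        (((F * F′) * rest) * (pW′ * (pE′ * (pS′ * pN′)))) *
          ((sSW * (Sₒ ^ᵇ tSW * W ^ᵇ tSW)) * ((sSE * (Sₒ ^ᵇ tSE * E ^ᵇ tSE)) *
           ((sNW * (W ^ᵇ tNW * N ^ᵇ tNW)) * (sNE * (E ^ᵇ tNE * N ^ᵇ tNE)))))
          ≈⟨ ∙-congˡ (∙-cong (inverse-^ᵇ Sₒ W tSW) (∙-cong (inverse-^ᵇ Sₒ E tSE)
               (∙-cong (inverse-^ᵇ W N tNW) (inverse-^ᵇ E N tNE)))) ⟩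
        (((F * F′) * rest) * (pW′ * (pE′ * (pS′ * pN′)))) * (1# * (1# * (1# * 1#)))
          ≈⟨ monomial (F ∷ F′ ∷ rest ∷ pW′ ∷ pE′ ∷ pS′ ∷ pN′ ∷ [])
               ((((v₀ · v₁) · v₂) · (v₃ · (v₄ · (v₅ · v₆)))) · (𝟙 · (𝟙 · (𝟙 · 𝟙))))
               (((v₁ · 𝟙) · (v₃ · (v₄ · (v₅ · (v₆ · 𝟙)))) · v₂) · v₀) refl ⟩
        ((F′ ^ℤ (+ 1) * (pW′ * (pE′ * (pS′ * (pN′ * 1#))))) * rest) * F ∎
        where
        open SetoidReasoning setoid
        pW = p (i , J)
        pE = p (I₂ , J)
        pS = p (I , j)
        pN = p (I , J₂)
        pW′ = p′ (i , J)
        pE′ = p′ (I₂ , J)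
        pS′ = p′ (I , j)
        pN′ = p′ (I , J₂)
        sSW = ((Sₒ * W) ⁻¹) ^ᵇ tSW
        sSE = ((Sₒ * E) ⁻¹) ^ᵇ tSE
        sNW = ((W * N) ⁻¹) ^ᵇ tNW
        sNE = ((E * N) ⁻¹) ^ᵇ tNE

    𝒞-flip : ∀ {B} → Unique B → (∀ {G} → G ∈ five → G ∈ B) → 𝒞 h B * (scale R P * X R P) ≈ 𝒞 h′ B * F
    𝒞-flip {B} uB five⊆B with split-⊆ five five-unique five⊆B
    ... | B₁ , B↭ = begin
        𝒞 h B * (scale R P * X R P)   ≈⟨ ∙-congʳ (≈-trans (∏ₛ.∏-↭ p B↭) (∏ₛ.∏-++ five {B₁} p)) ⟩
        (∏ₛ.∏ five p * ∏ₛ.∏ B₁ p) * (scale R P * X R P)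
          ≈⟨ ∙-congʳ (∙-congʳ (∙-congʳ (≈-reflexive (cong (F ^ℤ_) (exponent-F R P))))) ⟩
        ((F ^ℤ (+ 1) * (p (i , J) * (p (I₂ , J) * (p (I , j) * (p (I , J₂) * 1#))))) * ∏ₛ.∏ B₁ p) * (scale R P * X R P)
          ≈⟨ exponents-shift (∏ₛ.∏ B₁ p) ⟩
        ((F′ ^ℤ (+ 1) * (p′ (i , J) * (p′ (I₂ , J) * (p′ (I , j) * (p′ (I , J₂) * 1#))))) * ∏ₛ.∏ B₁ p) * F
          ≈⟨ ∙-congʳ (∙-cong (∙-cong (≈-reflexive (cong (F′ ^ℤ_) (sym (exponent-F′ R P))))
               (∙-cong (moved off-i) (∙-cong (moved off-I₂) (∙-cong (moved off-j) (∙-cong (moved off-J₂) ≈-refl))))) (∏ₛ.∏-cong B₁ elsewhere)) ⟩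
        (∏ₛ.∏ five P″ * ∏ₛ.∏ B₁ P″) * F   ≈⟨ ∙-congʳ (≈-trans (∏ₛ.∏-↭ P″ B↭) (∏ₛ.∏-++ five {B₁} P″)) ⟨
        𝒞 h′ B * F ∎
      where
      open SetoidReasoning setoid
      P″ : Face → Carrier
      P″ G = x h′ G ^ℤ exponent h′ G
      x-same : ∀ {G} → G ≢ (I , J) → x h G ≡ x h′ G
      x-same {k , l} ne = cong (λ z → f z k l) (sym (same k l ne))
      moved : ∀ {G} → G ≢ (I , J) → p′ G ≈ P″ G
      moved {G} ne = ≈-reflexive (cong (_^ℤ exponent h′ G) (x-same ne))
      elsewhere : ∀ {G} → G ∈ B₁ → p G ≈ P″ G
      elsewhere {G} G∈ = ≈-reflexive (cong₂ _^ℤ_ (x-same (λ eq → G∉ (here eq))) (sym (exponent-same R P G G∉)))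
        where
        G∉ : G ∉ five
        G∉ G∈′ = unique-disjoint five (Unique-resp-↭ B↭ uB) G∈′ G∈

    -- The factor `F` on the left of `Zᴮ-flip` is borrowed from `𝒞 h B` and given back by `𝒞-flip`.
    invariance : ∀ {B} → Unique B → (i , j) ∈ B → (∀ {G} → G ∈ five → G ∈ B) →
      F′ * F ≈ A R P * C R P * N * Sₒ +ₛ Bb R P * D R P * E * W →
      just (𝒞 h B) ⊗ Zᴮ h B ≋ just (𝒞 h′ B) ⊗ Zᴮ h′ B
    invariance {B} uB SW∈ five⊆B octahedron = begin
      just (𝒞 h B) ⊗ Zᴮ h B
        ≈⟨ *-congʳ {Zᴮ h B} (Pointwise.just (monomial (𝒞 h B ∷ F ∷ []) v₀ ((v₀ · v₁ ⁻) · v₁) refl)) ⟩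
      (just (𝒞 h B * F ⁻¹) ⊗ just F) ⊗ Zᴮ h B     ≈⟨ *-assoc (just (𝒞 h B * F ⁻¹)) (just F) (Zᴮ h B) ⟩
      just (𝒞 h B * F ⁻¹) ⊗ (just F ⊗ Zᴮ h B)
        ≈⟨ *-congˡ {just (𝒞 h B * F ⁻¹)} (Zᴮ-flip R P uB SW∈ (five⊆B (there (there (there (here refl)))))
             (five⊆B (there (here refl))) (five⊆B (here refl)) octahedron) ⟩
      just (𝒞 h B * F ⁻¹) ⊗ (just (scale R P * X R P) ⊗ Zᴮ h′ B)
        ≈⟨ *-assoc (just (𝒞 h B * F ⁻¹)) (just (scale R P * X R P)) (Zᴮ h′ B) ⟨
      just ((𝒞 h B * F ⁻¹) * (scale R P * X R P)) ⊗ Zᴮ h′ B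
        ≈⟨ *-congʳ {Zᴮ h′ B} (Pointwise.just (≈-trans
             (monomial (𝒞 h B ∷ F ∷ scale R P * X R P ∷ []) ((v₀ · v₁ ⁻) · v₂) ((v₀ · v₂) · v₁ ⁻) refl)
             (≈-trans (∙-congʳ (𝒞-flip uB five⊆B))
               (monomial (𝒞 h′ B ∷ F ∷ []) ((v₀ · v₁) · v₁ ⁻) v₀ refl)))) ⟩
      just (𝒞 h′ B) ⊗ Zᴮ h′ B ∎
      where
      open SetoidReasoning ≋-setoid

-- The cone of an apex

sign : Bool → ℤ
sign true  = - + 1
sign false = + 1

-- The distance to k₀ near i + 1: left (right) says that i (that i + 2) is closer to k₀ than i + 1.
record Axis (k₀ i : ℤ) : Set where
  dist = λ k → + ∣ k - k₀ ∣
  field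
    left right : Bool
    exclusive : left ∧ right ≡ false
    centred : does (i + + 1 ℤ.≟ k₀) ≡ not (left ∨ right)
    distˡ : dist i ≡ dist (i + + 1) + sign left
    distʳ : dist (i + + 1 + + 1) ≡ dist (i + + 1) + sign right
    farˡ : left ≡ false → dist (i - + 1) ≡ dist (i + + 1) + + 2
    farʳ : right ≡ false → dist (i + + 1 + + 1 + + 1) ≡ dist (i + + 1) + + 2

-- Keeps the case distinction on the offset from unfolding in types that mention the fields.
abstract
  axis : ∀ k₀ i → Axis k₀ i
  axis k₀ i = from (i + + 1 - k₀) refl
    where
    at-offset : ∀ {k z} t → k - k₀ ≡ i + + 1 - k₀ + t → i + + 1 - k₀ ≡ z → + ∣ k - k₀ ∣ ≡ + ∣ z + t ∣
    at-offset t eq refl = cong (λ w → + ∣ w ∣) eq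
    eq₋₁ : ∀ i k → i - k ≡ i + + 1 - k + - + 1
    eq₋₁ = solve-∀
    eq₊₁ : ∀ i k → i + + 1 + + 1 - k ≡ i + + 1 - k + + 1
    eq₊₁ = solve-∀
    eq₋₂ : ∀ i k → i - + 1 - k ≡ i + + 1 - k + - + 2
    eq₋₂ = solve-∀
    eq₊₂ : ∀ i k → i + + 1 + + 1 + + 1 - k ≡ i + + 1 - k + + 2
    eq₊₂ = solve-∀
    here? : ∀ {z} → i + + 1 - k₀ ≡ z → z ≢ + 0 → does (i + + 1 ℤ.≟ k₀) ≡ false
    here? eq z≢0 = dec-false (i + + 1 ℤ.≟ k₀) (λ i≡ → z≢0 (trans (sym eq) (ℤ.i≡j⇒i-j≡0 i≡)))
    via : ∀ k {z} t w → k - k₀ ≡ i + + 1 - k₀ + t → i + + 1 - k₀ ≡ z → + ∣ z + t ∣ ≡ + ∣ z ∣ + w →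
          + ∣ k - k₀ ∣ ≡ + ∣ i + + 1 - k₀ ∣ + w
    via k t w eq eq′ eq″ = trans (at-offset {k} t eq eq′) (trans eq″ (cong (λ z → + ∣ z ∣ + w) (sym eq′)))
    from : ∀ z → i + + 1 - k₀ ≡ z → Axis k₀ i
    from (+ ℕ.zero) eq = record
      { left = false ; right = false ; exclusive = refl
      ; centred = dec-true (i + + 1 ℤ.≟ k₀) (ℤ.i-j≡0⇒i≡j (i + + 1) k₀ eq)
      ; distˡ = via i (- + 1) (+ 1) (eq₋₁ i k₀) eq refl ; distʳ = via (i + + 1 + + 1) (+ 1) (+ 1) (eq₊₁ i k₀) eq refl
      ; farˡ = λ _ → via (i - + 1) (- + 2) (+ 2) (eq₋₂ i k₀) eq refl ; farʳ = λ _ → via (i + + 1 + + 1 + + 1) (+ 2) (+ 2) (eq₊₂ i k₀) eq refl }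
    from (+ ℕ.suc n) eq = record
      { left = true ; right = false ; exclusive = refl
      ; centred = here? eq λ ()
      ; distˡ = via i (- + 1) (- + 1) (eq₋₁ i k₀) eq refl ; distʳ = via (i + + 1 + + 1) (+ 1) (+ 1) (eq₊₁ i k₀) eq refl
      ; farˡ = λ () ; farʳ = λ _ → via (i + + 1 + + 1 + + 1) (+ 2) (+ 2) (eq₊₂ i k₀) eq refl }
    from -[1+ n ] eq = record
      { left = false ; right = true ; exclusive = refl
      ; centred = here? eq λ ()
      ; distˡ = via i (- + 1) (+ 1) (eq₋₁ i k₀) eq (cong (λ k → + ℕ.suc k) (sym (ℕ.+-suc n 0)))
      ; distʳ = via (i + + 1 + + 1) (+ 1) (- + 1) (eq₊₁ i k₀) eq (nearer n)
      ; farˡ = λ _ → via (i - + 1) (- + 2) (+ 2) (eq₋₂ i k₀) eq (cong (λ k → + ℕ.suc k) (sym (ℕ.+-suc n 1)))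
      ; farʳ = λ () }
      where
      nearer : ∀ n → + ∣ -[1+ n ] + + 1 ∣ ≡ + ∣ -[1+ n ] ∣ + - + 1
      nearer ℕ.zero = refl
      nearer (ℕ.suc n) = refl

∣z∣≡1 : ∀ z → ∣ z ∣ ≡ 1 → z ≡ + 1 ⊎ z ≡ - + 1
∣z∣≡1 (+ 1) refl = inj₁ refl
∣z∣≡1 -[1+ 0 ] refl = inj₂ refl

adjacent : ∀ y z → ∣ y - z ∣ ≡ 1 → y ≡ z + + 1 ⊎ y + + 1 ≡ z
adjacent y z eq with ∣z∣≡1 (y - z) eq
... | inj₁ d = inj₁ (trans (rearrange y z) (cong (λ w → z + w) d))
  where rearrange : ∀ y z → y ≡ z + (y - z)
        rearrange = solve-∀
... | inj₂ d = inj₂ (trans (rearrange y z) (trans (cong (λ w → z + w + + 1) d) (cancel z)))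
  where rearrange : ∀ y z → y + + 1 ≡ z + (y - z) + + 1
        rearrange = solve-∀
        cancel : ∀ z → z + - + 1 + + 1 ≡ z
        cancel = solve-∀

adjacent′ : ∀ y z → ∣ y - z ∣ ≡ 1 ⊎ ∣ z - y ∣ ≡ 1 → y ≡ z + + 1 ⊎ y + + 1 ≡ z
adjacent′ y z (inj₁ eq) = adjacent y z eq
adjacent′ y z (inj₂ eq) with adjacent z y eq
... | inj₁ z≡ = inj₂ (sym z≡)
... | inj₂ z≡ = inj₁ (sym z≡)

+1+-1 : ∀ z → z + + 1 + - + 1 ≡ z
+1+-1 = solve-∀

≤+1 : ∀ {z} → z ℤ.≤ z + + 1
≤+1 {z} = ℤ.i≤i+j z (+ 1)

adjacent-≤ : ∀ y z → ∣ y - z ∣ ≡ 1 → y ℤ.≤ z + + 1 × z ℤ.≤ y + + 1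
adjacent-≤ y z eq with adjacent y z eq
... | inj₁ refl = ℤ.≤-refl , ℤ.≤-trans ≤+1 ≤+1
... | inj₂ refl = ℤ.≤-trans ≤+1 ≤+1 , ℤ.≤-refl

shift-< : ∀ {y z y′ z′} t → y + t ≡ y′ → z + t ≡ z′ → y ℤ.< z → y′ ℤ.< z′
shift-< t refl refl y<z = ℤ.+-monoˡ-< t y<z

shift-≤ : ∀ {y z y′ z′} t → y + t ≡ y′ → z + t ≡ z′ → y ℤ.≤ z → y′ ℤ.≤ z′
shift-≤ t refl refl y≤z = ℤ.+-monoˡ-≤ t y≤z

record Adjacent (h : ℤ → ℤ → ℤ) : Set where
  field
    adjᵢ : ∀ i j → ∣ h (i + + 1) j - h i j ∣ ≡ 1
    adjⱼ : ∀ i j → ∣ h i (j + + 1) - h i j ∣ ≡ 1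

raise : (ℤ → ℤ → ℤ) → ℤ → ℤ → ℤ → ℤ → ℤ
raise h k l i j = if does (i ℤ.≟ k) ∧ does (j ℤ.≟ l) then h k l + + 2 else h i j

raise-at : ∀ h k l → raise h k l k l ≡ h k l + + 2
raise-at h k l rewrite dec-true (k ℤ.≟ k) refl | dec-true (l ℤ.≟ l) refl = refl

raise-off : ∀ h k l i j → (i , j) ≢ (k , l) → raise h k l i j ≡ h i j
raise-off h k l i j ne with i ℤ.≟ k | j ℤ.≟ l
... | yes refl | yes refl = ⊥-elim (ne refl)
... | yes _ | no _ = refl
... | no _ | _ = refl

module Geometry (n₀ i₀ j₀ : ℤ) where
  open Cone n₀ i₀ j₀

  pyramid : ℤ → ℤ → ℤ
  pyramid = pyr n₀ i₀ j₀

  <⇒closed : ∀ h i j → h i j ℤ.< pyramid i j → isClosed h (i , j) ≡ true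
  <⇒closed h i j = dec-true (h i j ℤ.<? pyramid i j)

  ≮⇒open : ∀ h i j → ¬ (h i j ℤ.< pyramid i j) → isClosed h (i , j) ≡ false
  ≮⇒open h i j = dec-false (h i j ℤ.<? pyramid i j)

  module LocalMinimum (h : ℤ → ℤ → ℤ) (adj : Adjacent h) (i j : ℤ) (closedF : h (i + + 1) (j + + 1) ℤ.< pyramid (i + + 1) (j + + 1))
      (minimal : ∀ k l → h k l ℤ.< pyramid k l → h (i + + 1) (j + + 1) ℤ.≤ h k l) where
    open Adjacent adj

    private
      I = i + + 1
      J = j + + 1
      I₂ = I + + 1
      J₂ = J + + 1
      m = h I J
      h′ = raise h I J
      module U = Axis (axis i₀ i)
      module V = Axis (axis j₀ j)
      u = U.dist
      v = V.dist
      t = pyramid I J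

      pyramid-at : ∀ k l a b → u k ≡ u I + a → v l ≡ v J + b → pyramid k l ≡ t - a - b
      pyramid-at k l a b eq eq′ = trans (cong₂ (λ y z → n₀ - y - z) eq eq′) (rearrange n₀ (u I) (v J) a b)
        where rearrange : ∀ n y z a b → n - (y + a) - (z + b) ≡ n - y - z - a - b
              rearrange = solve-∀

      +0 : ∀ z → z ≡ z + + 0
      +0 z = sym (ℤ.+-identityʳ z)

      -- The pyramid falls by at most one towards a neighbour, so a neighbour lower than a closed
      -- face is closed too and would contradict minimality.
      neighbour-height : ∀ {k l} s → ∣ h k l - m ∣ ≡ 1 ⊎ ∣ m - h k l ∣ ≡ 1 → pyramid k l ≡ t - sign s → h k l ≡ m + + 1
      neighbour-height {k} {l} s adj p≡ with adjacent′ (h k l) m adj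
      ... | inj₁ up = up
      ... | inj₂ down = ⊥-elim (ℤ.<⇒≱ below (minimal k l (closed s p≡)))
        where
        below : h k l ℤ.< m
        below = subst (h k l ℤ.<_) down (ℤ.suc[i]≤j⇒i<j (ℤ.≤-reflexive (ℤ.+-comm (+ 1) (h k l))))
        closed : ∀ s → pyramid k l ≡ t - sign s → h k l ℤ.< pyramid k l
        closed false eq = subst (h k l ℤ.<_) (sym eq)
          (shift-< (- + 1) (trans (cong (_+ - + 1) (sym down)) (+1+-1 (h k l))) refl closedF)
        closed true eq = subst (h k l ℤ.<_) (sym eq) (ℤ.<-≤-trans (ℤ.<-trans below closedF) ≤+1)

      pW : pyramid i J ≡ t - sign U.left
      pW = trans (pyramid-at i J (sign U.left) (+ 0) U.distˡ (+0 (v J))) (ℤ.+-identityʳ _)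
      pE : pyramid I₂ J ≡ t - sign U.right
      pE = trans (pyramid-at I₂ J (sign U.right) (+ 0) U.distʳ (+0 (v J))) (ℤ.+-identityʳ _)
      pS : pyramid I j ≡ t - sign V.left
      pS = trans (pyramid-at I j (+ 0) (sign V.left) (+0 (u I)) V.distˡ) (cong (_- sign V.left) (ℤ.+-identityʳ t))
      pN : pyramid I J₂ ≡ t - sign V.right
      pN = trans (pyramid-at I J₂ (+ 0) (sign V.right) (+0 (u I)) V.distʳ) (cong (_- sign V.right) (ℤ.+-identityʳ t))

      opposite-height : ∀ {y z} → ∣ y - z ∣ ≡ 1 ⊎ ∣ z - y ∣ ≡ 1 → z ≡ m + + 1 → y ≡ m ⊎ y ≡ m + + 2
      opposite-height {y} {z} adj refl with adjacent′ y z adj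
      ... | inj₁ eq = inj₂ (trans eq (ℤ.+-assoc m (+ 1) (+ 1)))
      ... | inj₂ eq = inj₁ (+1-injective eq)

      zW : h i J ≡ m + + 1
      zW = neighbour-height U.left (inj₂ (adjᵢ i J)) pW
      zE : h I₂ J ≡ m + + 1
      zE = neighbour-height U.right (inj₁ (adjᵢ I J)) pE
      zS : h I j ≡ m + + 1
      zS = neighbour-height V.left (inj₂ (adjⱼ I j)) pS
      zN : h I J₂ ≡ m + + 1
      zN = neighbour-height V.right (inj₁ (adjⱼ I J)) pN

    raised : Raise h h′ i j
    raised = record
      { raised = raise-at h I J ; same = λ k l → raise-off h I J k l
      ; zW = zW ; zE = zE ; zS = zS ; zN = zN
      ; zSW = opposite-height (inj₂ (adjᵢ i j)) zS ; zSE = opposite-height (inj₁ (adjᵢ I j)) zS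
      ; zNW = opposite-height (inj₁ (adjⱼ i J)) zW ; zNE = opposite-height (inj₁ (adjⱼ I₂ J)) zE }

    private
      q = isClosed h′ (I , J)

      q⇐ : m + + 2 ℤ.< t → q ≡ true
      q⇐ lt = <⇒closed h′ I J (subst (ℤ._< t) (sym (raise-at h I J)) lt)

      -- Towards the apex height and pyramid both grow by one, so the neighbour is closed. Away from
      -- it the neighbour has height `m + 1` under `t - 1`, which is closed exactly if `m + 2` is
      -- below `t`, the condition `q`.
      side : ∀ {k l} s → h k l ≡ m + + 1 → pyramid k l ≡ t - sign s → isClosed h (k , l) ≡ s ∨ q
      side {k} {l} true eq p≡ = <⇒closed h k l
        (subst₂ ℤ._<_ (sym eq) (sym p≡) (ℤ.+-monoˡ-< (+ 1) closedF))
      side {k} {l} false eq p≡ = does-⇔ (mk⇔ to from) (h k l ℤ.<? pyramid k l) (h′ I J ℤ.<? t)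
        where
        plus minus : ∀ z → _
        plus z = ℤ.+-assoc z (+ 1) (+ 1)
        minus z = -1+1 z
        to : h k l ℤ.< pyramid k l → h′ I J ℤ.< t
        to lt = shift-< (+ 1) (trans (cong (_+ + 1) eq) (trans (plus m) (sym (raise-at h I J))))
                              (trans (cong (_+ + 1) p≡) (minus t)) lt
        from : h′ I J ℤ.< t → h k l ℤ.< pyramid k l
        from lt = shift-< (- + 1) (trans (cong (_+ - + 1) (raise-at h I J)) (trans (ℤ.+-assoc m (+ 2) (- + 1)) (sym eq)))
                                  (sym p≡) lt

      -- If `q` is false, then `t` is at most `m + 2`. A face with excess distance `a + b` and
      -- height at least `m + 2 - (a + b)` is therefore open. The bound `y` is `m` at excess two and
      -- `m - 1` at excess three.
      distant : ∀ {k l} a b → ∀ {y} → pyramid k l ≡ t - a - b → y ℤ.≤ h k l → m + + 2 ≡ y + (a + b) → q ≡ false →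
                isClosed h (k , l) ≡ false
      distant {k} {l} a b {y} p≡ y≤ eq q≡ = ≮⇒open h k l λ lt → false≢true (trans (sym q≡)
          (q⇐ (shift-< (a + b) (sym eq) (cancel t a b) (ℤ.≤-<-trans y≤ (subst (h k l ℤ.<_) p≡ lt)))))
        where
        false≢true : false ≢ true
        false≢true ()
        cancel : ∀ z a b → z - a - b + (a + b) ≡ z
        cancel = solve-∀

      m≤ : ∀ {z} → z ≡ m ⊎ z ≡ m + + 2 → m ℤ.≤ z
      m≤ (inj₁ eq) = ℤ.≤-reflexive (sym eq)
      m≤ (inj₂ eq) = subst (m ℤ.≤_) (sym eq) (ℤ.i≤i+j m (+ 2))

      ⇒-true : ∀ b → (b ⇒ true) ≡ true
      ⇒-true true = refl
      ⇒-true false = refl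

      corner : ∀ {k l} s s′ → pyramid k l ≡ t - sign s - sign s′ → h k l ≡ m ⊎ h k l ≡ m + + 2 →
               (isClosed h (k , l) ⇒ s ∨ s′ ∨ q) ≡ true
      corner true _ _ _ = ⇒-true _
      corner false true _ _ = ⇒-true _
      corner {k} {l} false false p≡ o with q in q≡
      ... | true = ⇒-true _
      ... | false rewrite distant {k} {l} (+ 1) (+ 1) p≡ (m≤ o) refl q≡ = refl

      split-or : ∀ {s} → s ∨ q ≡ false → s ≡ false × q ≡ false
      split-or {false} eq = refl , eq

      swap-sides : ∀ {k l a b} → pyramid k l ≡ t - a - b → pyramid k l ≡ t - b - a
      swap-sides {a = a} {b} eq = trans eq (swap-minus t a b)
        where swap-minus : ∀ z a b → z - a - b ≡ z - b - a
              swap-minus = solve-∀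

      lower : ∀ {y z} → m ℤ.≤ z → z ℤ.≤ y + + 1 → m + - + 1 ℤ.≤ y
      lower {y} m≤z z≤ = shift-≤ (- + 1) refl (+1+-1 y) (ℤ.≤-trans m≤z z≤)

      lower′ : ∀ {y z} → z ≡ m + + 1 → z ℤ.≤ y + + 1 → m ℤ.≤ y
      lower′ {y} refl z≤ = shift-≤ (- + 1) (+1+-1 m) (+1+-1 y) z≤

      leftwards : ∀ l → h i l ℤ.≤ h (i - + 1) l + + 1
      leftwards l = proj₁ (adjacent-≤ (h i l) (h (i - + 1) l)
        (subst (λ k → ∣ h k l - h (i - + 1) l ∣ ≡ 1) (-1+1 i) (adjᵢ (i - + 1) l)))
      rightwards : ∀ l → h I₂ l ℤ.≤ h (I₂ + + 1) l + + 1
      rightwards l = proj₂ (adjacent-≤ (h (I₂ + + 1) l) (h I₂ l) (adjᵢ I₂ l))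
      downwards : ∀ k → h k j ℤ.≤ h k (j - + 1) + + 1
      downwards k = proj₁ (adjacent-≤ (h k j) (h k (j - + 1))
        (subst (λ l → ∣ h k l - h k (j - + 1) ∣ ≡ 1) (-1+1 j) (adjⱼ k (j - + 1))))
      upwards : ∀ k → h k J₂ ℤ.≤ h k (J₂ + + 1) + + 1
      upwards k = proj₂ (adjacent-≤ (h k (J₂ + + 1)) (h k J₂) (adjⱼ k J₂))

      3≡ : ∀ z → z + + 2 ≡ z + - + 1 + + 3
      3≡ = solve-∀

      sign-false : ∀ {s y z} → y ≡ z + sign s → s ≡ false → y ≡ z + + 1
      sign-false eq refl = eq

    open Raise raised using (zSW; zSE; zNW; zNE)

    position : Position h h′ i j
    position = record
      { closed = <⇒closed h I J closedF
      ; inW = U.left ; inE = U.right ; inS = V.left ; inN = V.right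
      ; inWE = U.exclusive ; inSN = V.exclusive
      ; clW = clW ; clE = clE ; clS = clS ; clN = clN
      ; clSW = corner V.left U.left (swap-sides {i} {j} (pyramid-at i j (sign U.left) (sign V.left) U.distˡ V.distˡ)) zSW
      ; clSE = corner V.left U.right (swap-sides {I₂} {j} (pyramid-at I₂ j (sign U.right) (sign V.left) U.distʳ V.distˡ)) zSE
      ; clNW = corner U.left V.right (pyramid-at i J₂ (sign U.left) (sign V.right) U.distˡ V.distʳ) zNW
      ; clNE = corner U.right V.right (pyramid-at I₂ J₂ (sign U.right) (sign V.right) U.distʳ V.distʳ) zNE
      ; apex = trans (cong₂ _∧_ U.centred V.centred) (deMorgan U.left U.right (V.left ∨ V.right))
      ; farW = λ W0 S0 N0 → let w , q0 = split-or (trans (sym clW) W0)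
                                s , _ = split-or (trans (sym clS) S0)
                                n , _ = split-or (trans (sym clN) N0) in
          distant (+ 2) (+ 1) (pyramid-at (i - + 1) j (+ 2) (+ 1) (U.farˡ w) (sign-false {V.left} {v j} {v J} V.distˡ s)) (lower (m≤ zSW) (leftwards j)) (3≡ m) q0
        , distant (+ 2) (+ 0) (pyramid-at (i - + 1) J (+ 2) (+ 0) (U.farˡ w) (+0 (v J))) (lower′ zW (leftwards J)) refl q0
        , distant (+ 2) (+ 1) (pyramid-at (i - + 1) J₂ (+ 2) (+ 1) (U.farˡ w) (sign-false {V.right} {v J₂} {v J} V.distʳ n)) (lower (m≤ zNW) (leftwards J₂)) (3≡ m) q0
      ; farE = λ E0 S0 N0 → let e , q0 = split-or (trans (sym clE) E0)
                                s , _ = split-or (trans (sym clS) S0)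
                                n , _ = split-or (trans (sym clN) N0) in
          distant (+ 2) (+ 1) (pyramid-at (I₂ + + 1) j (+ 2) (+ 1) (U.farʳ e) (sign-false {V.left} {v j} {v J} V.distˡ s)) (lower (m≤ zSE) (rightwards j)) (3≡ m) q0
        , distant (+ 2) (+ 0) (pyramid-at (I₂ + + 1) J (+ 2) (+ 0) (U.farʳ e) (+0 (v J))) (lower′ zE (rightwards J)) refl q0
        , distant (+ 2) (+ 1) (pyramid-at (I₂ + + 1) J₂ (+ 2) (+ 1) (U.farʳ e) (sign-false {V.right} {v J₂} {v J} V.distʳ n)) (lower (m≤ zNE) (rightwards J₂)) (3≡ m) q0
      ; farS = λ S0 W0 E0 → let s , q0 = split-or (trans (sym clS) S0)
                                w , _ = split-or (trans (sym clW) W0)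
                                e , _ = split-or (trans (sym clE) E0) in
          distant (+ 1) (+ 2) (pyramid-at i (j - + 1) (+ 1) (+ 2) (sign-false {U.left} {u i} {u I} U.distˡ w) (V.farˡ s)) (lower (m≤ zSW) (downwards i)) (3≡ m) q0
        , distant (+ 0) (+ 2) (pyramid-at I (j - + 1) (+ 0) (+ 2) (+0 (u I)) (V.farˡ s)) (lower′ zS (downwards I)) refl q0
        , distant (+ 1) (+ 2) (pyramid-at I₂ (j - + 1) (+ 1) (+ 2) (sign-false {U.right} {u I₂} {u I} U.distʳ e) (V.farˡ s)) (lower (m≤ zSE) (downwards I₂)) (3≡ m) q0
      ; farN = λ N0 W0 E0 → let n , q0 = split-or (trans (sym clN) N0)
                                w , _ = split-or (trans (sym clW) W0)
                                e , _ = split-or (trans (sym clE) E0) in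
          distant (+ 1) (+ 2) (pyramid-at i (J₂ + + 1) (+ 1) (+ 2) (sign-false {U.left} {u i} {u I} U.distˡ w) (V.farʳ n)) (lower (m≤ zNW) (upwards i)) (3≡ m) q0
        , distant (+ 0) (+ 2) (pyramid-at I (J₂ + + 1) (+ 0) (+ 2) (+0 (u I)) (V.farʳ n)) (lower′ zN (upwards I)) refl q0
        , distant (+ 1) (+ 2) (pyramid-at I₂ (J₂ + + 1) (+ 1) (+ 2) (sign-false {U.right} {u I₂} {u I} U.distʳ e) (V.farʳ n)) (lower (m≤ zNE) (upwards I₂)) (3≡ m) q0
      }
      where
      clW : isClosed h (i , J) ≡ U.left ∨ q
      clW = side U.left zW pW
      clE : isClosed h (I₂ , J) ≡ U.right ∨ q
      clE = side U.right zE pE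
      clS : isClosed h (I , j) ≡ V.left ∨ q
      clS = side V.left zS pS
      clN : isClosed h (I , J₂) ≡ V.right ∨ q
      clN = side V.right zN pN
      deMorgan : ∀ w e r → not (w ∨ e) ∧ not r ≡ not (w ∨ e ∨ r)
      deMorgan true  e r = refl
      deMorgan false true r = refl
      deMorgan false false r = refl

-- Induction on the height function

positivePart : ℤ → ℕ
positivePart (+ n)    = n
positivePart -[1+ n ] = 0

positivePart-decreases : ∀ y z → y ℤ.< z → positivePart (z - (y + + 2)) ℕ.< positivePart (z - y)
positivePart-decreases y z y<z = subst (λ w → positivePart w ℕ.< positivePart (z - y)) (sym (rearrange y z))
    (decreases (z - y) (subst (ℤ._< z - y) (ℤ.+-inverseʳ y) (ℤ.+-monoˡ-< (- y) y<z)))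
  where
  rearrange : ∀ y z → z - (y + + 2) ≡ z - y + - + 2
  rearrange = solve-∀
  decreases : ∀ w → + 0 ℤ.< w → positivePart (w + - + 2) ℕ.< positivePart w
  decreases (+ 0) (ℤ.+<+ ())
  decreases (+ 1) _ = ℕ.s≤s ℕ.z≤n
  decreases (+ ℕ.suc (ℕ.suc n)) _ = ℕ.n≤1+n (ℕ.suc n)

Even-+2 : ∀ z {w} → w ≡ z + + 2 → Even z → Even w
Even-+2 z refl even = Signed.∣⇒∣ᵤ (Signed.∣m∣n⇒∣m+n (Signed.∣ᵤ⇒∣ {+ 2} {z} even) (Signed.∣-refl {+ 2}))

-- Meant for the apex: parity excludes a gap of one, so raising the apex by 2 does not overshoot
-- `n₀`.
Even-gap : ∀ y z s → Even (y - s) → Even (z - s) → y ℤ.< z → y + + 2 ℤ.≤ z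
Even-gap y z s ey ez y<z with z - y in eq | subst Even (rearrange y z s) difference
  where
  rearrange : ∀ y z s → z - s - (y - s) ≡ z - y
  rearrange = solve-∀
  difference : Even (z - s - (y - s))
  difference = Signed.∣⇒∣ᵤ (Signed.∣m∣n⇒∣m-n (Signed.∣ᵤ⇒∣ {+ 2} {z - s} ez) (Signed.∣ᵤ⇒∣ {+ 2} {y - s} ey))
... | + 0 | _ = ⊥-elim (ℤ.<-irrefl (sym (ℤ.i-j≡0⇒i≡j z y eq)) y<z)
... | + 1 | e = ⊥-elim (2∤1 (ℕ.∣⇒≤ e))
  where
  import Data.Nat.Divisibility as ℕ
  2∤1 : ¬ (2 ℕ.≤ 1)
  2∤1 (ℕ.s≤s ())
... | + ℕ.suc (ℕ.suc n) | _ = subst (y + + 2 ℤ.≤_) (back y z) (ℤ.+-monoʳ-≤ y (subst (+ 2 ℤ.≤_) (sym eq) (ℤ.+≤+ (ℕ.s≤s (ℕ.s≤s ℕ.z≤n)))))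
  where
  back : ∀ y z → y + (z - y) ≡ z
  back = solve-∀
... | -[1+ n ] | _ = ⊥-elim (ℤ.<⇒≱ y<z (ℤ.i-j≤0⇒i≤j (subst (ℤ._≤ + 0) (sym eq) ℤ.-≤+)))

-- Edges outside the graph make an assignment inadmissible

conjunction-false : ∀ a b c d {e} → e ≡ false → a ∧ b ∧ c ∧ d ∧ e ≡ false
conjunction-false false b c d eq = refl
conjunction-false true false c d eq = refl
conjunction-false true true false d eq = refl
conjunction-false true true true false eq = refl
conjunction-false true true true true eq = eq

admissible-s : ∀ k q00 q10 q01 q11 e n w d → q00 ∨ (q10 ∨ false) ≡ false → admissible k q00 q10 q01 q11 true e n w d ≡ false
admissible-s k false false q01 q11 e n w d refl = refl

admissible-w : ∀ k q00 q10 q01 q11 s e n d → q00 ∨ (q01 ∨ false) ≡ false → admissible k q00 q10 q01 q11 s e n true d ≡ false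
admissible-w k false q10 false q11 s e n d refl = last (s ⇒ q10) (e ⇒ q10 ∨ q11) (n ⇒ q11)
  where
  last : ∀ a b c → a ∧ b ∧ c ∧ false ≡ false
  last false b c = refl
  last true false c = refl
  last true true false = refl
  last true true true = refl

neither : ∀ q q′ {b} → q ∨ (q′ ∨ false) ≡ false → (true ⇒ q ∨ q′) ∧ b ≡ false
neither false false refl = refl

module Vanishing {c ℓ} (S : Semifield c ℓ) (a b cc d : ℤ → ℤ → Semifield.Carrier S)
                 (f : ℤ → ℤ → ℤ → Semifield.Carrier S) (n₀ i₀ j₀ : ℤ) where
  open Semifield S
  open SemifieldProperties S
  open Cone n₀ i₀ j₀
  open Degrees n₀ i₀ j₀
  open PartitionFunction S a b cc d f n₀ i₀ j₀

  ∏-0 : ∀ {a} {A : Set a} {L : List A} {z} → z ∈ L → ∀ g → g z ≡ nothing → ∏ L g ≋ nothing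
  ∏-0 (here refl) g eq rewrite eq = ≋-refl
  ∏-0 {L = y ∷ L} (there z∈) g eq = ≋-trans (*-congˡ {g y} (∏-0 z∈ g eq)) (zeroʳ _)

  horizontal-inadmissible : ∀ h i j {σ} → σ (hE i j) ≡ true → inGraph h (hE i j) ≡ false →
                            ∀ t → admissibleBlock h (i , j) σ t ≡ false
  horizontal-inadmissible h i j {σ} σe out t rewrite σe =
    admissible-s (kind h i j) (isClosed h (i , j)) (isClosed h (i + + 1 , j)) (isClosed h (i , j + + 1)) (isClosed h (i + + 1 , j + + 1))
      (σ (vE (i + + 1) j)) (σ (hE i (j + + 1))) (σ (vE i j)) t out

  vertical-inadmissible : ∀ h i j {σ} → σ (vE i j) ≡ true → inGraph h (vE i j) ≡ false →
                          ∀ t → admissibleBlock h (i , j) σ t ≡ false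
  vertical-inadmissible h i j {σ} σe out t rewrite σe =
    admissible-w (kind h i j) (isClosed h (i , j)) (isClosed h (i + + 1 , j)) (isClosed h (i , j + + 1)) (isClosed h (i + + 1 , j + + 1))
      (σ (hE i j)) (σ (vE (i + + 1) j)) (σ (hE i (j + + 1))) t out

  diagonal-inadmissible : ∀ h i j σ → inGraph h (dE i j) ≡ false → admissibleBlock h (i , j) σ true ≡ false
  diagonal-inadmissible h i j σ out with kind h i j
  ... | cross = conjunction-false (σ (hE i j) ⇒ _) (σ (vE (i + + 1) j) ⇒ _) (σ (hE i (j + + 1)) ⇒ _) (σ (vE i j) ⇒ _) refl
  ... | wrenchMain = conjunction-false (σ (hE i j) ⇒ _) (σ (vE (i + + 1) j) ⇒ _) (σ (hE i (j + + 1)) ⇒ _) (σ (vE i j) ⇒ _)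
          (neither (isClosed h (i , j)) (isClosed h (i + + 1 , j + + 1)) out)
  ... | wrenchAnti = conjunction-false (σ (hE i j) ⇒ _) (σ (vE (i + + 1) j) ⇒ _) (σ (hE i (j + + 1)) ⇒ _) (σ (vE i j) ⇒ _)
          (neither (isClosed h (i + + 1 , j)) (isClosed h (i , j + + 1)) out)

  side-vanishes : ∀ h B σ {e} → e ∈ sides B → σ e ≡ true → inGraph h e ≡ false → ∏ B (blockWeight h σ) ≋ nothing
  side-vanishes h B σ e∈ σe out with ∈-++⁻ (map horizontal B) e∈
  ... | inj₁ e∈h with ∈-map⁻ horizontal e∈h
  ...   | (i , j) , F∈ , refl = ∏-0 F∈ (blockWeight h σ) (viaDiagonal-≡ refl (horizontal-inadmissible h i j {σ} σe out))
  side-vanishes h B σ e∈ σe out | inj₂ e∈v with ∈-map⁻ vertical e∈v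
  ...   | (i , j) , F∈ , refl = ∏-0 F∈ (blockWeight h σ) (viaDiagonal-≡ refl (vertical-inadmissible h i j {σ} σe out))

-- Raising closed faces until none is left

module Induct {c ℓ} (S : Semifield c ℓ) (h₀ : ℤ → ℤ → ℤ) (x₀ a b cc d : ℤ → ℤ → Semifield.Carrier S)
              (f : ℤ → ℤ → ℤ → Semifield.Carrier S) (recurrence : OctahedronRecurrence S h₀ x₀ a b cc d f)
              (n₀ i₀ j₀ : ℤ) (B : List Face) (uB : Unique B) where
  open Semifield S
  open SF S
  open SemifieldProperties S
  open FlipAlgebra S
  open Cone n₀ i₀ j₀
  open Degrees n₀ i₀ j₀
  open PartitionFunction S a b cc d f n₀ i₀ j₀
  open Constants S a b cc d f n₀ i₀ j₀
  open Geometry n₀ i₀ j₀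
  open Vanishing S a b cc d f n₀ i₀ j₀
  module ℕ∑ = Product ℕ.+-0-commutativeMonoid

  -- What every height function reached by moves satisfies. `above` keeps the recurrence applicable
  -- and the closed faces inside the box chosen for `h₀`; `below` pins the apex to `n₀` at the end;
  -- parity prevents overshooting.
  record Good (h : ℤ → ℤ → ℤ) : Set where
    field
      adjacent-heights : Adjacent h
      parity : ∀ i j → Even (h i j - (i + j))
      above  : ∀ i j → h₀ i j ℤ.≤ h i j
      below  : h i₀ j₀ ℤ.≤ n₀

  -- The owners of the four blocks around the raised face, together with the five faces whose
  -- factors in `𝒞` may change.
  neighbourhood : ℤ → ℤ → List Face
  neighbourhood i j = (i , j) ∷ (i + + 1 , j + + 1) ∷ (i , j + + 1) ∷ (i + + 1 + + 1 , j + + 1) ∷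
                      (i + + 1 , j) ∷ (i + + 1 , j + + 1 + + 1) ∷ []

  measure : (ℤ → ℤ → ℤ) → ℕ
  measure h = ℕ∑.∏ B λ { (i , j) → positivePart (pyramid i j - h i j) }

  data Search (h : ℤ → ℤ → ℤ) (L : List Face) : Set where
    none  : (∀ {i j} → (i , j) ∈ L → ¬ (h i j ℤ.< pyramid i j)) → Search h L
    least : ∀ i j → (i , j) ∈ L → h i j ℤ.< pyramid i j →
            (∀ {k l} → (k , l) ∈ L → h k l ℤ.< pyramid k l → h i j ℤ.≤ h k l) → Search h L

  search : ∀ h L → Search h L
  search h [] = none λ ()
  search h ((i , j) ∷ L) with search h L | h i j ℤ.<? pyramid i j
  ... | none p | yes lt = least i j (here refl) lt λ
          { (here refl) _ → ℤ.≤-refl ; (there G∈) lt′ → ⊥-elim (p G∈ lt′) }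
  ... | none p | no ≮ = none λ { (here refl) → ≮ ; (there G∈) → p G∈ }
  ... | least i′ j′ G∈ lt p | no ≮ = least i′ j′ (there G∈) lt λ
          { (here refl) lt′ → ⊥-elim (≮ lt′) ; (there G∈) lt′ → p G∈ lt′ }
  ... | least i′ j′ G∈ lt p | yes lt₁ with h i j ℤ.≤? h i′ j′
  ...   | yes le = least i j (here refl) lt₁ λ
          { (here refl) _ → ℤ.≤-refl ; (there G∈) lt′ → ℤ.≤-trans le (p G∈ lt′) }
  ...   | no ≰ = least i′ j′ (there G∈) lt λ
          { (here refl) _ → ℤ.<⇒≤ (ℤ.≰⇒> ≰) ; (there G∈) lt′ → p G∈ lt′ }

  module _ (apex∈B : (i₀ , j₀) ∈ B) (apexInL : InL n₀ i₀ j₀)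
           (boxed : ∀ i j → h₀ (i + + 1) (j + + 1) ℤ.< pyramid (i + + 1) (j + + 1) → All (_∈ B) (neighbourhood i j)) where

    -- Moves only raise heights, so a face that is closed now was closed for `h₀`, and the box
    -- contains those faces.
    closed∈B : ∀ {h} → Good h → ∀ k l → h k l ℤ.< pyramid k l → (k , l) ∈ B
    closed∈B {h} good k l lt = subst (_∈ B) (cong₂ _,_ (-1+1 k) (-1+1 l))
        (All.lookup (boxed (k - + 1) (l - + 1) below-pyramid) (there (here refl)))
      where
      open Good good
      below-pyramid : h₀ (k - + 1 + + 1) (l - + 1 + + 1) ℤ.< pyramid (k - + 1 + + 1) (l - + 1 + + 1)
      below-pyramid rewrite -1+1 k | -1+1 l = ℤ.≤-<-trans (above k l) lt

    module Step {h : ℤ → ℤ → ℤ} (good : Good h) (i j : ℤ) (closedF : h (i + + 1) (j + + 1) ℤ.< pyramid (i + + 1) (j + + 1))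
                (minimal : ∀ k l → h k l ℤ.< pyramid k l → h (i + + 1) (j + + 1) ℤ.≤ h k l) where
      open Good good
      open LocalMinimum h adjacent-heights i j closedF minimal
      open Adjacent adjacent-heights
      open Raise raised hiding (raised)

      h′ : ℤ → ℤ → ℤ
      h′ = raise h I J

      above-old : ∀ k l → h k l ℤ.≤ h′ k l
      above-old k l with k ℤ.≟ I | l ℤ.≟ J
      ... | yes refl | yes refl = ℤ.i≤i+j m (+ 2)
      ... | yes _ | no _ = ℤ.≤-refl
      ... | no _ | _ = ℤ.≤-refl

      difference₊ : ∀ {y z} → y ≡ m + + 2 → z ≡ m + + 1 → ∣ y - z ∣ ≡ 1
      difference₊ refl refl = cong ∣_∣ (arith m)
        where arith : ∀ z → z + + 2 - (z + + 1) ≡ + 1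
              arith = solve-∀
      difference₋ : ∀ {y z} → y ≡ m + + 1 → z ≡ m + + 2 → ∣ y - z ∣ ≡ 1
      difference₋ refl refl = cong ∣_∣ (arith m)
        where arith : ∀ z → z + + 1 - (z + + 2) ≡ - + 1
              arith = solve-∀

      good′ : Good h′
      good′ = record
        { adjacent-heights = record { adjᵢ = adjᵢ′ ; adjⱼ = adjⱼ′ } ; parity = parity′
        ; above = λ k l → ℤ.≤-trans (above k l) (above-old k l) ; below = below′ }
        where
        adjᵢ′ : ∀ k l → ∣ h′ (k + + 1) l - h′ k l ∣ ≡ 1
        adjᵢ′ k l with (k , l) ≟F (I , J) | (k + + 1 , l) ≟F (I , J)
        ... | yes refl | _ = difference₋ (trans (same I₂ J off-I₂) zE) (raise-at h I J)
        ... | no ne | yes eq = difference₊ (trans (cong₂ h′ (cong proj₁ eq) (cong proj₂ eq)) (raise-at h I J))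
                (trans (same k l ne) (trans (cong₂ h (+1-injective (cong proj₁ eq)) (cong proj₂ eq)) zW))
        ... | no ne | no ne′ = trans (cong₂ (λ y z → ∣ y - z ∣) (same (k + + 1) l ne′) (same k l ne)) (adjᵢ k l)
        adjⱼ′ : ∀ k l → ∣ h′ k (l + + 1) - h′ k l ∣ ≡ 1
        adjⱼ′ k l with (k , l) ≟F (I , J) | (k , l + + 1) ≟F (I , J)
        ... | yes refl | _ = difference₋ (trans (same I J₂ off-J₂) zN) (raise-at h I J)
        ... | no ne | yes eq = difference₊ (trans (cong₂ h′ (cong proj₁ eq) (cong proj₂ eq)) (raise-at h I J))
                (trans (same k l ne) (trans (cong₂ h (cong proj₁ eq) (+1-injective (cong proj₂ eq))) zS))
        ... | no ne | no ne′ = trans (cong₂ (λ y z → ∣ y - z ∣) (same k (l + + 1) ne′) (same k l ne)) (adjⱼ k l)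
        parity′ : ∀ k l → Even (h′ k l - (k + l))
        parity′ k l with (k , l) ≟F (I , J)
        ... | yes refl = Even-+2 (m - (I + J)) (trans (cong (_- (I + J)) (raise-at h I J)) (arith m (I + J))) (parity I J)
          where arith : ∀ z s → z + + 2 - s ≡ z - s + + 2
                arith = solve-∀
        ... | no ne = subst (λ z → Even (z - (k + l))) (sym (same k l ne)) (parity k l)
        below′ : h′ i₀ j₀ ℤ.≤ n₀
        below′ with (i₀ , j₀) ≟F (I , J)
        ... | no ne = subst (ℤ._≤ n₀) (sym (same i₀ j₀ ne)) below
        -- A closed apex lies below `n₀`, hence by parity at least two below.
        ... | yes refl = subst (ℤ._≤ n₀) (sym (raise-at h I J))
                (Even-gap m n₀ (I + J) (parity I J) apexInL (subst (m ℤ.<_) (pyramid-apex I J) closedF))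
          where
          pyramid-apex : ∀ k l → n₀ - + ∣ k - k ∣ - + ∣ l - l ∣ ≡ n₀
          pyramid-apex k l rewrite ℤ.+-inverseʳ k | ℤ.+-inverseʳ l = trans (ℤ.+-identityʳ _) (ℤ.+-identityʳ n₀)

      neighbours∈B : All (_∈ B) (neighbourhood i j)
      neighbours∈B = boxed i j (ℤ.≤-<-trans (above I J) closedF)

      measure-decreases : measure h′ ℕ.< measure h
      measure-decreases with split-⊆ ((I , J) ∷ []) ([] ∷ []) (λ { (here refl) → All.lookup neighbours∈B (there (here refl)) })
      ... | B′ , B↭ = subst₂ ℕ._<_ (sym (ℕ∑.∏-↭ (gap h′) B↭))
              (sym (trans (ℕ∑.∏-↭ (gap h) B↭) (cong (gap h (I , J) ℕ.+_) (ℕ∑.∏-cong B′ elsewhere))))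
              (ℕ.+-monoˡ-< (ℕ∑.∏ B′ (gap h′)) gap-decreases)
        where
        gap : (ℤ → ℤ → ℤ) → Face → ℕ
        gap h = λ { (i , j) → positivePart (pyramid i j - h i j) }
        elsewhere : ∀ {G} → G ∈ B′ → gap h G ≡ gap h′ G
        elsewhere {k , l} G∈ = cong (λ z → positivePart (pyramid k l - z)) (sym (same k l
          λ { refl → unique-head (Unique-resp-↭ B↭ uB) G∈ }))
        gap-decreases : gap h′ (I , J) ℕ.< gap h (I , J)
        gap-decreases = subst (λ z → positivePart (pyramid I J - z) ℕ.< gap h (I , J)) (sym (raise-at h I J))
          (positivePart-decreases m (pyramid I J) closedF)

      -- At height `m + 2` the recurrence refers to height `m + 1` at the four neighbours and to `m`
      -- at the face itself, which are just the current heights. It applies because `h₀` is at most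
      -- `m` there.
      octahedron : x h′ (I , J) * x h (I , J) ≈
        a (I + (m + + 2) - + 1) J * cc (I - (m + + 2) + + 1) J * x h (I , J₂) * x h (I , j) +ₛ
        b I (J + (m + + 2) - + 1) * d I (J - (m + + 2) + + 1) * x h (I₂ , J) * x h (i , J)
      octahedron = ≈-trans (∙-congʳ (≈-trans (≈-reflexive (cong (λ z → f z I J) (raise-at h I J)))
          (OctahedronRecurrence.recur recurrence (m + + 2) I J inU)))
        (≈-trans (∙-congʳ (∙-cong
           (+ₛ.∙-cong (∙-cong (∙-congˡ (value I J₂ zN)) (≈-trans (≈-reflexive (cong (f (m + + 2 - + 1) I) (+1-1 j))) (value I j zS)))
                      (∙-cong (∙-congˡ (value I₂ J zE)) (≈-trans (≈-reflexive (cong (λ k → f (m + + 2 - + 1) k J) (+1-1 i))) (value i J zW))))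
           (⁻¹-cong (≈-reflexive (cong (λ z → f z I J) (two-below m))))))
        (≈-trans (assoc _ _ _) (≈-trans (∙-congˡ (inverseˡ _)) (identityʳ _))))
        where
        one-below : ∀ z → z + + 2 - + 1 ≡ z + + 1
        one-below = solve-∀
        two-below : ∀ z → z + + 2 - + 2 ≡ z
        two-below = solve-∀
        value : ∀ k l → h k l ≡ m + + 1 → f (m + + 2 - + 1) k l ≈ x h (k , l)
        value k l eq = ≈-reflexive (cong (λ z → f z k l) (trans (one-below m) (sym eq)))
        inU : InU h₀ (m + + 2) I J
        inU = Even-+2 (m - (I + J)) (arith m (I + J)) (parity I J) ,
              ℤ.≤-<-trans (above I J) (subst (ℤ._< m + + 2) (ℤ.+-identityʳ m) (ℤ.+-monoʳ-< m (ℤ.+<+ (ℕ.s≤s ℕ.z≤n))))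
          where arith : ∀ z s → z + + 2 - s ≡ z - s + + 2
                arith = solve-∀

      step : just (𝒞 h B) ⊗ Zᴮ h B ≋ just (𝒞 h′ B) ⊗ Zᴮ h′ B
      step = invariance raised position uB (All.lookup neighbours∈B (here refl))
               (λ G∈ → All.lookup neighbours∈B (there G∈)) octahedron

    module Base {h : ℤ → ℤ → ℤ} (good : Good h) (open-everywhere : ∀ i j → isClosed h (i , j) ≡ false) where
      open Good good

      -- An open apex has reached `n₀`, and by `below` it is no higher.
      apex-height : h i₀ j₀ ≡ n₀
      apex-height = ℤ.≤-antisym below (ℤ.≮⇒≥ λ lt → true≢false (trans (sym (<⇒closed h i₀ j₀
          (subst (h i₀ j₀ ℤ.<_) (sym pyramid-apex) lt))) (open-everywhere i₀ j₀)))
        where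
        true≢false : true ≢ false
        true≢false ()
        pyramid-apex : pyramid i₀ j₀ ≡ n₀
        pyramid-apex rewrite ℤ.+-inverseʳ i₀ | ℤ.+-inverseʳ j₀ = trans (ℤ.+-identityʳ _) (ℤ.+-identityʳ n₀)

      not-in-graph : ∀ L → foldr (λ F t → isClosed h F ∨ t) false L ≡ false
      not-in-graph [] = refl
      not-in-graph ((i , j) ∷ L) rewrite open-everywhere i j = not-in-graph L

      no-edges : ∀ L → count (inGraph h) L ≡ 0
      no-edges [] = refl
      no-edges (e ∷ L) rewrite not-in-graph (faces h e) = no-edges L

      exponent-open : ∀ G → exponent h G ≡ + bit (isApex G)
      exponent-open (i , j) rewrite no-edges (boundary h i j) | open-everywhere i j | Bool.∧-identityʳ (isApex (i , j)) =
          trans (ℤ.+-identityˡ _) (ℤ.+-identityʳ _)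

      𝒞-base : 𝒞 h B ≈ f n₀ i₀ j₀
      𝒞-base = ≈-trans (∏ₛ.∏-⊆ {xs = (i₀ , j₀) ∷ []} ([] ∷ []) uB (λ { (here refl) → apex∈B }) elsewhere)
          (≈-trans (identityʳ _) (≈-trans (≈-reflexive (cong (x h (i₀ , j₀) ^ℤ_) (trans (exponent-open (i₀ , j₀)) at-apex)))
            (≈-trans (identityʳ _) (≈-reflexive (cong (λ n → f n i₀ j₀) apex-height)))))
        where
        at-apex : + bit (isApex (i₀ , j₀)) ≡ + 1
        at-apex rewrite dec-true (i₀ ℤ.≟ i₀) refl | dec-true (j₀ ℤ.≟ j₀) refl = refl
        elsewhere : ∀ {G} → G ∈ B → G ∉ (i₀ , j₀) ∷ [] → x h G ^ℤ exponent h G ≈ 1#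
        elsewhere {i , j} _ G∉ = ≈-reflexive (cong (x h (i , j) ^ℤ_) (trans (exponent-open (i , j)) (cong (λ t → + bit t) off)))
          where
          off : isApex (i , j) ≡ false
          off with i ℤ.≟ i₀ | j ℤ.≟ j₀
          ... | yes refl | yes refl = ⊥-elim (G∉ (here refl))
          ... | yes _ | no _ = refl
          ... | no _ | _ = refl

      -- No edge is in the graph, so only the empty assignment survives, and no vertex asks to be
      -- matched.
      Zᴮ-base : Zᴮ h B ≋ just 1#
      Zᴮ-base = ≋-trans (Sum-vanishing (sides B) (sides-unique uB) (configWeight-ext h B) vanish (λ _ → false) (λ _ → refl))
          (≋-trans (*-cong (∏-1 (sides B) {sideWeight h (λ _ → false)} (λ _ → ≋-refl)) (∏-1 B (λ {F} _ → block-1 F))) (*-identityˡ _))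
        where
        vanish : ∀ {e} → e ∈ sides B → ∀ σ → σ e ≡ true → configWeight h B σ ≋ nothing
        vanish {e} e∈ σ σe = ≋-trans (*-congˡ {∏ (sides B) (sideWeight h σ)} (side-vanishes h B σ e∈ σe (not-in-graph (faces h e)))) (zeroʳ _)
        block-1 : ∀ F → blockWeight h (λ _ → false) F ≋ just 1#
        block-1 (i , j) rewrite open-everywhere i j | open-everywhere (i + + 1) j | open-everywhere i (j + + 1)
                              | open-everywhere (i + + 1) (j + + 1) = values (kind h i j)
          where
          values : ∀ k → viaDiagonal (weightOf h (dE i j)) (admissible k false false false false false false false false) ≋ just 1#
          values cross = ≋-refl
          values wrenchMain = ≋-refl
          values wrenchAnti = ≋-refl

    -- `n` is fuel that makes the recursion structural; every move lowers `measure`, so the fuel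
    -- cannot run out while a closed face is left.
    evaluation : ∀ n h → Good h → measure h ℕ.≤ n → just (𝒞 h B) ⊗ Zᴮ h B ≋ just (f n₀ i₀ j₀)
    evaluation n h good bound with search h B
    ... | none all-open = ≋-trans (*-cong (Pointwise.just 𝒞-base) Zᴮ-base) (Pointwise.just (identityʳ _))
      where open Base good (λ i j → ≮⇒open h i j (λ lt → all-open (closed∈B good i j lt) lt))
    ... | least k l _ lt minimal = ≋-trans step (descend n bound)
      where
      -- `Raise` writes the raised face as a successor in both coordinates.
      I-1 = k - + 1
      J-1 = l - + 1
      shifted : h (I-1 + + 1) (J-1 + + 1) ℤ.< pyramid (I-1 + + 1) (J-1 + + 1)
      shifted rewrite -1+1 k | -1+1 l = lt
      minimal′ : ∀ k′ l′ → h k′ l′ ℤ.< pyramid k′ l′ → h (I-1 + + 1) (J-1 + + 1) ℤ.≤ h k′ l′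
      minimal′ k′ l′ lt′ rewrite -1+1 k | -1+1 l = minimal (closed∈B good k′ l′ lt′) lt′
      open Step good I-1 J-1 shifted minimal′
      descend : ∀ n → measure h ℕ.≤ n → just (𝒞 h′ B) ⊗ Zᴮ h′ B ≋ just (f n₀ i₀ j₀)
      descend ℕ.zero    bound = ⊥-elim (ℕ.n≮0 (ℕ.<-≤-trans measure-decreases bound))
      descend (ℕ.suc n) bound = evaluation n h′ good′ (ℕ.≤-pred (ℕ.<-≤-trans measure-decreases bound))

-- Perfect matchings as admissible assignments

-- `ends` read from the vertex: the edges at a vertex, all found in its own block. Tags that do not
-- occur in the kind get no legs.
legs : Kind → Tag → ℤ → ℤ → List Edge
legs cross      centre   i j = hE i j ∷ vE (i + + 1) j ∷ hE i (j + + 1) ∷ vE i j ∷ []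
legs wrenchMain (at c10) i j = hE i j ∷ vE (i + + 1) j ∷ dE i j ∷ []
legs wrenchMain (at c01) i j = vE i j ∷ hE i (j + + 1) ∷ dE i j ∷ []
legs wrenchAnti (at c00) i j = hE i j ∷ vE i j ∷ dE i j ∷ []
legs wrenchAnti (at c11) i j = vE (i + + 1) j ∷ hE i (j + + 1) ∷ dE i j ∷ []
legs _          _        i j = []

tags : Kind → List Tag
tags cross      = centre ∷ []
tags wrenchMain = at c10 ∷ at c01 ∷ []
tags wrenchAnti = at c00 ∷ at c11 ∷ []

isOne : ℕ → Bool
isOne 1 = true
isOne _ = false

isOne⇒≡ : ∀ n → isOne n ≡ true → n ≡ 1
isOne⇒≡ 1 _ = refl

anyᵇ allᵇ : ∀ {a} {A : Set a} → (A → Bool) → List A → Bool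
anyᵇ p = foldr (λ x t → p x ∨ t) false
allᵇ p = foldr (λ x t → p x ∧ t) true

anyᵇ-∈ : ∀ {a} {A : Set a} (p : A → Bool) {L x} → x ∈ L → p x ≡ true → anyᵇ p L ≡ true
anyᵇ-∈ p (here refl) eq rewrite eq = refl
anyᵇ-∈ p {y ∷ L} (there x∈) eq rewrite anyᵇ-∈ p x∈ eq = Bool.∨-zeroʳ (p y)

∈-anyᵇ : ∀ {a} {A : Set a} (p : A → Bool) L → anyᵇ p L ≡ true → ∃[ x ] x ∈ L × p x ≡ true
∈-anyᵇ p (x ∷ L) eq with p x in px
... | true = x , here refl , px
... | false with ∈-anyᵇ p L eq
...   | y , y∈ , py = y , there y∈ , py

allᵇ-∈ : ∀ {a} {A : Set a} (p : A → Bool) {L x} → allᵇ p L ≡ true → x ∈ L → p x ≡ true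
allᵇ-∈ p eq (here refl) = proj₁ (∧-true eq)
allᵇ-∈ p {y ∷ L} eq (there x∈) = allᵇ-∈ p (proj₂ (∧-true {p y} eq)) x∈

∈-allᵇ : ∀ {a} {A : Set a} (p : A → Bool) L → (∀ {x} → x ∈ L → p x ≡ true) → allᵇ p L ≡ true
∈-allᵇ p [] _ = refl
∈-allᵇ p (x ∷ L) eq rewrite eq {x} (here refl) = ∈-allᵇ p L (eq ∘ there)

count-filter : ∀ {a p} {A : Set a} {P : A → Set p} (P? : ∀ x → Dec (P x)) L → length (filter P? L) ≡ count (does ∘ P?) L
count-filter P? [] = refl
count-filter P? (x ∷ L) with does (P? x)
... | true = cong ℕ.suc (count-filter P? L)
... | false = count-filter P? L

count-cong : ∀ {a} {A : Set a} {p p′ : A → Bool} L → (∀ x → p x ≡ p′ x) → count p L ≡ count p′ L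
count-cong [] eq = refl
count-cong (x ∷ L) eq = cong₂ ℕ._+_ (cong bit (eq x)) (count-cong L eq)

module Incidence (h : ℤ → ℤ → ℤ) (n₀ i₀ j₀ : ℤ) where
  open Cone n₀ i₀ j₀
  open Degrees n₀ i₀ j₀
  open Subgraph h n₀ i₀ j₀

  end-s : ∀ i j → vertex i j (meet (kind h i j) c00 c10) ∈ ends h (hE i j)
  end-s i j = there (here refl)
  end-w : ∀ i j → vertex i j (meet (kind h i j) c00 c01) ∈ ends h (vE i j)
  end-w i j = there (here refl)
  end-n : ∀ i j → vertex i j (meet (kind h i j) c01 c11) ∈ ends h (hE i (j + + 1))
  end-n i j = here (cong (λ z → vertex i z (meet (kind h i z) c01 c11)) (sym (+1-1 j)))
  end-e : ∀ i j → vertex i j (meet (kind h i j) c10 c11) ∈ ends h (vE (i + + 1) j)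
  end-e i j = here (cong (λ z → vertex z j (meet (kind h z j) c10 c11)) (sym (+1-1 i)))

  legs⇒ends : ∀ i j t {e} → e ∈ legs (kind h i j) t i j → vertex i j t ∈ ends h e
  -- The four membership proofs are abstracted together with the kind, so that `meet` reduces in
  -- their types.
  legs⇒ends i j t e∈ with kind h i j in eq | end-s i j | end-e i j | end-n i j | end-w i j
  legs⇒ends i j centre (here refl) | cross | s | e | n | w rewrite eq = s
  legs⇒ends i j centre (there (here refl)) | cross | s | e | n | w = e
  legs⇒ends i j centre (there (there (here refl))) | cross | s | e | n | w = n
  legs⇒ends i j centre (there (there (there (here refl)))) | cross | s | e | n | w rewrite eq = w
  legs⇒ends i j (at c10) (here refl) | wrenchMain | s | e | n | w rewrite eq = s
  legs⇒ends i j (at c10) (there (here refl)) | wrenchMain | s | e | n | w = e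
  legs⇒ends i j (at c10) (there (there (here refl))) | wrenchMain | s | e | n | w rewrite eq = here refl
  legs⇒ends i j (at c01) (here refl) | wrenchMain | s | e | n | w rewrite eq = w
  legs⇒ends i j (at c01) (there (here refl)) | wrenchMain | s | e | n | w = n
  legs⇒ends i j (at c01) (there (there (here refl))) | wrenchMain | s | e | n | w rewrite eq = there (here refl)
  legs⇒ends i j (at c00) (here refl) | wrenchAnti | s | e | n | w rewrite eq = s
  legs⇒ends i j (at c00) (there (here refl)) | wrenchAnti | s | e | n | w rewrite eq = w
  legs⇒ends i j (at c00) (there (there (here refl))) | wrenchAnti | s | e | n | w rewrite eq = here refl
  legs⇒ends i j (at c11) (here refl) | wrenchAnti | s | e | n | w = e
  legs⇒ends i j (at c11) (there (here refl)) | wrenchAnti | s | e | n | w = n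
  legs⇒ends i j (at c11) (there (there (here refl))) | wrenchAnti | s | e | n | w rewrite eq = there (here refl)

  s∈legs : ∀ k i j → hE i j ∈ legs k (meet k c00 c10) i j
  s∈legs cross      i j = here refl
  s∈legs wrenchMain i j = here refl
  s∈legs wrenchAnti i j = here refl
  w∈legs : ∀ k i j → vE i j ∈ legs k (meet k c00 c01) i j
  w∈legs cross      i j = there (there (there (here refl)))
  w∈legs wrenchMain i j = here refl
  w∈legs wrenchAnti i j = there (here refl)
  n∈legs : ∀ k i j → hE i (j + + 1) ∈ legs k (meet k c01 c11) i j
  n∈legs cross      i j = there (there (here refl))
  n∈legs wrenchMain i j = there (here refl)
  n∈legs wrenchAnti i j = there (here refl)
  e∈legs : ∀ k i j → vE (i + + 1) j ∈ legs k (meet k c10 c11) i j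
  e∈legs cross      i j = there (here refl)
  e∈legs wrenchMain i j = there (here refl)
  e∈legs wrenchAnti i j = here refl

  ends⇒legs : ∀ e {i j t} → vertex i j t ∈ ends h e → e ∈ legs (kind h i j) t i j
  ends⇒legs (hE i j) (here refl) = subst (λ z → hE i z ∈ legs (kind h i (j - + 1)) (meet (kind h i (j - + 1)) c01 c11) i (j - + 1))
                                     (-1+1 j) (n∈legs (kind h i (j - + 1)) i (j - + 1))
  ends⇒legs (hE i j) (there (here refl)) = s∈legs (kind h i j) i j
  ends⇒legs (vE i j) (here refl) = subst (λ z → vE z j ∈ legs (kind h (i - + 1) j) (meet (kind h (i - + 1) j) c10 c11) (i - + 1) j)
                                     (-1+1 i) (e∈legs (kind h (i - + 1) j) (i - + 1) j)
  ends⇒legs (vE i j) (there (here refl)) = w∈legs (kind h i j) i j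
  ends⇒legs (dE i j) v∈ with kind h i j in eq
  ends⇒legs (dE i j) (here refl) | wrenchMain rewrite eq = there (there (here refl))
  ends⇒legs (dE i j) (there (here refl)) | wrenchMain rewrite eq = there (there (here refl))
  ends⇒legs (dE i j) (here refl) | wrenchAnti rewrite eq = there (there (here refl))
  ends⇒legs (dE i j) (there (here refl)) | wrenchAnti rewrite eq = there (there (here refl))

  legs-unique : ∀ k t i j → Unique (legs k t i j)
  legs-unique cross centre i j = ((λ ()) ∷ (λ eq → z≢z+suc 0 (cong proj₂ (hE-injective eq))) ∷ (λ ()) ∷ []) ∷
      ((λ ()) ∷ (λ eq → z≢z+suc 0 (sym (cong proj₁ (vE-injective eq)))) ∷ []) ∷ ((λ ()) ∷ []) ∷ [] ∷ []
  legs-unique wrenchMain (at c10) i j = ((λ ()) ∷ (λ ()) ∷ []) ∷ ((λ ()) ∷ []) ∷ [] ∷ []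
  legs-unique wrenchMain (at c01) i j = ((λ ()) ∷ (λ ()) ∷ []) ∷ ((λ ()) ∷ []) ∷ [] ∷ []
  legs-unique wrenchAnti (at c00) i j = ((λ ()) ∷ (λ ()) ∷ []) ∷ ((λ ()) ∷ []) ∷ [] ∷ []
  legs-unique wrenchAnti (at c11) i j = ((λ ()) ∷ (λ ()) ∷ []) ∷ ((λ ()) ∷ []) ∷ [] ∷ []
  legs-unique cross (at _) i j = []
  legs-unique wrenchMain centre i j = []
  legs-unique wrenchMain (at c00) i j = []
  legs-unique wrenchMain (at c11) i j = []
  legs-unique wrenchAnti centre i j = []
  legs-unique wrenchAnti (at c10) i j = []
  legs-unique wrenchAnti (at c01) i j = []

  -- A vertex belongs to the graph when one of its legs does, and only then must it be matched.
  vertexOk : (g σ : Edge → Bool) → Kind → ℤ → ℤ → Tag → Bool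
  vertexOk g σ k i j t = anyᵇ g (legs k t i j) ⇒ isOne (count σ (legs k t i j))

  blockEdges : ℤ → ℤ → List Edge
  blockEdges i j = hE i j ∷ vE (i + + 1) j ∷ hE i (j + + 1) ∷ vE i j ∷ dE i j ∷ []

  diagonalClosed : Kind → (q00 q10 q01 q11 : Bool) → Bool
  diagonalClosed cross      q00 q10 q01 q11 = false
  diagonalClosed wrenchMain q00 q10 q01 q11 = q00 ∨ q11
  diagonalClosed wrenchAnti q00 q10 q01 q11 = q10 ∨ q01

  -- Justifies the explicit formula for `admissible` by the definition of a matching: for each kind
  -- it is an identity in nine Boolean variables, four corners and five edges.
  admissible-legs : ∀ k (g σ : Edge → Bool) i j q00 q10 q01 q11 →
    g (hE i j) ≡ q00 ∨ q10 → g (vE (i + + 1) j) ≡ q10 ∨ q11 → g (hE i (j + + 1)) ≡ q01 ∨ q11 → g (vE i j) ≡ q00 ∨ q01 →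
    g (dE i j) ≡ diagonalClosed k q00 q10 q01 q11 →
    admissible k q00 q10 q01 q11 (σ (hE i j)) (σ (vE (i + + 1) j)) (σ (hE i (j + + 1))) (σ (vE i j)) (σ (dE i j)) ≡
    allᵇ (λ e → σ e ⇒ g e) (blockEdges i j) ∧ allᵇ (vertexOk g σ k i j) (tags k)
  admissible-legs cross g σ i j q00 q10 q01 q11 S E N W D rewrite S | E | N | W | D =
    ==⇒≡ _ _ (instantiate 9 (λ { (q00 ∷ q10 ∷ q01 ∷ q11 ∷ s ∷ e ∷ n ∷ w ∷ d ∷ []) →
      let cS = q00 ∨ q10 ; cE = q10 ∨ q11 ; cN = q01 ∨ q11 ; cW = q00 ∨ q01 ; cD = diagonalClosed cross q00 q10 q01 q11 in
      admissible cross q00 q10 q01 q11 s e n w d ==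
      (((s ⇒ cS) ∧ (e ⇒ cE) ∧ (n ⇒ cN) ∧ (w ⇒ cW) ∧ (d ⇒ cD) ∧ true) ∧
       (((cS ∨ (cE ∨ (cN ∨ (cW ∨ false)))) ⇒ isOne (bit s ℕ.+ (bit e ℕ.+ (bit n ℕ.+ (bit w ℕ.+ 0))))) ∧ true)) }) refl
      (q00 ∷ q10 ∷ q01 ∷ q11 ∷ σ (hE i j) ∷ σ (vE (i + + 1) j) ∷ σ (hE i (j + + 1)) ∷ σ (vE i j) ∷ σ (dE i j) ∷ []))
  admissible-legs wrenchMain g σ i j q00 q10 q01 q11 S E N W D rewrite S | E | N | W | D =
    ==⇒≡ _ _ (instantiate 9 (λ { (q00 ∷ q10 ∷ q01 ∷ q11 ∷ s ∷ e ∷ n ∷ w ∷ d ∷ []) →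
      let cS = q00 ∨ q10 ; cE = q10 ∨ q11 ; cN = q01 ∨ q11 ; cW = q00 ∨ q01 ; cD = diagonalClosed wrenchMain q00 q10 q01 q11 in
      admissible wrenchMain q00 q10 q01 q11 s e n w d ==
      (((s ⇒ cS) ∧ (e ⇒ cE) ∧ (n ⇒ cN) ∧ (w ⇒ cW) ∧ (d ⇒ cD) ∧ true) ∧
       (((cS ∨ (cE ∨ (cD ∨ false))) ⇒ isOne (bit s ℕ.+ (bit e ℕ.+ (bit d ℕ.+ 0)))) ∧ (((cW ∨ (cN ∨ (cD ∨ false))) ⇒ isOne (bit w ℕ.+ (bit n ℕ.+ (bit d ℕ.+ 0)))) ∧ true))) }) refl
      (q00 ∷ q10 ∷ q01 ∷ q11 ∷ σ (hE i j) ∷ σ (vE (i + + 1) j) ∷ σ (hE i (j + + 1)) ∷ σ (vE i j) ∷ σ (dE i j) ∷ []))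
  admissible-legs wrenchAnti g σ i j q00 q10 q01 q11 S E N W D rewrite S | E | N | W | D =
    ==⇒≡ _ _ (instantiate 9 (λ { (q00 ∷ q10 ∷ q01 ∷ q11 ∷ s ∷ e ∷ n ∷ w ∷ d ∷ []) →
      let cS = q00 ∨ q10 ; cE = q10 ∨ q11 ; cN = q01 ∨ q11 ; cW = q00 ∨ q01 ; cD = diagonalClosed wrenchAnti q00 q10 q01 q11 in
      admissible wrenchAnti q00 q10 q01 q11 s e n w d ==
      (((s ⇒ cS) ∧ (e ⇒ cE) ∧ (n ⇒ cN) ∧ (w ⇒ cW) ∧ (d ⇒ cD) ∧ true) ∧
       (((cS ∨ (cW ∨ (cD ∨ false))) ⇒ isOne (bit s ℕ.+ (bit w ℕ.+ (bit d ℕ.+ 0)))) ∧ (((cE ∨ (cN ∨ (cD ∨ false))) ⇒ isOne (bit e ℕ.+ (bit n ℕ.+ (bit d ℕ.+ 0)))) ∧ true))) }) refl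
      (q00 ∷ q10 ∷ q01 ∷ q11 ∷ σ (hE i j) ∷ σ (vE (i + + 1) j) ∷ σ (hE i (j + + 1)) ∷ σ (vE i j) ∷ σ (dE i j) ∷ []))

  admissible-vertices : ∀ (σ : Edge → Bool) i j →
    admissible (kind h i j) (isClosed h (i , j)) (isClosed h (i + + 1 , j)) (isClosed h (i , j + + 1)) (isClosed h (i + + 1 , j + + 1))
      (σ (hE i j)) (σ (vE (i + + 1) j)) (σ (hE i (j + + 1))) (σ (vE i j)) (σ (dE i j)) ≡
    allᵇ (λ e → σ e ⇒ inGraph h e) (blockEdges i j) ∧ allᵇ (vertexOk (inGraph h) σ (kind h i j) i j) (tags (kind h i j))
  admissible-vertices σ i j = admissible-legs (kind h i j) (inGraph h) σ i j _ _ _ _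
      (two (i , j) (i + + 1 , j)) (two (i + + 1 , j) (i + + 1 , j + + 1)) (two (i , j + + 1) (i + + 1 , j + + 1)) (two (i , j) (i , j + + 1))
      (diagonals (kind h i j))
    where
    two : ∀ F F′ → isClosed h F ∨ (isClosed h F′ ∨ false) ≡ isClosed h F ∨ isClosed h F′
    two F F′ = cong (isClosed h F ∨_) (Bool.∨-identityʳ (isClosed h F′))
    diagonals : ∀ k → anyᵇ (isClosed h) (diagonalFaces k i j) ≡
      diagonalClosed k (isClosed h (i , j)) (isClosed h (i + + 1 , j)) (isClosed h (i , j + + 1)) (isClosed h (i + + 1 , j + + 1))
    diagonals cross = refl
    diagonals wrenchMain = two (i , j) (i + + 1 , j + + 1)
    diagonals wrenchAnti = two (i + + 1 , j) (i , j + + 1)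

  cornerFace : Corner → ℤ → ℤ → Face
  cornerFace c00 i j = i , j
  cornerFace c10 i j = i + + 1 , j
  cornerFace c01 i j = i , j + + 1
  cornerFace c11 i j = i + + 1 , j + + 1

  diagIf⇒faces : ∀ i j X {e} → e ∈ diagIf h i j X → cornerFace X i j ∈ faces h e
  diagIf⇒faces i j X e∈ with kind h i j in eq
  diagIf⇒faces i j c00 (here refl) | wrenchMain rewrite eq = here refl
  diagIf⇒faces i j c11 (here refl) | wrenchMain rewrite eq = there (here refl)
  diagIf⇒faces i j c10 (here refl) | wrenchAnti rewrite eq = here refl
  diagIf⇒faces i j c01 (here refl) | wrenchAnti rewrite eq = there (here refl)

  boundary⇒faces : ∀ e k l → e ∈ boundary h k l → (k , l) ∈ faces h e
  boundary⇒faces _ k l (here refl) = there (here (cong (_, l) (sym (-1+1 k))))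
  boundary⇒faces _ k l (there (here refl)) = here refl
  boundary⇒faces _ k l (there (there (here refl))) = there (here (cong (k ,_) (sym (-1+1 l))))
  boundary⇒faces _ k l (there (there (there (here refl)))) = here refl
  boundary⇒faces e k l (there (there (there (there e∈)))) with ∈-++⁻ (diagIf h k l c00) e∈
  ... | inj₁ e∈ = diagIf⇒faces k l c00 e∈
  ... | inj₂ e∈ with ∈-++⁻ (diagIf h (k - + 1) l c10) e∈
  ...   | inj₁ e∈ = subst (λ z → (z , l) ∈ faces h e) (-1+1 k) (diagIf⇒faces (k - + 1) l c10 e∈)
  ...   | inj₂ e∈ with ∈-++⁻ (diagIf h k (l - + 1) c01) e∈
  ...     | inj₁ e∈ = subst (λ z → (k , z) ∈ faces h e) (-1+1 l) (diagIf⇒faces k (l - + 1) c01 e∈)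
  ...     | inj₂ e∈ = subst₂ (λ z w → (z , w) ∈ faces h e) (-1+1 k) (-1+1 l) (diagIf⇒faces (k - + 1) (l - + 1) c11 e∈)

  private
    diagIf∈ : ∀ i j X → inEqualPair (kind h i j) X ≡ true → dE i j ∈ diagIf h i j X
    diagIf∈ i j X eq rewrite eq = here refl

  faces⇒boundary : ∀ e k l → (k , l) ∈ faces h e → e ∈ boundary h k l
  faces⇒boundary (hE i j) k l (here refl) = there (here refl)
  faces⇒boundary (hE i j) k l (there (here refl)) = here (cong (λ z → hE z j) (sym (+1-1 i)))
  faces⇒boundary (vE i j) k l (here refl) = there (there (there (here refl)))
  faces⇒boundary (vE i j) k l (there (here refl)) = there (there (here (cong (vE i) (sym (+1-1 j)))))
  faces⇒boundary (dE i j) k l F∈ with kind h i j in eq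
  faces⇒boundary (dE i j) k l (here refl) | wrenchMain = there (there (there (there
    (∈-++⁺ˡ (diagIf∈ i j c00 (cong (λ z → inEqualPair z c00) eq))))))
  faces⇒boundary (dE i j) k l (there (here refl)) | wrenchMain = there (there (there (there
    (∈-++⁺ʳ (diagIf h k l c00) (∈-++⁺ʳ (diagIf h (k - + 1) l c10) (∈-++⁺ʳ (diagIf h k (l - + 1) c01)
      (subst₂ (λ z w → dE i j ∈ diagIf h z w c11) (sym (+1-1 i)) (sym (+1-1 j))
        (diagIf∈ i j c11 (cong (λ z → inEqualPair z c11) eq)))))))))
  faces⇒boundary (dE i j) k l (here refl) | wrenchAnti = there (there (there (there
    (∈-++⁺ʳ (diagIf h k l c00) (∈-++⁺ˡ
      (subst (λ z → dE i j ∈ diagIf h z j c10) (sym (+1-1 i)) (diagIf∈ i j c10 (cong (λ z → inEqualPair z c10) eq))))))))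
  faces⇒boundary (dE i j) k l (there (here refl)) | wrenchAnti = there (there (there (there
    (∈-++⁺ʳ (diagIf h k l c00) (∈-++⁺ʳ (diagIf h (k - + 1) l c10) (∈-++⁺ˡ
      (subst (λ z → dE i j ∈ diagIf h i z c01) (sym (+1-1 j)) (diagIf∈ i j c01 (cong (λ z → inEqualPair z c01) eq)))))))))

  closed⇒true : ∀ F → ClosedFace F → isClosed h F ≡ true
  closed⇒true F = dec-true (closed? F)

  true⇒closed : ∀ F → isClosed h F ≡ true → ClosedFace F
  true⇒closed F eq with closed? F
  ... | yes p = p
  true⇒closed F () | no _

  inGraph⇒EdgeOfG : ∀ e → inGraph h e ≡ true → EdgeOfG e
  inGraph⇒EdgeOfG e eq with ∈-anyᵇ (isClosed h) (faces h e) eq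
  ... | (k , l) , F∈ , cl = isEdge e F∈ , (k , l) , true⇒closed (k , l) cl , faces⇒boundary e k l F∈
    where
    isEdge : ∀ e {F} → F ∈ faces h e → IsEdge𝒢 h e
    isEdge (hE i j) _ = _
    isEdge (vE i j) _ = _
    isEdge (dE i j) F∈ eq rewrite eq with () ← F∈

  EdgeOfG⇒inGraph : ∀ e → EdgeOfG e → inGraph h e ≡ true
  EdgeOfG⇒inGraph e (_ , (k , l) , cl , e∈) = anyᵇ-∈ (isClosed h) (boundary⇒faces e k l e∈) (closed⇒true (k , l) cl)

  leg⇒tag : ∀ k t i j {e} → e ∈ legs k t i j → t ∈ tags k
  leg⇒tag cross centre i j _ = here refl
  leg⇒tag wrenchMain (at c10) i j _ = here refl
  leg⇒tag wrenchMain (at c01) i j _ = there (here refl)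
  leg⇒tag wrenchAnti (at c00) i j _ = here refl
  leg⇒tag wrenchAnti (at c11) i j _ = there (here refl)

  diagIf-dE : ∀ i j X {e} → e ∈ diagIf h i j X → e ≡ dE i j
  diagIf-dE i j X e∈ with inEqualPair (kind h i j) X
  diagIf-dE i j X (here refl) | true = refl

  -- `α` counts entries of this list; to count edges of a matching it must not repeat any. The four
  -- possible diagonals belong to different blocks.
  boundary-unique : ∀ k l → Unique (boundary h k l)
  boundary-unique k l =
      ((λ eq → z-1≢z k (cong proj₁ (hE-injective eq))) ∷ (λ ()) ∷ (λ ()) ∷ notDiagonal λ ()) ∷
      ((λ ()) ∷ (λ ()) ∷ notDiagonal λ ()) ∷
      ((λ eq → z-1≢z l (cong proj₂ (vE-injective eq))) ∷ notDiagonal λ ()) ∷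
      notDiagonal (λ ()) ∷
      Unique.++⁺ (one k l c00) (Unique.++⁺ (one k⁻ l c10) (Unique.++⁺ (one k l⁻ c01) (one k⁻ l⁻ c11)
          (λ { (m , m′) → z-1≢z k (sym (cong proj₁ (same-place k l⁻ c01 k⁻ l⁻ c11 m m′))) }))
        (λ { (m , m′) → [ (λ m″ → z-1≢z l (sym (cong proj₂ (same-place k⁻ l c10 k l⁻ c01 m m″)))) ,
                          (λ m″ → z-1≢z l (sym (cong proj₂ (same-place k⁻ l c10 k⁻ l⁻ c11 m m″)))) ]′ (∈-++⁻ (diagIf h k l⁻ c01) m′) }))
        λ { (m , m′) → [ (λ m″ → z-1≢z k (sym (cong proj₁ (same-place k l c00 k⁻ l c10 m m″)))) ,
                         (λ m″ → [ (λ m‴ → z-1≢z l (sym (cong proj₂ (same-place k l c00 k l⁻ c01 m m‴)))) ,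
                                   (λ m‴ → z-1≢z l (sym (cong proj₂ (same-place k l c00 k⁻ l⁻ c11 m m‴)))) ]′
                                 (∈-++⁻ (diagIf h k l⁻ c01) m″)) ]′ (∈-++⁻ (diagIf h k⁻ l c10) m′) }
    where
    k⁻ = k - + 1
    l⁻ = l - + 1
    z-1≢z : ∀ z → z - + 1 ≢ z
    z-1≢z z eq = z≢z+suc 0 (trans eq (sym (-1+1 z)))
    same-place : ∀ i j X i′ j′ X′ {e} → e ∈ diagIf h i j X → e ∈ diagIf h i′ j′ X′ → (i , j) ≡ (i′ , j′)
    same-place i j X i′ j′ X′ m m′ = dE-injective (trans (sym (diagIf-dE i j X m)) (diagIf-dE i′ j′ X′ m′))
    one : ∀ i j X → Unique (diagIf h i j X)
    one i j X with inEqualPair (kind h i j) X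
    ... | true = [] ∷ []
    ... | false = []
    allDiagonals : ∀ {e} → e ∈ diagIf h k l c00 ++ diagIf h k⁻ l c10 ++ diagIf h k l⁻ c01 ++ diagIf h k⁻ l⁻ c11 →
                   ∃[ i ] ∃[ j ] e ≡ dE i j
    allDiagonals m with ∈-++⁻ (diagIf h k l c00) m
    ... | inj₁ m = _ , _ , diagIf-dE k l c00 m
    ... | inj₂ m with ∈-++⁻ (diagIf h k⁻ l c10) m
    ...   | inj₁ m = _ , _ , diagIf-dE k⁻ l c10 m
    ...   | inj₂ m with ∈-++⁻ (diagIf h k l⁻ c01) m
    ...     | inj₁ m = _ , _ , diagIf-dE k l⁻ c01 m
    ...     | inj₂ m = _ , _ , diagIf-dE k⁻ l⁻ c11 m
    notDiagonal : ∀ {e} → (∀ {i j} → e ≢ dE i j) →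
      All (e ≢_) (diagIf h k l c00 ++ diagIf h k⁻ l c10 ++ diagIf h k l⁻ c01 ++ diagIf h k⁻ l⁻ c11)
    notDiagonal ne = All.tabulate λ { m refl → ne (proj₂ (proj₂ (allDiagonals m))) }

  faces-unique : ∀ e → Unique (faces h e)
  faces-unique (hE i j) = ((λ eq → z≢z+suc 0 (cong proj₁ eq)) ∷ []) ∷ [] ∷ []
  faces-unique (vE i j) = ((λ eq → z≢z+suc 0 (cong proj₂ eq)) ∷ []) ∷ [] ∷ []
  faces-unique (dE i j) with kind h i j
  ... | cross = []
  ... | wrenchMain = ((λ eq → z≢z+suc 0 (cong proj₁ eq)) ∷ []) ∷ [] ∷ []
  ... | wrenchAnti = ((λ eq → z≢z+suc 0 (sym (cong proj₁ eq))) ∷ []) ∷ [] ∷ []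

  module Matchings (es : List Edge) (∈es⇔ : ∀ e → (e ∈ es) ⇔ EdgeOfG e) where
    open WithEdges es

    ∈es⇒inGraph : ∀ {e} → e ∈ es → inGraph h e ≡ true
    ∈es⇒inGraph {e} e∈ = EdgeOfG⇒inGraph e (Equivalence.to (∈es⇔ e) e∈)

    inGraph⇒∈es : ∀ {e} → inGraph h e ≡ true → e ∈ es
    inGraph⇒∈es {e} eq = Equivalence.from (∈es⇔ e) (inGraph⇒EdgeOfG e eq)

    subsets-⊆ : ∀ L {M} → M ∈ subsets L → ∀ {e} → e ∈ M → e ∈ L
    subsets-⊆ [] (here refl) ()
    subsets-⊆ (e ∷ L) M∈ e′∈ with ∈-++⁻ (map (e ∷_) (subsets L)) M∈
    subsets-⊆ (e ∷ L) M∈ e′∈ | inj₁ M∈′ with ∈-map⁻ (e ∷_) M∈′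
    subsets-⊆ (e ∷ L) M∈ (here refl) | inj₁ _ | M′ , M′∈ , refl = here refl
    subsets-⊆ (e ∷ L) M∈ (there e′∈) | inj₁ _ | M′ , M′∈ , refl = there (subsets-⊆ L M′∈ e′∈)
    subsets-⊆ (e ∷ L) M∈ e′∈ | inj₂ M∈′ = there (subsets-⊆ L M∈′ e′∈)

    subsets-unique : ∀ L {M} → Unique L → M ∈ subsets L → Unique M
    subsets-unique [] u (here refl) = []
    subsets-unique (e ∷ L) u M∈ with ∈-++⁻ (map (e ∷_) (subsets L)) M∈
    ... | inj₂ M∈′ = subsets-unique L (unique-++ʳ (e ∷ []) u) M∈′
    ... | inj₁ M∈′ with ∈-map⁻ (e ∷_) M∈′
    ...   | M′ , M′∈ , refl = All.tabulate (λ { e′∈ refl → unique-head u (subsets-⊆ L M′∈ e′∈) }) ∷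
                              subsets-unique L (unique-++ʳ (e ∷ []) u) M′∈

    module _ {M : List Edge} (uM : Unique M) (M⊆ : ∀ {e} → e ∈ M → e ∈ es)
             {σ : Edge → Bool} (σ≡ : ∀ e → σ e ≡ does (e MemE.∈? M)) where

      σ⇒∈ : ∀ e → σ e ≡ true → e ∈ M
      σ⇒∈ e eq with e MemE.∈? M | trans (sym (σ≡ e)) eq
      ... | yes e∈ | _ = e∈

      -- Both sides count the edges of `M` at the vertex, one by filtering `M`, the other by
      -- filtering the legs; the filtered lists are duplicate-free with the same members.
      degree-legs : ∀ i j t → degIn M (vertex i j t) ≡ count σ (legs (kind h i j) t i j)
      degree-legs i j t = trans
        (Perm.↭-length (unique-↭ (Unique.filter⁺ at? uM) (Unique.filter⁺ (MemE._∈? M) (legs-unique (kind h i j) t i j)) to from))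
        (trans (count-filter (MemE._∈? M) L) (count-cong L (λ e → sym (σ≡ e))))
        where
        L = legs (kind h i j) t i j
        at? = λ e → vertex i j t MemV.∈? ends h e
        to : ∀ {e} → e ∈ filter at? M → e ∈ filter (MemE._∈? M) L
        to {e} e∈ with ∈-filter⁻ at? e∈
        ... | e∈M , v∈ = ∈-filter⁺ (MemE._∈? M) (ends⇒legs e v∈) e∈M
        from : ∀ {e} → e ∈ filter (MemE._∈? M) L → e ∈ filter at? M
        from {e} e∈ with ∈-filter⁻ (MemE._∈? M) {xs = L} e∈
        ... | e∈L , e∈M = ∈-filter⁺ at? e∈M (legs⇒ends i j t e∈L)

      matching⇒admissible : IsPerfectMatching M → ∀ i j →
        allᵇ (λ e → σ e ⇒ inGraph h e) (blockEdges i j) ∧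
        allᵇ (vertexOk (inGraph h) σ (kind h i j) i j) (tags (kind h i j)) ≡ true
      matching⇒admissible pm i j = cong₂ _∧_ (∈-allᵇ _ (blockEdges i j) (λ {e} _ → in-graph e)) (∈-allᵇ _ (tags (kind h i j)) (λ {t} _ → one t))
        where
        in-graph : ∀ e → (σ e ⇒ inGraph h e) ≡ true
        in-graph e with σ e in eq
        ... | false = refl
        ... | true = ∈es⇒inGraph (M⊆ (σ⇒∈ e eq))
        one : ∀ t → vertexOk (inGraph h) σ (kind h i j) i j t ≡ true
        one t with anyᵇ (inGraph h) (legs (kind h i j) t i j) in eq
        ... | false = refl
        ... | true with ∈-anyᵇ (inGraph h) (legs (kind h i j) t i j) eq
        ...   | e , e∈ , ine = cong isOne (trans (sym (degree-legs i j t))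
                  (All.lookup (All.lookup pm (inGraph⇒∈es {e} ine)) (legs⇒ends i j t e∈)))

      -- Asks only for the blocks that contain an end of an edge of the graph, so the blocks of a
      -- finite box suffice.
      admissible⇒matching : (∀ {e i j t} → e ∈ es → vertex i j t ∈ ends h e →
          allᵇ (vertexOk (inGraph h) σ (kind h i j) i j) (tags (kind h i j)) ≡ true) → IsPerfectMatching M
      admissible⇒matching ok = All.tabulate λ {e} e∈ → All.tabulate λ {v} v∈ → matched e∈ v v∈
        where
        modusPonens : ∀ {b b′} → b ≡ true → (b ⇒ b′) ≡ true → b′ ≡ true
        modusPonens refl eq = eq
        matched : ∀ {e} → e ∈ es → ∀ v → v ∈ ends h e → degIn M v ≡ 1
        matched {e} e∈ (vertex i j t) v∈ = trans (degree-legs i j t) (isOne⇒≡ _ (modusPonens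
          (anyᵇ-∈ (inGraph h) (ends⇒legs e v∈) (∈es⇒inGraph e∈))
          (allᵇ-∈ _ (ok e∈ v∈) (leg⇒tag (kind h i j) t i j (ends⇒legs e v∈)))))

-- The weight of a perfect matching

count-+ : ∀ {a} {A : Set a} (p p′ p″ : A → Bool) L → (∀ x → bit (p x) ℕ.+ bit (p′ x) ≡ bit (p″ x)) →
          count p L ℕ.+ count p′ L ≡ count p″ L
count-+ p p′ p″ [] eq = refl
count-+ p p′ p″ (x ∷ L) eq = trans (interchange (bit (p x)) (count p L) (bit (p′ x)) (count p′ L))
                               (cong₂ ℕ._+_ (eq x) (count-+ p p′ p″ L eq))
  where open CommutativeSemigroupProperties ℕ.+-commutativeSemigroup using (interchange)

module _ (h : ℤ → ℤ → ℤ) (n₀ i₀ j₀ : ℤ) (es : List Edge) where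
  open Subgraph.WithEdges h n₀ i₀ j₀ es

  -- The numbers `b - a` and `a + b` differ by twice `a`. This separates the degree, which is the
  -- same for all matchings, from the count `α`.
  ceilHalf-difference : ∀ a b → ceilHalf (+ b - + a) ≡ + ⌈ a ℕ.+ b /2⌉ - + a
  ceilHalf-difference ℕ.zero b = trans (cong ceilHalf (ℤ.+-identityʳ (+ b))) (sym (ℤ.+-identityʳ _))
  ceilHalf-difference (ℕ.suc a) ℕ.zero rewrite ℕ.+-identityʳ a = trans
      (arith (+ ⌊ ℕ.suc a /2⌋) (+ ⌈ ℕ.suc a /2⌉))
      (cong (λ n → + ⌈ ℕ.suc a /2⌉ - + n) (ℕ.⌊n/2⌋+⌈n/2⌉≡n (ℕ.suc a)))
    where
    arith : ∀ y z → - y ≡ z - (y + z)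
    arith = solve-∀
  ceilHalf-difference (ℕ.suc a) (ℕ.suc b) rewrite ℕ.+-suc a b = trans (cong ceilHalf (suc-cancel b a))
      (trans (ceilHalf-difference a b) (sym (suc-cancel ⌈ a ℕ.+ b /2⌉ a)))
    where
    suc-cancel : ∀ m n → + ℕ.suc m - + ℕ.suc n ≡ + m - + n
    suc-cancel m n = trans (ℤ.[1+m]⊖[1+n]≡m⊖n m n) (sym (ℤ.m-n≡m⊖n m n))

module MatchingWeights {c ℓ} (S : Semifield c ℓ) (x₀ a b cc d : ℤ → ℤ → Semifield.Carrier S)
    (f : ℤ → ℤ → ℤ → Semifield.Carrier S) (h : ℤ → ℤ → ℤ) (n₀ i₀ j₀ : ℤ)
    (initial : ∀ i j → Semifield._≈_ S (f (h i j) i j) (x₀ i j))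
    (apexClosed : Cone.isClosed n₀ i₀ j₀ h (i₀ , j₀) ≡ true)
    (es : List Edge) (∈es⇔ : ∀ e → (e ∈ es) ⇔ Subgraph.EdgeOfG h n₀ i₀ j₀ e)
    (fs : List Face) (ufs : Unique fs) (∈fs⇔ : ∀ F → (F ∈ fs) ⇔ Subgraph.FaceOfG h n₀ i₀ j₀ F) where
  open Semifield S
  open SF S
  open SemifieldProperties S
  open Cone n₀ i₀ j₀
  open Degrees n₀ i₀ j₀
  open PartitionFunction S a b cc d f n₀ i₀ j₀
  open Constants S a b cc d f n₀ i₀ j₀
  open Incidence h n₀ i₀ j₀
  open Matchings es ∈es⇔
  open Subgraph h n₀ i₀ j₀
  open WithEdges es
  open Weights S x₀ a b cc d fs
  open DecMembership _≟F_ using () renaming (_∈?_ to _∈F?_)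

  -- The apex of the original graph is closed, which makes the apex term of `correction` vanish.
  exponent-closed : ∀ F → exponent h F ≡ + ⌈ degree h F /2⌉ - + bit (isClosed h F)
  exponent-closed F = cong (λ z → + ⌈ degree h F /2⌉ + z)
      (trans (cong (λ t → + bit t - + bit (isClosed h F)) (not-open-apex F)) (ℤ.+-identityˡ (- + bit (isClosed h F))))
    where
    not-open-apex : ∀ F → isApex F ∧ not (isClosed h F) ≡ false
    not-open-apex (i , j) with i ℤ.≟ i₀ | j ℤ.≟ j₀
    ... | yes refl | yes refl = cong not apexClosed
    ... | yes _ | no _ = refl
    ... | no _ | _ = refl

  α+β : ∀ {M} → (∀ {e} → e ∈ M → e ∈ es) → ∀ F → α M F ℕ.+ β M F ≡ degree h F
  α+β {M} M⊆ F = trans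
      (cong₂ ℕ._+_ (count-filter (MemE._∈? M) (bd F)) (count-filter (λ e → (e MemE.∈? es) ×-dec ¬? (e MemE.∈? M)) (bd F)))
      (count-+ (λ e → does (e MemE.∈? M)) (λ e → does ((e MemE.∈? es) ×-dec ¬? (e MemE.∈? M))) (inGraph h) (bd F) bits)
    where
    bits : ∀ e → bit (does (e MemE.∈? M)) ℕ.+ bit (does ((e MemE.∈? es) ×-dec ¬? (e MemE.∈? M))) ≡ bit (inGraph h e)
    bits e with e MemE.∈? M | e MemE.∈? es
    ... | yes e∈M | yes e∈es = cong bit (sym (∈es⇒inGraph e∈es))
    ... | yes e∈M | no e∉es = ⊥-elim (e∉es (M⊆ e∈M))
    ... | no _ | yes e∈es = cong bit (sym (∈es⇒inGraph e∈es))
    ... | no _ | no e∉es with inGraph h e in eq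
    ...   | true = ⊥-elim (e∉es (inGraph⇒∈es {e} eq))
    ...   | false = refl

  ε-exponent : ∀ {M} → (∀ {e} → e ∈ M → e ∈ es) → ∀ F → ε M F ≡ exponent h F + - + α M F
  ε-exponent {M} M⊆ F = trans
      (cong₂ _-_ (trans (ceilHalf-difference h n₀ i₀ j₀ es (α M F) (β M F)) (cong (λ k → + ⌈ k /2⌉ - + α M F) (α+β M⊆ F)))
                 (if-bit (isClosed h F)))
      (trans (arith (+ ⌈ degree h F /2⌉) (+ α M F) (+ bit (isClosed h F))) (cong (λ z → z + - + α M F) (sym (exponent-closed F))))
    where
    if-bit : ∀ t → (if t then + 1 else + 0) ≡ + bit t
    if-bit true = refl
    if-bit false = refl
    arith : ∀ k a c → k - a - c ≡ k - c + - a
    arith = solve-∀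

  power-length : ∀ {a} {A : Set a} y (L : List A) → y ^ℤ (- + length L) ≈ ∏ₛ.∏ L (λ _ → y ⁻¹)
  power-length y [] = ≈-refl
  power-length y (z ∷ L) = ≈-trans (≈-reflexive (cong (y ^ℤ_) (ℤ.neg-suc (length L))))
                             (≈-trans (^ℤ-pred y (- + length L)) (∙-congˡ (power-length y L)))

  module _ {M : List Edge} (uM : Unique M) (M⊆ : ∀ {e} → e ∈ M → e ∈ es) where

    faceFactor : Face → Edge → Carrier
    faceFactor F e = if does (F ∈F? faces h e) then x h F ⁻¹ else 1#

    face-power : ∀ F → x h F ^ℤ (- + α M F) ≈ ∏ₛ.∏ M (faceFactor F)
    face-power F@(k , l) = ≈-trans (power-length (x h F) (filter (MemE._∈? M) (bd F)))
        (≈-trans (∏ₛ.∏-↭ (λ _ → x h F ⁻¹) (unique-↭ (Unique.filter⁺ (MemE._∈? M) (boundary-unique k l)) (Unique.filter⁺ on? uM) to from))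
          (∏ₛ.∏-filter on? M (λ _ → x h F ⁻¹)))
      where
      on? = λ e → F ∈F? faces h e
      to : ∀ {e} → e ∈ filter (MemE._∈? M) (bd F) → e ∈ filter on? M
      to {e} e∈ with ∈-filter⁻ (MemE._∈? M) {xs = bd F} e∈
      ... | e∈bd , e∈M = ∈-filter⁺ on? e∈M (boundary⇒faces e k l e∈bd)
      from : ∀ {e} → e ∈ filter on? M → e ∈ filter (MemE._∈? M) (bd F)
      from {e} e∈ with ∈-filter⁻ on? e∈
      ... | e∈M , F∈ = ∈-filter⁺ (MemE._∈? M) (faces⇒boundary e k l F∈) e∈M

    faces⊆fs : ∀ {e} → e ∈ es → ∀ {F} → F ∈ faces h e → F ∈ fs
    faces⊆fs {e} e∈ {k , l} F∈ = Equivalence.from (∈fs⇔ (k , l)) (closed-or-open (closed? (k , l)))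
      where
      closed-or-open : Dec (ClosedFace (k , l)) → FaceOfG (k , l)
      closed-or-open (yes cl) = inj₁ cl
      closed-or-open (no ¬cl) = inj₂ (¬cl , e , faces⇒boundary e k l F∈ , Equivalence.to (∈es⇔ e) e∈)

    edge-faces : ∀ {e} → e ∈ es → ∏ₛ.∏ fs (λ F → faceFactor F e) ≈ ∏ₛ.∏ (faces h e) (λ F → x h F ⁻¹)
    edge-faces {e} e∈ = ≈-trans (≈-sym (∏ₛ.∏-filter (_∈F? faces h e) fs (λ F → x h F ⁻¹)))
        (∏ₛ.∏-↭ (λ F → x h F ⁻¹) (unique-↭ (Unique.filter⁺ (_∈F? faces h e) ufs) (faces-unique e)
          (λ F∈ → proj₂ (∈-filter⁻ (_∈F? faces h e) {xs = fs} F∈)) (λ F∈ → ∈-filter⁺ (_∈F? faces h e) (faces⊆fs e∈ F∈) F∈)))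

    λ′-label : ∀ e → λ′ e ≡ labelOf h e
    λ′-label (hE i j) with h i j ℤ.<? h (i + + 1) j
    ... | yes _ = refl
    ... | no _ = refl
    λ′-label (vE i j) with h i j ℤ.<? h i (j + + 1)
    ... | yes _ = refl
    ... | no _ = refl
    λ′-label (dE i j) = refl

    prod-map : ∀ {a} {A : Set a} {g g′ : A → Carrier} (L : List A) → (∀ y → g y ≈ g′ y) → prod (map g L) ≈ ∏ₛ.∏ L g′
    prod-map [] eq = ≈-refl
    prod-map (y ∷ L) eq = ∙-cong (eq y) (prod-map L eq)

    -- The negative power of each face value is a product over the edges of `M` on that face.
    -- Exchanging the two products collects at each edge the inverses of the values at its own
    -- faces, all of which are listed in `fs`.
    term-weight : term M ≈ ∏ₛ.∏ fs (λ F → x h F ^ℤ exponent h F) * ∏ₛ.∏ M (weightOf h)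
    term-weight = begin
      term M
        ≈⟨ ∙-cong (prod-map M (λ e → ≈-reflexive (λ′-label e))) (prod-map fs (λ { (k , l) → face-term k l })) ⟩
      ∏ₛ.∏ M (labelOf h) * ∏ₛ.∏ fs (λ F → x h F ^ℤ exponent h F * ∏ₛ.∏ M (faceFactor F))
        ≈⟨ ∙-congˡ (∏ₛ.∏-∙ fs _ _) ⟩
      ∏ₛ.∏ M (labelOf h) * (∏ₛ.∏ fs (λ F → x h F ^ℤ exponent h F) * ∏ₛ.∏ fs (λ F → ∏ₛ.∏ M (faceFactor F)))
        ≈⟨ ∙-congˡ (∙-congˡ (≈-trans (∏ₛ.∏-swap fs M faceFactor) (∏ₛ.∏-cong M (λ e∈ → edge-faces (M⊆ e∈))))) ⟩
      ∏ₛ.∏ M (labelOf h) * (∏ₛ.∏ fs (λ F → x h F ^ℤ exponent h F) * ∏ₛ.∏ M (λ e → ∏ₛ.∏ (faces h e) (λ F → x h F ⁻¹)))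
        ≈⟨ monomial (_ ∷ _ ∷ _ ∷ []) (v₀ · (v₁ · v₂)) (v₁ · (v₀ · v₂)) refl ⟩
      ∏ₛ.∏ fs (λ F → x h F ^ℤ exponent h F) * (∏ₛ.∏ M (labelOf h) * ∏ₛ.∏ M (λ e → ∏ₛ.∏ (faces h e) (λ F → x h F ⁻¹)))
        ≈⟨ ∙-congˡ (∏ₛ.∏-∙ M (labelOf h) _) ⟨
      ∏ₛ.∏ fs (λ F → x h F ^ℤ exponent h F) * ∏ₛ.∏ M (weightOf h) ∎
      where
      open SetoidReasoning setoid
      face-term : ∀ k l → x₀ k l ^ℤ ε M (k , l) ≈ x h (k , l) ^ℤ exponent h (k , l) * ∏ₛ.∏ M (faceFactor (k , l))
      face-term k l = ≈-trans (^ℤ-cong (ε M (k , l)) (≈-sym (initial k l)))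
        (≈-trans (≈-reflexive (cong (x h (k , l) ^ℤ_) (ε-exponent M⊆ (k , l))))
        (≈-trans (^ℤ-+ (x h (k , l)) (exponent h (k , l)) (- + α M (k , l))) (∙-congˡ (face-power (k , l)))))

-- The matching sum as a partition function

module MatchingSum {c ℓ} (S : Semifield c ℓ) (x₀ a b cc d : ℤ → ℤ → Semifield.Carrier S)
    (f : ℤ → ℤ → ℤ → Semifield.Carrier S) (h : ℤ → ℤ → ℤ) (n₀ i₀ j₀ : ℤ)
    (initial : ∀ i j → Semifield._≈_ S (f (h i j) i j) (x₀ i j))
    (apexClosed : Cone.isClosed n₀ i₀ j₀ h (i₀ , j₀) ≡ true)
    (es : List Edge) (ues : Unique es) (∈es⇔ : ∀ e → (e ∈ es) ⇔ Subgraph.EdgeOfG h n₀ i₀ j₀ e)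
    (fs : List Face) (ufs : Unique fs) (∈fs⇔ : ∀ F → (F ∈ fs) ⇔ Subgraph.FaceOfG h n₀ i₀ j₀ F)
    (B : List Face) (uB : Unique B)
    (closed∈B : ∀ {F} → Subgraph.ClosedFace h n₀ i₀ j₀ F → F ∈ B)
    (faces∈B : ∀ {e} → e ∈ es → ∀ {F} → F ∈ Cone.faces n₀ i₀ j₀ h e → F ∈ B)
    (blocks∈B : ∀ {e} → e ∈ es → ∀ {i j t} → vertex i j t ∈ ends h e → (i , j) ∈ B)
    (edges∈B : ∀ {e} → e ∈ es → e ∈ sides B ++ map diagonal B) where
  open Semifield S
  open SF S
  open SemifieldProperties S
  open FlipAlgebra S
  open Cone n₀ i₀ j₀
  open Degrees n₀ i₀ j₀
  open PartitionFunction S a b cc d f n₀ i₀ j₀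
  open Constants S a b cc d f n₀ i₀ j₀
  open Vanishing S a b cc d f n₀ i₀ j₀
  open Incidence h n₀ i₀ j₀
  open Matchings es ∈es⇔
  open MatchingWeights S x₀ a b cc d f h n₀ i₀ j₀ initial apexClosed es ∈es⇔ fs ufs ∈fs⇔
  open Subgraph h n₀ i₀ j₀
  open WithEdges es
  open Weights S x₀ a b cc d fs

  allEdges : List Edge
  allEdges = sides B ++ map diagonal B

  diagonals-unique : Unique (map diagonal B)
  diagonals-unique = Unique.map⁺ (λ { refl → refl }) uB

  allEdges-unique : Unique allEdges
  allEdges-unique = Unique.++⁺ (sides-unique uB) diagonals-unique disjoint
    where
    disjoint : ∀ {e} → ¬ (e ∈ sides B × e ∈ map diagonal B)
    disjoint (e∈ , e∈d) with ∈-map⁻ diagonal e∈d | ∈-++⁻ (map horizontal B) e∈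
    ... | _ , _ , refl | inj₁ e∈h with ∈-map⁻ horizontal e∈h
    ...   | _ , _ , ()
    disjoint (e∈ , e∈d) | _ , _ , refl | inj₂ e∈v with ∈-map⁻ vertical e∈v
    ...   | _ , _ , ()

  sidesWeight : Assignment → Maybe Carrier
  sidesWeight σ = ∏ (sides B) (sideWeight h σ)

  blockTerm : Face → Assignment → Bool → Maybe Carrier
  blockTerm F σ t = just (weightOf h (diagonal F) ^ᵇ t) ⊗ [ admissibleBlock h F σ t ]

  fullWeight : Assignment → Maybe Carrier
  fullWeight σ = sidesWeight σ ⊗ ∏ B (λ F → blockTerm F σ (σ (diagonal F)))

  sidesWeight-ext : Extensional sidesWeight
  sidesWeight-ext eq = ∏-cong (sides B) (λ {e} _ → ≋-reflexive (cong (λ t → just (weightOf h e ^ᵇ t)) (eq e)))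

  blockTerm-ext : ∀ F {σ τ} → (∀ e → σ e ≡ τ e) → ∀ t → blockTerm F σ t ≋ blockTerm F τ t
  blockTerm-ext F eq t = ≋-reflexive (cong (λ p → just (weightOf h (diagonal F) ^ᵇ t) ⊗ [ p ]) (admissibleBlock-ext h F eq t))

  fullWeight-ext : Extensional fullWeight
  fullWeight-ext {σ} {τ} eq = *-cong (sidesWeight-ext eq) (∏-cong B (λ {F} _ →
    ≋-trans (blockTerm-ext F eq (σ (diagonal F))) (≋-reflexive (cong (blockTerm F τ) (eq (diagonal F))))))

  sidesWeight-put : ∀ G t σ → sidesWeight (put (diagonal G) t σ) ≋ sidesWeight σ
  sidesWeight-put G t σ = ∏-cong (sides B) λ e∈ → ≋-reflexive (unchanged e∈)
    where
    unchanged : ∀ {e} → e ∈ sides B → sideWeight h (put (diagonal G) t σ) e ≡ sideWeight h σ e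
    unchanged e∈ with ∈-++⁻ (map horizontal B) e∈
    ... | inj₁ e∈h with ∈-map⁻ horizontal e∈h
    ...   | _ , _ , refl = refl
    unchanged e∈ | inj₂ e∈v with ∈-map⁻ vertical e∈v
    ...   | _ , _ , refl = refl

  -- A diagonal enters the condition of its own block alone, so the sum over all diagonals factors
  -- over the blocks.
  sum-over-diagonals : ∀ σ → Sum (map diagonal B) fullWeight σ ≋ configWeight h B σ
  sum-over-diagonals σ = ≋-trans
    (Sum-factor diagonal B sidesWeight blockTerm diagonals-unique sidesWeight-ext blockTerm-ext
      sidesWeight-put (λ F G t τ t′ → ≋-refl) σ)
    (*-congˡ {sidesWeight σ} (∏-cong B (λ {F} _ →
      +-congʳ {just (weightOf h (diagonal F)) ⊗ [ admissibleBlock h F σ true ]} (*-identityˡ [ admissibleBlock h F σ false ]))))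

  outside⇒∉graph : ∀ e → e ∉ es → inGraph h e ≡ false
  outside⇒∉graph e e∉ with inGraph h e in eq
  ... | false = refl
  ... | true = ⊥-elim (e∉ (inGraph⇒∈es {e} eq))

  fullWeight-vanishes : ∀ {e} → e ∈ allEdges → e ∉ es → ∀ σ → σ e ≡ true → fullWeight σ ≋ nothing
  fullWeight-vanishes {e} e∈ e∉ σ σe = ≋-trans (*-congˡ {sidesWeight σ} (zero-factor (∈-++⁻ (sides B) e∈) σe)) (zeroʳ (sidesWeight σ))
    where
    Blocks = ∏ B (λ F → blockTerm F σ (σ (diagonal F)))
    zero-at : ∀ F → F ∈ B → admissibleBlock h F σ (σ (diagonal F)) ≡ false → Blocks ≋ nothing
    zero-at F F∈ eq = ∏-0 F∈ (λ F → blockTerm F σ (σ (diagonal F)))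
      (cong (λ p → just (weightOf h (diagonal F) ^ᵇ σ (diagonal F)) ⊗ [ p ]) eq)
    zero-factor : e ∈ sides B ⊎ e ∈ map diagonal B → σ e ≡ true → Blocks ≋ nothing
    zero-factor (inj₁ e∈s) σe with ∈-++⁻ (map horizontal B) e∈s
    ... | inj₁ e∈h with ∈-map⁻ horizontal e∈h
    ...   | (i , j) , F∈ , refl = zero-at (i , j) F∈ (horizontal-inadmissible h i j {σ} σe (outside⇒∉graph (hE i j) e∉) _)
    zero-factor (inj₁ e∈s) σe | inj₂ e∈v with ∈-map⁻ vertical e∈v
    ...   | (i , j) , F∈ , refl = zero-at (i , j) F∈ (vertical-inadmissible h i j {σ} σe (outside⇒∉graph (vE i j) e∉) _)
    zero-factor (inj₂ e∈d) σe with ∈-map⁻ diagonal e∈d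
    ... | (i , j) , F∈ , refl = zero-at (i , j) F∈
          (trans (cong (admissibleBlock h (i , j) σ) σe) (diagonal-inadmissible h i j σ (outside⇒∉graph (dE i j) e∉)))

  -- Diagonals become variables again, edges of the box outside the graph drop out because they make
  -- the weight vanish, and what remains is a sum over sublists of `es`.
  Zᴮ-subsets : Zᴮ h B ≋ ∑ (subsets es) (λ M → fullWeight (λ e → does (e MemE.∈? M) ∨ false))
  Zᴮ-subsets = begin
    Zᴮ h B                                                    ≈⟨ Sum-cong (sides B) sum-over-diagonals _ ⟨
    Sum (sides B) (Sum (map diagonal B) fullWeight) _         ≡⟨ Sum-++ (sides B) fullWeight _ ⟨
    Sum allEdges fullWeight (λ _ → false)
      ≈⟨ Sum-support ues allEdges-unique edges∈B fullWeight-ext fullWeight-vanishes ⟩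
    Sum es fullWeight (λ _ → false)                           ≈⟨ Sum-subsets h n₀ i₀ j₀ es es ues fullWeight-ext (λ _ → refl) ⟩
    ∑ (subsets es) (λ M → fullWeight (λ e → does (e MemE.∈? M) ∨ false)) ∎
    where open SetoidReasoning ≋-setoid

  -- A face of the box that is not a face of the graph is open and has no edge in the graph, so its
  -- exponent is zero.
  𝒞-faces : ∏ₛ.∏ fs (λ F → x h F ^ℤ exponent h F) ≈ 𝒞 h B
  𝒞-faces = ≈-sym (∏ₛ.∏-⊆ ufs uB fs⊆B outside)
    where
    fs⊆B : ∀ {F} → F ∈ fs → F ∈ B
    fs⊆B {F} F∈ with Equivalence.to (∈fs⇔ F) F∈
    ... | inj₁ cl = closed∈B cl
    fs⊆B {k , l} F∈ | inj₂ (_ , e , e∈bd , eG) = faces∈B (Equivalence.from (∈es⇔ e) eG) (boundary⇒faces e k l e∈bd)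
    outside : ∀ {F} → F ∈ B → F ∉ fs → x h F ^ℤ exponent h F ≈ 1#
    outside {k , l} _ F∉ = ≈-reflexive (cong (x h (k , l) ^ℤ_) (trans (exponent-closed (k , l))
        (cong₂ (λ n t → + ⌈ n /2⌉ - + bit t) no-edges (dec-false (closed? (k , l)) not-closed))))
      where
      not-closed : ¬ ClosedFace (k , l)
      not-closed cl = F∉ (Equivalence.from (∈fs⇔ (k , l)) (inj₁ cl))
      none : ∀ L → (∀ {e} → e ∈ L → inGraph h e ≡ false) → count (inGraph h) L ≡ 0
      none [] _ = refl
      none (e ∷ L) eq rewrite eq {e} (here refl) = none L (eq ∘ there)
      no-edges : degree h (k , l) ≡ 0
      no-edges = none (boundary h k l) λ {e} e∈ → outside⇒∉graph e λ e∈es →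
        F∉ (Equivalence.from (∈fs⇔ (k , l)) (inj₂ (not-closed , e , e∈ , Equivalence.to (∈es⇔ e) e∈es)))

  ∏-indicator-all : ∀ {a} {A : Set a} (L : List A) (p : A → Bool) → (∀ {y} → y ∈ L → p y ≡ true) → ∏ L (λ y → [ p y ]) ≋ just 1#
  ∏-indicator-all L p eq = ∏-1 L (λ y∈ → ≋-reflexive (cong [_] (eq y∈)))

  ∏-indicator : ∀ {a} {A : Set a} (L : List A) (p : A → Bool) → (∀ {y} → y ∈ L → p y ≡ true) ⊎ ∏ L (λ y → [ p y ]) ≋ nothing
  ∏-indicator [] p = inj₁ λ ()
  ∏-indicator (y ∷ L) p with p y in eq
  ... | false = inj₂ Pointwise.nothing
  ... | true with ∏-indicator L p
  ...   | inj₁ all = inj₁ λ { (here refl) → eq ; (there z∈) → all z∈ }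
  ...   | inj₂ vanish = inj₂ (≋-trans (*-identityˡ _) vanish)

  module _ {M : List Edge} (M∈ : M ∈ subsets es) where
    private
      σ : Assignment
      σ e = does (e MemE.∈? M) ∨ false
      σ≡ : ∀ e → σ e ≡ does (e MemE.∈? M)
      σ≡ e = Bool.∨-identityʳ _
      uM : Unique M
      uM = subsets-unique es ues M∈
      M⊆ : ∀ {e} → e ∈ M → e ∈ es
      M⊆ = subsets-⊆ es M∈
      admissibleAt : Face → Bool
      admissibleAt F = admissibleBlock h F σ (σ (diagonal F))

    edgesWeight : ∏ allEdges (sideWeight h σ) ≋ just (∏ₛ.∏ M (weightOf h))
    edgesWeight = ≋-trans (∏-⊆ uM allEdges-unique (edges∈B ∘ M⊆) outside)
        (≋-trans (∏-cong M inside) (≋-sym (just-∏ M (weightOf h))))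
      where
      outside : ∀ {e} → e ∈ allEdges → e ∉ M → sideWeight h σ e ≋ just 1#
      outside {e} _ e∉ = ≋-reflexive (cong (λ t → just (weightOf h e ^ᵇ t)) (trans (σ≡ e) (dec-false (e MemE.∈? M) e∉)))
      inside : ∀ {e} → e ∈ M → sideWeight h σ e ≋ just (weightOf h e)
      inside {e} e∈ = ≋-reflexive (cong (λ t → just (weightOf h e ^ᵇ t)) (trans (σ≡ e) (dec-true (e MemE.∈? M) e∈)))

    fullWeight-M : fullWeight σ ≋ just (∏ₛ.∏ M (weightOf h)) ⊗ ∏ B (λ F → [ admissibleAt F ])
    fullWeight-M = begin
      sidesWeight σ ⊗ ∏ B (λ F → sideWeight h σ (diagonal F) ⊗ [ admissibleAt F ])
        ≈⟨ *-congˡ {sidesWeight σ} (∏-∙ B (sideWeight h σ ∘ diagonal) _) ⟩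
      sidesWeight σ ⊗ (∏ B (sideWeight h σ ∘ diagonal) ⊗ ∏ B (λ F → [ admissibleAt F ]))
        ≈⟨ *-assoc (sidesWeight σ) (∏ B (sideWeight h σ ∘ diagonal)) _ ⟨
      (sidesWeight σ ⊗ ∏ B (sideWeight h σ ∘ diagonal)) ⊗ ∏ B (λ F → [ admissibleAt F ])
        ≡⟨ cong (λ z → (sidesWeight σ ⊗ z) ⊗ ∏ B (λ F → [ admissibleAt F ])) (∏-map diagonal B (sideWeight h σ)) ⟨
      (sidesWeight σ ⊗ ∏ (map diagonal B) (sideWeight h σ)) ⊗ ∏ B (λ F → [ admissibleAt F ])
        ≈⟨ *-congʳ {∏ B (λ F → [ admissibleAt F ])} (≋-trans (≋-sym (∏-++ (sides B) (sideWeight h σ))) edgesWeight) ⟩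
      just (∏ₛ.∏ M (weightOf h)) ⊗ ∏ B (λ F → [ admissibleAt F ]) ∎
      where open SetoidReasoning ≋-setoid

    summand : just (𝒞 h B) ⊗ fullWeight σ ≋ (if does (isPerfectMatching? M) then just (term M) else nothing)
    summand = ≋-trans (*-congˡ {just (𝒞 h B)} fullWeight-M) (decide (isPerfectMatching? M))
      where
      characterise : ∀ i j → admissibleAt (i , j) ≡ _
      characterise i j = admissible-vertices σ i j
      indicators = ∏ B (λ F → [ admissibleAt F ])
      w = just (∏ₛ.∏ M (weightOf h))
      decide : (pm? : Dec (IsPerfectMatching M)) → just (𝒞 h B) ⊗ (w ⊗ indicators) ≋ (if does pm? then just (term M) else nothing)
      decide (yes pm) = ≋-trans
        (*-congˡ {just (𝒞 h B)} (*-congˡ {w} (∏-indicator-all B admissibleAt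
          (λ { {i , j} _ → trans (characterise i j) (matching⇒admissible uM M⊆ σ≡ pm i j) }))))
        (Pointwise.just (≈-trans (∙-congˡ (identityʳ _)) (≈-sym (≈-trans (term-weight uM M⊆) (∙-congʳ 𝒞-faces)))))
      decide (no ¬pm) with ∏-indicator B admissibleAt
      ... | inj₂ vanish = *-congˡ {just (𝒞 h B)} (*-congˡ {w} vanish)
      -- Every vertex of the graph lies in a block of the box; if all these blocks were admissible,
      -- `M` would be a perfect matching.
      ... | inj₁ all = ⊥-elim (¬pm (admissible⇒matching uM M⊆ σ≡ λ {e} {i} {j} e∈ v∈ →
              proj₂ (∧-true {allᵇ (λ e → σ e ⇒ inGraph h e) (blockEdges i j)} (trans (sym (characterise i j)) (all (blocks∈B e∈ v∈))))))

  ∑-terms : ∑ terms just ≋ just (𝒞 h B) ⊗ Zᴮ h B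
  ∑-terms = begin
    ∑ terms just                                        ≡⟨ ∑-map term perfectMatchings just ⟩
    ∑ perfectMatchings (just ∘ term)                    ≈⟨ ∑-filter isPerfectMatching? (subsets es) (just ∘ term) ⟩
    ∑ (subsets es) (λ M → if does (isPerfectMatching? M) then just (term M) else nothing)
      ≈⟨ ∑-cong (subsets es) (λ M∈ → summand M∈) ⟨
    ∑ (subsets es) (λ M → just (𝒞 h B) ⊗ fullWeight (λ e → does (e MemE.∈? M) ∨ false))
      ≈⟨ ∑-*ˡ (subsets es) (just (𝒞 h B)) _ ⟨
    just (𝒞 h B) ⊗ ∑ (subsets es) (λ M → fullWeight (λ e → does (e MemE.∈? M) ∨ false))
      ≈⟨ *-congˡ {just (𝒞 h B)} Zᴮ-subsets ⟨
    just (𝒞 h B) ⊗ Zᴮ h B ∎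
    where open SetoidReasoning ≋-setoid

-- Boxes

range : ℕ → List ℤ
range r = map +_ (upTo (ℕ.suc r)) ++ map -[1+_] (upTo r)

range-unique : ∀ r → Unique (range r)
range-unique r = Unique.++⁺ (Unique.map⁺ ℤ.+-injective (Unique.upTo⁺ (ℕ.suc r))) (Unique.map⁺ ℤ.-[1+-injective (Unique.upTo⁺ r)) disjoint
  where
  disjoint : ∀ {z} → ¬ (z ∈ map +_ (upTo (ℕ.suc r)) × z ∈ map -[1+_] (upTo r))
  disjoint (p , q) with ∈-map⁻ +_ p | ∈-map⁻ -[1+_] q
  ... | _ , _ , refl | _ , _ , ()

∈-range : ∀ {r} z → ∣ z ∣ ℕ.≤ r → z ∈ range r
∈-range (+ n) n≤r = ∈-++⁺ˡ (∈-map⁺ +_ (∈-upTo⁺ (ℕ.s≤s n≤r)))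
∈-range {r} -[1+ n ] n<r = ∈-++⁺ʳ (map +_ (upTo (ℕ.suc r))) (∈-map⁺ -[1+_] (∈-upTo⁺ n<r))

box : ℕ → List Face
box r = cartesianProduct (range r) (range r)

box-unique : ∀ r → Unique (box r)
box-unique r = Unique.cartesianProduct⁺ (range-unique r) (range-unique r)

∈-box : ∀ {r i j} → ∣ i ∣ ℕ.≤ r → ∣ j ∣ ℕ.≤ r → (i , j) ∈ box r
∈-box {i = i} {j} i≤ j≤ = ∈-cartesianProduct⁺ (∈-range i i≤) (∈-range j j≤)

widen : ∀ {r} z t → ∣ t ∣ ℕ.≤ 1 → ∣ z ∣ ℕ.≤ r → ∣ z + t ∣ ℕ.≤ ℕ.suc r
widen {r} z t t≤ z≤ = ℕ.≤-trans (ℤ.∣i+j∣≤∣i∣+∣j∣ z t) (ℕ.≤-trans (ℕ.+-mono-≤ z≤ t≤) (ℕ.≤-reflexive (ℕ.+-comm r 1)))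

module ConeInBox (h : ℤ → ℤ → ℤ) (n₀ i₀ j₀ : ℤ) (r : ℕ)
                 (bounded : ∀ i j → h i j ℤ.< pyr n₀ i₀ j₀ i j → ∣ i ∣ ℕ.≤ r × ∣ j ∣ ℕ.≤ r) where
  open Cone n₀ i₀ j₀
  open Degrees n₀ i₀ j₀
  open Incidence h n₀ i₀ j₀
  open Subgraph h n₀ i₀ j₀

  -- One layer more than the closed faces occupy: in each coordinate the open faces of the graph and
  -- the blocks around a closed face are at distance at most one from it.
  B : List Face
  B = box (ℕ.suc r)

  Corner∈ : ℤ → ℤ → Set
  Corner∈ z k = k ≡ z ⊎ k ≡ z + + 1

  corner-bounds : ∀ {z k} → Corner∈ z k → ∣ k ∣ ℕ.≤ r → ∣ z ∣ ℕ.≤ ℕ.suc r × ∣ z + + 1 ∣ ℕ.≤ ℕ.suc r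
  corner-bounds {z} (inj₁ refl) k≤ = ℕ.m≤n⇒m≤1+n k≤ , widen z (+ 1) ℕ.≤-refl k≤
  corner-bounds {z} (inj₂ refl) k≤ = subst (λ y → ∣ y ∣ ℕ.≤ ℕ.suc r) (+1-1 z) (widen (z + + 1) (- + 1) ℕ.≤-refl k≤) , ℕ.m≤n⇒m≤1+n k≤

  corner∈ : ∀ {z k} → Corner∈ z k → ∣ z ∣ ℕ.≤ ℕ.suc r × ∣ z + + 1 ∣ ℕ.≤ ℕ.suc r → ∣ k ∣ ℕ.≤ ℕ.suc r
  corner∈ (inj₁ refl) = proj₁
  corner∈ (inj₂ refl) = proj₂

  face-corner : ∀ {i j e k l} → e ∈ blockEdges i j → (k , l) ∈ faces h e → Corner∈ i k × Corner∈ j l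
  face-corner (here refl) (here refl) = inj₁ refl , inj₁ refl
  face-corner (here refl) (there (here refl)) = inj₂ refl , inj₁ refl
  face-corner (there (here refl)) (here refl) = inj₂ refl , inj₁ refl
  face-corner (there (here refl)) (there (here refl)) = inj₂ refl , inj₂ refl
  face-corner (there (there (here refl))) (here refl) = inj₁ refl , inj₂ refl
  face-corner (there (there (here refl))) (there (here refl)) = inj₂ refl , inj₂ refl
  face-corner (there (there (there (here refl)))) (here refl) = inj₁ refl , inj₁ refl
  face-corner (there (there (there (here refl)))) (there (here refl)) = inj₁ refl , inj₂ refl
  face-corner {i} {j} (there (there (there (there (here refl))))) F∈ with kind h i j
  face-corner (there (there (there (there (here refl))))) (here refl) | wrenchMain = inj₁ refl , inj₁ refl
  face-corner (there (there (there (there (here refl))))) (there (here refl)) | wrenchMain = inj₂ refl , inj₂ refl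
  face-corner (there (there (there (there (here refl))))) (here refl) | wrenchAnti = inj₂ refl , inj₁ refl
  face-corner (there (there (there (there (here refl))))) (there (here refl)) | wrenchAnti = inj₁ refl , inj₂ refl

  leg∈blockEdges : ∀ k t i j {e} → e ∈ legs k t i j → e ∈ blockEdges i j
  leg∈blockEdges cross centre i j e∈ = ∈-++⁺ˡ e∈
  leg∈blockEdges wrenchMain (at c10) i j (here refl) = here refl
  leg∈blockEdges wrenchMain (at c10) i j (there (here refl)) = there (here refl)
  leg∈blockEdges wrenchMain (at c10) i j (there (there (here refl))) = there (there (there (there (here refl))))
  leg∈blockEdges wrenchMain (at c01) i j (here refl) = there (there (there (here refl)))
  leg∈blockEdges wrenchMain (at c01) i j (there (here refl)) = there (there (here refl))
  leg∈blockEdges wrenchMain (at c01) i j (there (there (here refl))) = there (there (there (there (here refl))))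
  leg∈blockEdges wrenchAnti (at c00) i j (here refl) = here refl
  leg∈blockEdges wrenchAnti (at c00) i j (there (here refl)) = there (there (there (here refl)))
  leg∈blockEdges wrenchAnti (at c00) i j (there (there (here refl))) = there (there (there (there (here refl))))
  leg∈blockEdges wrenchAnti (at c11) i j (here refl) = there (here refl)
  leg∈blockEdges wrenchAnti (at c11) i j (there (here refl)) = there (there (here refl))
  leg∈blockEdges wrenchAnti (at c11) i j (there (there (here refl))) = there (there (there (there (here refl))))

  Bounds : ℤ → ℤ → Set
  Bounds i j = (∣ i ∣ ℕ.≤ ℕ.suc r × ∣ i + + 1 ∣ ℕ.≤ ℕ.suc r) × (∣ j ∣ ℕ.≤ ℕ.suc r × ∣ j + + 1 ∣ ℕ.≤ ℕ.suc r)

  block-bounds : ∀ {i j e} → e ∈ blockEdges i j → inGraph h e ≡ true → Bounds i j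
  block-bounds {e = e} e∈ eq with ∈-anyᵇ (isClosed h) (faces h e) eq
  ... | (k , l) , F∈ , cl with face-corner e∈ F∈ | bounded k l (true⇒closed (k , l) cl)
  ...   | ki , lj | k≤ , l≤ = corner-bounds ki k≤ , corner-bounds lj l≤

  block∈ : ∀ {i j} → Bounds i j → (i , j) ∈ B
  block∈ ((i≤ , _) , (j≤ , _)) = ∈-box i≤ j≤

  own-block : ∀ e → ∃[ i ] ∃[ j ] e ∈ blockEdges i j × (∀ {C} → (i , j) ∈ C → e ∈ sides C ++ map diagonal C)
  own-block (hE i j) = i , j , here refl , (λ F∈ → ∈-++⁺ˡ (horizontal∈ F∈))
  own-block (vE i j) = i , j , there (there (there (here refl))) , (λ F∈ → ∈-++⁺ˡ (vertical∈ F∈))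
  own-block (dE i j) = i , j , there (there (there (there (here refl)))) , (λ {C} F∈ → ∈-++⁺ʳ (sides C) (∈-map⁺ diagonal F∈))

  closed∈ : ∀ {F} → ClosedFace F → F ∈ B
  closed∈ {k , l} cl with bounded k l cl
  ... | k≤ , l≤ = ∈-box (ℕ.m≤n⇒m≤1+n k≤) (ℕ.m≤n⇒m≤1+n l≤)

  edge∈ : ∀ {e} → inGraph h e ≡ true → e ∈ sides B ++ map diagonal B
  edge∈ {e} eq with own-block e
  ... | i , j , e∈ , place = place (block∈ (block-bounds {e = e} e∈ eq))

  face∈ : ∀ {e} → inGraph h e ≡ true → ∀ {F} → F ∈ faces h e → F ∈ B
  face∈ {e} eq {k , l} F∈ with own-block e
  ... | i , j , e∈ , _ with face-corner e∈ F∈ | block-bounds {e = e} e∈ eq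
  ...   | ki , lj | bi , bj = ∈-box (corner∈ ki bi) (corner∈ lj bj)

  vertex-block∈ : ∀ {e} → inGraph h e ≡ true → ∀ {i j t} → vertex i j t ∈ ends h e → (i , j) ∈ B
  vertex-block∈ {e} eq {i} {j} {t} v∈ =
    block∈ (block-bounds {e = e} (leg∈blockEdges (kind h i j) t i j (ends⇒legs e v∈)) eq)

  neighbourhood∈ : ∀ i j → h (i + + 1) (j + + 1) ℤ.< pyr n₀ i₀ j₀ (i + + 1) (j + + 1) →
    All (_∈ B) ((i , j) ∷ (i + + 1 , j + + 1) ∷ (i , j + + 1) ∷ (i + + 1 + + 1 , j + + 1) ∷ (i + + 1 , j) ∷ (i + + 1 , j + + 1 + + 1) ∷ [])
  neighbourhood∈ i j cl with bounded (i + + 1) (j + + 1) cl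
  ... | I≤ , J≤ = ∈-box i≤ j≤ ∷ ∈-box I≤′ J≤′ ∷ ∈-box i≤ J≤′ ∷ ∈-box (widen (i + + 1) (+ 1) ℕ.≤-refl I≤) J≤′ ∷
                  ∈-box I≤′ j≤ ∷ ∈-box I≤′ (widen (j + + 1) (+ 1) ℕ.≤-refl J≤) ∷ []
    where
    i≤ = proj₁ (corner-bounds {i} (inj₂ refl) I≤)
    j≤ = proj₁ (corner-bounds {j} (inj₂ refl) J≤)
    I≤′ = ℕ.m≤n⇒m≤1+n I≤
    J≤′ = ℕ.m≤n⇒m≤1+n J≤

-- Comparison and boundedness of cones

triangle : ∀ k i i′ → + ∣ k - i ∣ ≤ + ∣ k - i′ ∣ + + ∣ i′ - i ∣
triangle k i i′ = ℤ.+≤+ (subst (λ z → ∣ z ∣ ℕ.≤ ∣ k - i′ ∣ ℕ.+ ∣ i′ - i ∣) (split k i i′) (ℤ.∣i+j∣≤∣i∣+∣j∣ (k - i′) (i′ - i)))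
  where
  split : ∀ k i i′ → k - i′ + (i′ - i) ≡ k - i
  split = solve-∀

-- The triangle inequality in each coordinate: a smaller apex inside the cone has its whole pyramid
-- below the larger one.
pyr-monotone : ∀ n i j n′ i′ j′ → n′ ≤ pyr n i j i′ j′ → ∀ k l → pyr n′ i′ j′ k l ≤ pyr n i j k l
pyr-monotone n i j n′ i′ j′ n′≤ k l = begin
    n′ - + ∣ k - i′ ∣ - + ∣ l - j′ ∣
      ≤⟨ ℤ.+-monoˡ-≤ (- + ∣ l - j′ ∣) (ℤ.+-monoˡ-≤ (- + ∣ k - i′ ∣) n′≤) ⟩
    n - + ∣ i′ - i ∣ - + ∣ j′ - j ∣ - + ∣ k - i′ ∣ - + ∣ l - j′ ∣
      ≡⟨ arith n (+ ∣ i′ - i ∣) (+ ∣ j′ - j ∣) (+ ∣ k - i′ ∣) (+ ∣ l - j′ ∣) ⟩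
    n - (+ ∣ k - i′ ∣ + + ∣ i′ - i ∣) - (+ ∣ l - j′ ∣ + + ∣ j′ - j ∣)
      ≤⟨ ℤ.+-mono-≤ (ℤ.+-monoʳ-≤ n (ℤ.neg-mono-≤ (triangle k i i′))) (ℤ.neg-mono-≤ (triangle l j j′)) ⟩
    n - + ∣ k - i ∣ - + ∣ l - j ∣ ∎
  where
  open ℤ.≤-Reasoning
  arith : ∀ n a b c d → n - a - b - c - d ≡ n - (c + a) - (d + b)
  arith = solve-∀

-- By the triangle inequality a closed face has height plus distance from the origin below `n₀` plus
-- the distance of the apex from the origin. The growth condition at this constant bounds such
-- faces.
cone-bounded : ∀ h n₀ i₀ j₀ → IsHeightFunction h →
  ∃[ r ] ∀ i j → h i j ℤ.< pyr n₀ i₀ j₀ i j → ∣ i ∣ ℕ.≤ r × ∣ j ∣ ℕ.≤ r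
cone-bounded h n₀ i₀ j₀ isHeight with IsHeightFunction.growth isHeight (n₀ + + ∣ i₀ ∣ + + ∣ j₀ ∣)
... | r , grows = r , bounded
  where
  origin : ∀ k i → + ∣ k ∣ ≤ + ∣ k - i ∣ + + ∣ i ∣
  origin k i = ℤ.+≤+ (subst (λ z → ∣ z ∣ ℕ.≤ ∣ k - i ∣ ℕ.+ ∣ i ∣) (split k i) (ℤ.∣i+j∣≤∣i∣+∣j∣ (k - i) i))
    where
    split : ∀ k i → k - i + i ≡ k
    split = solve-∀
  inside : ∀ i j → h i j ℤ.< pyr n₀ i₀ j₀ i j → ∣ i ∣ ℕ.+ ∣ j ∣ ℕ.< r
  inside i j lt = ℕ.≰⇒> λ r≤ → ℤ.<-irrefl refl (begin-strict
      n₀ + + ∣ i₀ ∣ + + ∣ j₀ ∣                     ≤⟨ grows i j r≤ ⟩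
      h i j + + ∣ i ∣ + + ∣ j ∣
        <⟨ ℤ.+-monoˡ-< (+ ∣ j ∣) (ℤ.+-monoˡ-< (+ ∣ i ∣) lt) ⟩
      n₀ - + ∣ i - i₀ ∣ - + ∣ j - j₀ ∣ + + ∣ i ∣ + + ∣ j ∣
        ≤⟨ ℤ.+-mono-≤ (ℤ.+-monoʳ-≤ (n₀ - + ∣ i - i₀ ∣ - + ∣ j - j₀ ∣) (origin i i₀)) (origin j j₀) ⟩
      n₀ - + ∣ i - i₀ ∣ - + ∣ j - j₀ ∣ + (+ ∣ i - i₀ ∣ + + ∣ i₀ ∣) + (+ ∣ j - j₀ ∣ + + ∣ j₀ ∣)
        ≡⟨ arith n₀ (+ ∣ i - i₀ ∣) (+ ∣ j - j₀ ∣) (+ ∣ i₀ ∣) (+ ∣ j₀ ∣) ⟩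
      n₀ + + ∣ i₀ ∣ + + ∣ j₀ ∣ ∎)
    where
    open ℤ.≤-Reasoning
    arith : ∀ n a b c d → n - a - b + (a + c) + (b + d) ≡ n + c + d
    arith = solve-∀
  bounded : ∀ i j → h i j ℤ.< pyr n₀ i₀ j₀ i j → ∣ i ∣ ℕ.≤ r × ∣ j ∣ ℕ.≤ r
  bounded i j lt = ℕ.≤-trans (ℕ.m≤m+n ∣ i ∣ ∣ j ∣) (ℕ.<⇒≤ (inside i j lt)) ,
                   ℕ.≤-trans (ℕ.m≤n+m ∣ j ∣ ∣ i ∣) (ℕ.<⇒≤ (inside i j lt))

mainTheorem2 : ∀ {lc lℓ : Level} (h : ℤ → ℤ → ℤ) → IsHeightFunction h →
    ( (S : Semifield lc lℓ) (x a b c d : ℤ → ℤ → Semifield.Carrier S)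
    (f : ℤ → ℤ → ℤ → Semifield.Carrier S) →
    OctahedronRecurrence S h x a b c d f →
    ∀ n i j → InU h n i j →
    (es : List Edge) → Unique es → (∀ e → (e ∈ es) ⇔ Subgraph.EdgeOfG h n i j e) →
    (fs : List Face) → Unique fs → (∀ F → (F ∈ fs) ⇔ Subgraph.FaceOfG h n i j F) →
    SF.SumsTo S (Subgraph.WithEdges.Weights.terms h n i j es S x a b c d fs) (f n i j) )
    ×
    ( ∀ n i j n′ i′ j′ → InU h n i j → InU h n′ i′ j′ → n′ ≤ pyr n i j i′ j′ →
    (∀ v → Subgraph.VertexOfG h n′ i′ j′ v → Subgraph.VertexOfG h n i j v) ×
    (∀ e → Subgraph.EdgeOfG h n′ i′ j′ e → Subgraph.EdgeOfG h n i j e) ×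
    (∀ F → Subgraph.FaceOfG h n′ i′ j′ F → Subgraph.FaceOfG h n i j F) )
mainTheorem2 h isHeight = matching-formula , nesting
  where
  open IsHeightFunction isHeight

  matching-formula : (S : Semifield _ _) (x a b c d : ℤ → ℤ → Semifield.Carrier S)
    (f : ℤ → ℤ → ℤ → Semifield.Carrier S) → OctahedronRecurrence S h x a b c d f → ∀ n i j → InU h n i j →
    (es : List Edge) → Unique es → (∀ e → (e ∈ es) ⇔ Subgraph.EdgeOfG h n i j e) →
    (fs : List Face) → Unique fs → (∀ F → (F ∈ fs) ⇔ Subgraph.FaceOfG h n i j F) →
    SF.SumsTo S (Subgraph.WithEdges.Weights.terms h n i j es S x a b c d fs) (f n i j)
  matching-formula S x a b c d f recurrence n i j (inL , h<n) es ues ∈es⇔ fs ufs ∈fs⇔ with cone-bounded h n i j isHeight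
  -- The induction starts at `h` itself, with its own `measure` as fuel.
  ... | r , bounded = ∑⇒SumsTo (Subgraph.WithEdges.Weights.terms h n i j es S x a b c d fs) (≋-trans ∑-terms
      (evaluation apex∈B inL neighbourhood∈ (measure h) h good ℕ.≤-refl))
    where
    open SemifieldProperties S
    open ConeInBox h n i j r bounded
    open Incidence h n i j
    open Matchings es ∈es⇔
    open Induct S h x a b c d f recurrence n i j B (box-unique (ℕ.suc r))
    apexClosed : h i j ℤ.< pyr n i j i j
    apexClosed rewrite ℤ.+-inverseʳ i | ℤ.+-inverseʳ j = subst (h i j ℤ.<_) (sym (trans (ℤ.+-identityʳ _) (ℤ.+-identityʳ n))) h<n
    apex∈B : (i , j) ∈ B
    apex∈B = closed∈ apexClosed
    good : Good h
    good = record { adjacent-heights = record { adjᵢ = adjᵢ ; adjⱼ = adjⱼ } ; parity = parity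
                  ; above = λ _ _ → ℤ.≤-refl ; below = ℤ.<⇒≤ h<n }
    faces∈B : ∀ {e} → e ∈ es → ∀ {F} → F ∈ Cone.faces n i j h e → F ∈ B
    faces∈B {e} e∈ = face∈ {e} (∈es⇒inGraph e∈)
    blocks∈B : ∀ {e} → e ∈ es → ∀ {i j t} → vertex i j t ∈ ends h e → (i , j) ∈ B
    blocks∈B {e} e∈ = vertex-block∈ {e} (∈es⇒inGraph e∈)
    edges∈B : ∀ {e} → e ∈ es → e ∈ sides B ++ map diagonal B
    edges∈B {e} e∈ = edge∈ {e} (∈es⇒inGraph e∈)
    open MatchingSum S x a b c d f h n i j (OctahedronRecurrence.initial recurrence) (closed⇒true (i , j) apexClosed)
      es ues ∈es⇔ fs ufs ∈fs⇔ B (box-unique (ℕ.suc r)) closed∈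
      faces∈B blocks∈B edges∈B

  nesting : ∀ n i j n′ i′ j′ → InU h n i j → InU h n′ i′ j′ → n′ ≤ pyr n i j i′ j′ →
    (∀ v → Subgraph.VertexOfG h n′ i′ j′ v → Subgraph.VertexOfG h n i j v) ×
    (∀ e → Subgraph.EdgeOfG h n′ i′ j′ e → Subgraph.EdgeOfG h n i j e) ×
    (∀ F → Subgraph.FaceOfG h n′ i′ j′ F → Subgraph.FaceOfG h n i j F)
  nesting n i j n′ i′ j′ _ _ n′≤ = vertices , edges , faces
    where
    open Subgraph h
    closed : ∀ F → ClosedFace n′ i′ j′ F → ClosedFace n i j F
    closed (k , l) lt = ℤ.<-≤-trans lt (pyr-monotone n i j n′ i′ j′ n′≤ k l)
    edges : ∀ e → EdgeOfG n′ i′ j′ e → EdgeOfG n i j e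
    edges e (isEdge , F , cl , e∈) = isEdge , F , closed F cl , e∈
    vertices : ∀ v → VertexOfG n′ i′ j′ v → VertexOfG n i j v
    vertices v (e , eG , v∈) = e , edges e eG , v∈
    faces : ∀ F → FaceOfG n′ i′ j′ F → FaceOfG n i j F
    faces F (inj₁ cl) = inj₁ (closed F cl)
    faces F (inj₂ (_ , e , e∈ , eG)) with closed? n i j F
    ... | yes cl = inj₁ cl
    ... | no ¬cl = inj₂ (¬cl , e , e∈ , edges e eG)
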